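{- For every $\varepsilon>0$ there exist $N\in\mathbb{N}$ and $\delta>0$ such that for every field $\mathsf{K}$ (uniformly in the characteristic) the following holds for any two distinct projective planes $P_1,P_2\subseteq\mathbb{P}^3(\mathsf{K})$. Suppose $X_1\subseteq P_1$, $X_2\subseteq P_2$ and $X_3\subseteq\mathbb{P}^3(\mathsf{K})\setminus(P_1\cup P_2)$ are finite sets with (1) $1\ll|X_1|=|X_2|=|X_3|$; (2) $|X_i|<p^{1/N}$ for $i=1,2,3$ if $\mathrm{char}(\mathsf{K})=p>0$; (3) $|X_3\cap P|\leq|X_3|^{1-\varepsilon}$ for every projective plane $P$ which intersects $P_1$ and $P_2$ in a common line; (4) $|X_i\cap\ell|\leq|X_i|^{1-\varepsilon}$ for every projective line $\ell\subseteq P_i$, for $i=1,2$, and $|X_3\cap\ell|\leq|X_3|^{1-\varepsilon}$ for every projective line $\ell\subseteq\mathbb{P}^3(\mathsf{K})$. Then \[|\{(x_1,x_2,x_3)\in X_1\times X_2\times X_3: x_1,x_2,x_3\text{ are distinct and collinear}\}|\leq|X_1|^{2-\delta}.\]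
   Context: "$1\ll|X_1|$" means $|X_1|$ is sufficiently large in terms of $\varepsilon$. -}

module Defs where

open import Level using (Level; _⊔_; Setω)
open import Algebra.Bundles using (CommutativeRing)
open import Data.Nat using (ℕ; zero; suc; _≤_; _<_; _^_) renaming (_*_ to _*ℕ_)
open import Data.Fin using (Fin) renaming (zero to fz; suc to fs)
open import Data.Product using (Σ; ∃; _×_; _,_)
open import Data.List using (List; length)
open import Data.List.Relation.Unary.All using (All)
open import Data.List.Relation.Unary.Unique.Propositional using (Unique)
open import Relation.Nullary using (¬_)
open import Relation.Binary.PropositionalEquality using (_≡_)

record Field (c ℓ : Level) : Set (Level.suc (c ⊔ ℓ)) where
  field
    commutativeRing : CommutativeRing c ℓ
  open CommutativeRing commutativeRing public
  field
    0≉1     : ¬ (0# ≈ 1#)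
    inverse : ∀ x → ¬ (x ≈ 0#) → Σ Carrier (λ y → (x * y) ≈ 1#)

module Proj {c ℓ : Level} (K : Field c ℓ) where
  open Field K

  _·1 : ℕ → Carrier
  zero ·1  = 0#
  suc n ·1 = 1# + (n ·1)

  HasCharacteristic : ℕ → Set ℓ
  HasCharacteristic p =
    (0 < p) × ((p ·1) ≈ 0#) × (∀ m → 0 < m → m < p → ¬ ((m ·1) ≈ 0#))

  Vec4 : Set c
  Vec4 = Fin 4 → Carrier

  -- a point of ℙ³(K): a nonzero vector of K⁴ (homogeneous coordinates)
  record Point : Set (c ⊔ ℓ) where
    constructor mkPoint
    field
      vec     : Vec4
      nonzero : ¬ (∀ i → vec i ≈ 0#)
  open Point public

  SamePoint : Point → Point → Set (c ⊔ ℓ)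
  SamePoint x y = Σ Carrier (λ λ₀ → ∀ i → vec x i ≈ (λ₀ * vec y i))

  record Plane : Set (c ⊔ ℓ) where
    constructor mkPlane
    field
      form        : Vec4
      formNonzero : ¬ (∀ i → form i ≈ 0#)
  open Plane public

  SamePlane : Plane → Plane → Set (c ⊔ ℓ)
  SamePlane P Q = Σ Carrier (λ λ₀ → ∀ i → form P i ≈ (λ₀ * form Q i))

  dot : Vec4 → Vec4 → Carrier
  dot a v = ((a fz * v fz) + (a (fs fz) * v (fs fz)))
          + ((a (fs (fs fz)) * v (fs (fs fz)))
             + (a (fs (fs (fs fz))) * v (fs (fs (fs fz)))))

  OnPlane : Point → Plane → Set ℓ
  OnPlane x P = dot (form P) (vec x) ≈ 0#

  record Line : Set (c ⊔ ℓ) where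
    constructor mkLine
    field
      pt₁ pt₂  : Point
      distinct : ¬ SamePoint pt₁ pt₂
  open Line public

  OnLine : Point → Line → Set (c ⊔ ℓ)
  OnLine x L = Σ Carrier (λ a → Σ Carrier (λ b →
    ∀ i → vec x i ≈ ((a * vec (pt₁ L) i) + (b * vec (pt₂ L) i))))

  LineInPlane : Line → Plane → Set (c ⊔ ℓ)
  LineInPlane L P = ∀ x → OnLine x L → OnPlane x P

  Collinear : Point → Point → Point → Set (c ⊔ ℓ)
  Collinear x y z = Σ Line (λ L → OnLine x L × OnLine y L × OnLine z L)

  DistinctCollinear : Point → Point → Point → Set (c ⊔ ℓ)
  DistinctCollinear x y z =
    ¬ SamePoint x y × ¬ SamePoint x z × ¬ SamePoint y z × Collinear x y z

  -- a finite set of n points of ℙ³(K), enumerated without repetition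
  Injective : {n : ℕ} → (Fin n → Point) → Set (c ⊔ ℓ)
  Injective {n} X = ∀ i j → SamePoint (X i) (X j) → i ≡ j

-- "k ≤ n^(1 - a/b)" for b > 0, written without real exponents:
-- k^b · n^a ≤ n^b
AtMostPowMinus : ℕ → ℕ → ℕ → ℕ → Set
AtMostPowMinus k n a b = ((k ^ b) *ℕ (n ^ a)) ≤ (n ^ b)

-- "k ≤ n^(2 - c/d)" for d > 0: k^d · n^c ≤ n^(2d)
AtMostPow2Minus : ℕ → ℕ → ℕ → ℕ → Set
AtMostPow2Minus k n c d = ((k ^ d) *ℕ (n ^ c)) ≤ (n ^ (2 *ℕ d))

-- every duplicate-free list of indices satisfying Q has length ≤ m, i.e.
-- |{ i : Q i }| ≤ m (phrased without assuming Q decidable)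
CardBound : ∀ {p} {A : Set} → (A → Set p) → (ℕ → Set) → Set p
CardBound {A = A} Q bound =
  (xs : List A) → Unique xs → All Q xs → bound (length xs)

-- existential / conjunction landing in Setω (needed because the field K
-- is universally quantified over all universe levels, uniformly in N, δ)
record Σω {a : Level} (A : Set a) (P : A → Setω) : Setω where
  constructor _,ω_
  field
    witness : A
    proof   : P witness

infixr 2 _×ω_
record _×ω_ {a : Level} (A : Set a) (B : Setω) : Setω where
  constructor _,ω'_
  field
    fst : A
    snd : B

{-# OPTIONS --safe #-}
-- Let f₁, f₂ be the forms of P₁, P₂, and scale the points so that f₂(x₁) = f₁(x₂) = f₁(x₃) = 1. Then
-- x₁, x₂, x₃ are collinear iff x₃ = t x₁ + x₂ with t = f₂(x₃), i.e. iff the affine map g = (v ↦ x₃ − t v)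
-- sends x₁ to x₂. Hypothesis (3) says that few of these maps have the same linear part −t, and (4) that
-- few of them send a given point to a given point.
--
-- Suppose that n maps have n^(2−δ) incidences with X₁ × X₂. The quotients g h⁻¹ are again rich in
-- incidences (Cauchy–Schwarz), and the two non-concentration properties persist. Since an affine map
-- is determined by the images of two points, a family of rich maps has effectively at most n^(2+o(1))
-- elements; hence, passing repeatedly from a family to its quotients, at some step the family does not
-- grow by a factor n^γ. There it has large multiplicative energy, and the Balog–Szemerédi–Gowers theorem
-- yields a set S with |S⁻¹S| ≤ M|S|. The set P of popular elements of SS⁻¹ satisfies |Pᵏ| ≤ M^O(k) |S|.
--
-- Let Vₖ be the set of translations in Pᵏ. Every linear part t of an element of P maps V₄ into V₆, which
-- is covered by few translates of V₄, and the scalars s such that s V₄ is covered by few translates of V₄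
-- are closed under sums and products. Either V₄ is tiny, in which case commutators take few values
-- and many elements of P send one point to one point; or there are at most |V₄|⁴ such scalars. In the
-- latter case let T be a set of them. Some r ∈ (T − T)/(T − T) has r + 1 ∉ (T − T)/(T − T), since the
-- characteristic is 0 or large, and then T + (r + 1) T has |T|² elements. After clearing denominators
-- these are again such scalars, so iteration gives a contradiction.

module Submission where

open import Defs
open import Level using (Level; _⊔_)
open import Algebra.Bundles using (CommutativeRing; Group; RawRing)
open import Data.Empty using (⊥; ⊥-elim)
open import Data.Fin using (Fin; fromℕ<)
import Data.Fin as Fin
open import Data.List using (List; []; _∷_; _++_; allFin; cartesianProduct; cartesianProductWith; filter; length; lookup; map; upTo)
open import Data.List.Membership.Propositional using (_∈_)
open import Data.List.Membership.Propositional.Properties using (∈-allFin; ∈-cartesianProduct⁺; ∈-cartesianProduct⁻; ∈-cartesianProductWith⁺; ∈-cartesianProductWith⁻; ∈-filter⁺; ∈-filter⁻; ∈-lookup; ∈-map⁺; ∈-map⁻)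
open import Data.List.Properties using (length-++; length-map; length-tabulate; length-upTo)
open import Data.List.Relation.Unary.All using (All; []; _∷_)
import Data.List.Relation.Unary.All as All
import Data.List.Relation.Unary.All.Properties as All
open import Data.List.Relation.Unary.AllPairs using (AllPairs; []; _∷_)
import Data.List.Relation.Unary.AllPairs as AllPairs
import Data.List.Relation.Unary.AllPairs.Properties as AllPairs
open import Data.List.Relation.Unary.Any using (here; there)
open import Data.List.Relation.Unary.Unique.Propositional using (Unique)
import Data.List.Relation.Unary.Unique.Propositional.Properties as Unique
open import Data.Nat hiding (_⊔_)
open import Data.Nat.DivMod using (m/n*n≤m; m≡m%n+[m/n]*n; m%n<n)
open import Data.Nat.Induction using (<-rec)
open import Data.Nat.Properties
open import Data.Nat.Tactic.RingSolver using (solve-∀)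
open import Data.Product using (Σ; _×_; _,_; proj₁; proj₂)
open import Data.Product.Properties using (,-injectiveˡ; ,-injectiveʳ)
open import Data.Sum using (_⊎_; inj₁; inj₂)
open import Data.Unit using (⊤; tt)
open import Data.Vec using (Vec; []; _∷_)
open import Function using (_∘_; id)
open import Relation.Binary.PropositionalEquality using (_≡_; _≢_; refl; sym; trans; cong; cong₂; subst)
open import Relation.Nullary using (¬_; ¬?; Dec; yes; no)
open import Relation.Nullary.Decidable using (_×-dec_; decidable-stable)
import Relation.Nullary.Decidable as Dec

-- Families of maps are kept with multiplicity and measured by the effective size m²/E, where E
-- counts pairs of equal maps: a quotient family is then simply indexed by pairs, and no dyadic
-- pigeonholing is needed. Only the Balog-Szemerédi-Gowers step extracts a genuine set, so its
-- conclusion must also carry over the bounds on concentration.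
--
-- The order of the constants avoids a circle. Squaring T at most J times costs a power 13^J of the
-- covering constant, and 2^J ≥ 64 b lets T outgrow |V₄|⁴. In powers of the loss factor L, the
-- non-concentration is L^β and n is below L^(2bC), with exponents depending on b alone. So the
-- number f of quotient steps is fixed before L is related to the initial density 1/y. These steps
-- lower the density to 1/y^(2^f), and L = y^g absorbs the fourth power of this loss. Finally n lies
-- between y^R and y^(2R), whence the gain n^(1/(2R)).
--
-- Division and real exponents are avoided: inequalities are cleared of denominators, and field
-- equations are polynomial identities modulo hypotheses.

private
  variable
    ℓ₁ ℓ₂ ℓ₃ ℓ₄ ℓ₅ ℓ₆ : Level
    𝔸 : Set ℓ₁
    𝔹 : Set ℓ₂
    ℂ : Set ℓ₃

-- Double negation and finite sums

-- Equality in the field is not assumed decidable. All conclusions are inequalities between natural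
-- numbers or ⊥, so that case distinctions can be made under double negation.

infixl 1 _>>=_

DN : Set ℓ₄ → Set ℓ₄
DN P = ¬ ¬ P

pure : 𝔸 → DN 𝔸
pure x k = k x

_>>=_ : DN 𝔸 → (𝔸 → DN 𝔹) → DN 𝔹
(m >>= f) k = m λ x → f x k

dec : (P : Set ℓ₄) → DN (Dec P)
dec P k = k (no λ x → k (yes x))

run : {m n : ℕ} → DN (m ≤ n) → m ≤ n
run {m} {n} = decidable-stable (m ≤? n)

allDN : {P : 𝔸 → Set ℓ₄} (xs : List 𝔸) → (∀ {x} → x ∈ xs → DN (P x)) → DN (All P xs)
allDN []       f = pure []
allDN (x ∷ xs) f = do
  px  ← f (here refl)
  pxs ← allDN xs (f ∘ there)
  pure (px ∷ pxs)

Finite : Set ℓ₁ → Set ℓ₁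
Finite 𝔸 = Σ (List 𝔸) λ xs → ∀ x → x ∈ xs

-- Double negation does not pass through universal quantifiers in general, but it does along an
-- enumeration. Hence index types carry a `Finite` list.
choice : Finite 𝔸 → {P : 𝔸 → Set ℓ₄} → (∀ x → DN (P x)) → DN (∀ x → P x)
choice (xs , full) f = do
  ps ← allDN xs (λ {x} _ → f x)
  pure (λ x → All.lookup ps (full x))

decide : Finite 𝔸 → (P : 𝔸 → Set ℓ₄) → DN (∀ x → Dec (P x))
decide fin P = choice fin (dec ∘ P)

decide₂ : Finite 𝔸 → Finite 𝔹 → (P : 𝔸 → 𝔹 → Set ℓ₄) → DN (∀ x y → Dec (P x y))
decide₂ fa fb P = choice fa λ x → decide fb (P x)

_×-finite_ : Finite 𝔸 → Finite 𝔹 → Finite (𝔸 × 𝔹)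
(xs , f) ×-finite (ys , g) = cartesianProduct xs ys , λ (x , y) → ∈-cartesianProduct⁺ (f x) (g y)

¬All⇒DNAny : {P : 𝔸 → Set ℓ₄} (xs : List 𝔸) → ¬ All (¬_ ∘ P) xs → DN (Σ 𝔸 λ x → x ∈ xs × P x)
¬All⇒DNAny xs h k = h (All.tabulate λ x∈xs px → k (_ , x∈xs , px))

∑ : List 𝔸 → (𝔸 → ℕ) → ℕ
∑ []       f = 0
∑ (x ∷ xs) f = f x + ∑ xs f

𝟙 : {P : Set ℓ₄} → Dec P → ℕ
𝟙 (yes _) = 1
𝟙 (no _)  = 0

𝟙-yes : {P : Set ℓ₄} (d : Dec P) → P → 𝟙 d ≡ 1
𝟙-yes (yes _) _ = refl
𝟙-yes (no ¬p) p = ⊥-elim (¬p p)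

𝟙>0 : {P : Set ℓ₄} (d : Dec P) → 0 < 𝟙 d → P
𝟙>0 (yes p) _ = p

𝟙-cover : {P : Set ℓ₄} (d : Dec P) (x : ℕ) → x ≤ 𝟙 d * x + 𝟙 (¬? d) * x
𝟙-cover (yes _) x = ≤-trans (m≤m+n x 0) (m≤m+n _ _)
𝟙-cover (no _)  x = m≤m+n x 0

𝟙-mono : {P : Set ℓ₄} {Q : Set ℓ₅} (d : Dec P) (e : Dec Q) → (P → Q) → 𝟙 d ≤ 𝟙 e
𝟙-mono (no _)  e f = z≤n
𝟙-mono (yes p) e f = ≤-reflexive (sym (𝟙-yes e (f p)))

𝟙* : {P : Set ℓ₄} (d : Dec P) {m n : ℕ} → (P → m ≤ n) → 𝟙 d * m ≤ 𝟙 d * n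
𝟙* (yes p) f = *-monoʳ-≤ 1 (f p)
𝟙* (no _)  f = z≤n

𝟙*≤ : {P : Set ℓ₄} (d : Dec P) {m n : ℕ} → (P → m ≤ n) → 𝟙 d * m ≤ n
𝟙*≤ (yes p) {m} f = ≤-trans (≤-reflexive (+-identityʳ m)) (f p)
𝟙*≤ (no _)  f = z≤n

∑-mono-∈ : (xs : List 𝔸) {f g : 𝔸 → ℕ} → (∀ {x} → x ∈ xs → f x ≤ g x) → ∑ xs f ≤ ∑ xs g
∑-mono-∈ []       h = z≤n
∑-mono-∈ (x ∷ xs) h = +-mono-≤ (h (here refl)) (∑-mono-∈ xs (h ∘ there))

∑-mono : (xs : List 𝔸) {f g : 𝔸 → ℕ} → (∀ x → f x ≤ g x) → ∑ xs f ≤ ∑ xs g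
∑-mono xs h = ∑-mono-∈ xs λ {x} _ → h x

∑-cong : (xs : List 𝔸) {f g : 𝔸 → ℕ} → (∀ x → f x ≡ g x) → ∑ xs f ≡ ∑ xs g
∑-cong []       h = refl
∑-cong (x ∷ xs) h = cong₂ _+_ (h x) (∑-cong xs h)

∑-cong-∈ : (xs : List 𝔸) {f g : 𝔸 → ℕ} → (∀ {x} → x ∈ xs → f x ≡ g x) → ∑ xs f ≡ ∑ xs g
∑-cong-∈ []       h = refl
∑-cong-∈ (x ∷ xs) h = cong₂ _+_ (h (here refl)) (∑-cong-∈ xs (h ∘ there))

∑-+ : (xs : List 𝔸) (f g : 𝔸 → ℕ) → ∑ xs (λ x → f x + g x) ≡ ∑ xs f + ∑ xs g
∑-+ []       f g = refl
∑-+ (x ∷ xs) f g = begin-equality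
  f x + g x + ∑ xs (λ x → f x + g x) ≡⟨ cong (f x + g x +_) (∑-+ xs f g) ⟩
  f x + g x + (∑ xs f + ∑ xs g)      ≡⟨ lemma (f x) (g x) (∑ xs f) (∑ xs g) ⟩
  f x + ∑ xs f + (g x + ∑ xs g)      ∎
  where
  open ≤-Reasoning
  lemma : ∀ a b c d → a + b + (c + d) ≡ a + c + (b + d)
  lemma = solve-∀

∑-*ˡ : (xs : List 𝔸) (k : ℕ) (f : 𝔸 → ℕ) → ∑ xs (λ x → k * f x) ≡ k * ∑ xs f
∑-*ˡ []       k f = sym (*-zeroʳ k)
∑-*ˡ (x ∷ xs) k f = trans (cong (k * f x +_) (∑-*ˡ xs k f)) (sym (*-distribˡ-+ k (f x) (∑ xs f)))

∑-*ʳ : (xs : List 𝔸) (f : 𝔸 → ℕ) (k : ℕ) → ∑ xs (λ x → f x * k) ≡ ∑ xs f * k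
∑-*ʳ xs f k = begin-equality
  ∑ xs (λ x → f x * k) ≡⟨ ∑-cong xs (λ x → *-comm (f x) k) ⟩
  ∑ xs (λ x → k * f x) ≡⟨ ∑-*ˡ xs k f ⟩
  k * ∑ xs f           ≡⟨ *-comm k (∑ xs f) ⟩
  ∑ xs f * k           ∎
  where open ≤-Reasoning

∑-const : (xs : List 𝔸) (k : ℕ) → ∑ xs (λ _ → k) ≡ length xs * k
∑-const []       k = refl
∑-const (x ∷ xs) k = cong (k +_) (∑-const xs k)

∑-≤const : (xs : List 𝔸) {f : 𝔸 → ℕ} (k : ℕ) → (∀ {x} → x ∈ xs → f x ≤ k) → ∑ xs f ≤ length xs * k
∑-≤const xs k h = ≤-trans (∑-mono-∈ xs h) (≤-reflexive (∑-const xs k))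

∑-≥const : (xs : List 𝔸) {f : 𝔸 → ℕ} (k : ℕ) → (∀ {x} → x ∈ xs → k ≤ f x) → length xs * k ≤ ∑ xs f
∑-≥const xs k h = ≤-trans (≤-reflexive (sym (∑-const xs k))) (∑-mono-∈ xs h)

∑-swap : (xs : List 𝔸) (ys : List 𝔹) (f : 𝔸 → 𝔹 → ℕ) →
         ∑ xs (λ x → ∑ ys (f x)) ≡ ∑ ys (λ y → ∑ xs (λ x → f x y))
∑-swap []       ys f = sym (trans (∑-const ys 0) (*-zeroʳ (length ys)))
∑-swap (x ∷ xs) ys f = trans (cong (∑ ys (f x) +_) (∑-swap xs ys f))
                             (sym (∑-+ ys (f x) (λ y → ∑ xs (λ x → f x y))))

∑-++ : (xs ys : List 𝔸) (f : 𝔸 → ℕ) → ∑ (xs ++ ys) f ≡ ∑ xs f + ∑ ys f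
∑-++ []       ys f = refl
∑-++ (x ∷ xs) ys f = trans (cong (f x +_) (∑-++ xs ys f)) (sym (+-assoc (f x) _ _))

∑-map : (g : 𝔸 → 𝔹) (xs : List 𝔸) (f : 𝔹 → ℕ) → ∑ (map g xs) f ≡ ∑ xs (f ∘ g)
∑-map g []       f = refl
∑-map g (x ∷ xs) f = cong (f (g x) +_) (∑-map g xs f)

∑-cartesianProduct : (xs : List 𝔸) (ys : List 𝔹) (f : 𝔸 × 𝔹 → ℕ) →
                     ∑ (cartesianProduct xs ys) f ≡ ∑ xs (λ x → ∑ ys (λ y → f (x , y)))
∑-cartesianProduct []       ys f = refl
∑-cartesianProduct (x ∷ xs) ys f = trans (∑-++ (map (x ,_) ys) _ f)
  (cong₂ _+_ (∑-map (x ,_) ys f) (∑-cartesianProduct xs ys f))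

∑-∑-* : (xs : List 𝔸) (ys : List 𝔹) (f : 𝔸 → ℕ) (g : 𝔹 → ℕ) →
        ∑ xs (λ x → ∑ ys (λ y → f x * g y)) ≡ ∑ xs f * ∑ ys g
∑-∑-* xs ys f g = trans (∑-cong xs λ x → ∑-*ˡ ys (f x) g) (∑-*ʳ xs f (∑ ys g))

∑-filter : {P : 𝔸 → Set ℓ₄} (P? : ∀ x → Dec (P x)) (xs : List 𝔸) (f : 𝔸 → ℕ) →
           ∑ (filter P? xs) f ≡ ∑ xs (λ x → 𝟙 (P? x) * f x)
∑-filter P? []       f = refl
∑-filter P? (x ∷ xs) f with P? x
... | yes _ = cong₂ _+_ (sym (+-identityʳ (f x))) (∑-filter P? xs f)
... | no _  = ∑-filter P? xs f

length≡∑ : (xs : List 𝔸) → length xs ≡ ∑ xs (λ _ → 1)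
length≡∑ xs = sym (trans (∑-const xs 1) (*-identityʳ (length xs)))

length-filter≡∑ : {P : 𝔸 → Set ℓ₄} (P? : ∀ x → Dec (P x)) (xs : List 𝔸) →
                  length (filter P? xs) ≡ ∑ xs (𝟙 ∘ P?)
length-filter≡∑ P? xs = trans (length≡∑ (filter P? xs)) (trans (∑-filter P? xs (λ _ → 1)) (∑-cong xs λ x → *-identityʳ _))

length-cartesianProductWith : (f : 𝔸 → 𝔹 → ℂ) (xs : List 𝔸) (ys : List 𝔹) →
                              length (cartesianProductWith f xs ys) ≡ length xs * length ys
length-cartesianProductWith f []       ys = refl
length-cartesianProductWith f (x ∷ xs) ys = trans (length-++ (map (f x) ys))
  (cong₂ _+_ (length-map (f x) ys) (length-cartesianProductWith f xs ys))

length-cartesianProduct : (xs : List 𝔸) (ys : List 𝔹) → length (cartesianProduct xs ys) ≡ length xs * length ys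
length-cartesianProduct = length-cartesianProductWith _,_

∑-<⇒∃ : (xs : List 𝔸) (f g : 𝔸 → ℕ) → ∑ xs f < ∑ xs g → Σ 𝔸 λ x → x ∈ xs × f x < g x
∑-<⇒∃ (x ∷ xs) f g h with f x <? g x
... | yes fx<gx = x , here refl , fx<gx
... | no  fx≮gx = let y , y∈xs , fy<gy = ∑-<⇒∃ xs f g (+-cancelˡ-< (g x) _ _ (≤-<-trans (+-monoˡ-≤ (∑ xs f) (≮⇒≥ fx≮gx)) h))
                  in y , there y∈xs , fy<gy

2ab≤a²+b² : ∀ a b → 2 * (a * b) ≤ a * a + b * b
2ab≤a²+b² a b with ≤-total a b
... | inj₁ a≤b = subst (λ b → 2 * (a * b) ≤ a * a + b * b) (m+[n∸m]≡n a≤b) (lemma a (b ∸ a))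
  where
  eq : ∀ a d → a * a + (a + d) * (a + d) ≡ 2 * (a * (a + d)) + d * d
  eq = solve-∀
  lemma : ∀ a d → 2 * (a * (a + d)) ≤ a * a + (a + d) * (a + d)
  lemma a d = ≤-trans (m≤m+n _ (d * d)) (≤-reflexive (sym (eq a d)))
... | inj₂ b≤a = subst (λ a → 2 * (a * b) ≤ a * a + b * b) (m+[n∸m]≡n b≤a) (lemma b (a ∸ b))
  where
  eq : ∀ b d → (b + d) * (b + d) + b * b ≡ 2 * ((b + d) * b) + d * d
  eq = solve-∀
  lemma : ∀ b d → 2 * ((b + d) * b) ≤ (b + d) * (b + d) + b * b
  lemma b d = ≤-trans (m≤m+n _ (d * d)) (≤-reflexive (sym (eq b d)))

-- Sum `2ab≤a²+b²` over all pairs (x, y); both squares contribute the same sum.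
cauchy-schwarz : (xs : List 𝔸) (f : 𝔸 → ℕ) → ∑ xs f * ∑ xs f ≤ length xs * ∑ xs (λ x → f x * f x)
cauchy-schwarz xs f = *-cancelˡ-≤ 2 (begin
  2 * (∑ xs f * ∑ xs f)                                  ≡⟨ cong (2 *_) (sym (∑-∑-* xs xs f f)) ⟩
  2 * ∑ xs (λ x → ∑ xs (λ y → f x * f y))                ≡⟨ ∑-*ˡ xs 2 _ ⟨
  ∑ xs (λ x → 2 * ∑ xs (λ y → f x * f y))                ≡⟨ ∑-cong xs (λ x → ∑-*ˡ xs 2 _) ⟨
  ∑ xs (λ x → ∑ xs (λ y → 2 * (f x * f y)))              ≤⟨ ∑-mono xs (λ x → ∑-mono xs (λ y → 2ab≤a²+b² (f x) (f y))) ⟩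
  ∑ xs (λ x → ∑ xs (λ y → f x * f x + f y * f y))        ≡⟨ ∑-cong xs (λ x → ∑-+ xs _ _) ⟩
  ∑ xs (λ x → ∑ xs (λ y → f x * f x) + S)                ≡⟨ ∑-+ xs _ _ ⟩
  ∑ xs (λ x → ∑ xs (λ y → f x * f x)) + ∑ xs (λ x → S)   ≡⟨ cong₂ _+_ (∑-cong xs (λ x → ∑-const xs _)) (∑-const xs S) ⟩
  ∑ xs (λ x → length xs * (f x * f x)) + length xs * S   ≡⟨ cong (_+ length xs * S) (∑-*ˡ xs (length xs) _) ⟩
  length xs * S + length xs * S                          ≡⟨ lemma (length xs * S) ⟩
  2 * (length xs * S)                                    ∎)
  where
  open ≤-Reasoning
  S = ∑ xs (λ x → f x * f x)
  lemma : ∀ a → a + a ≡ 2 * a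
  lemma = solve-∀

-- Two entries of a product list differ in the first coordinate, whatever the second ones are, or in
-- the second only. The two cases separate sums such as a + r b.
AllPairs-cartesianProductWith :
  {R : 𝔸 → 𝔸 → Set ℓ₄} {S : 𝔹 → 𝔹 → Set ℓ₅} {T : ℂ → ℂ → Set ℓ₆} (f : 𝔸 → 𝔹 → ℂ) → ∀ {ys} →
  (∀ {x x′ y y′} → y ∈ ys → y′ ∈ ys → R x x′ → T (f x y) (f x′ y′)) →
  (∀ {x y y′} → S y y′ → T (f x y) (f x y′)) →
  ∀ {xs} → AllPairs R xs → AllPairs S ys → AllPairs T (cartesianProductWith f xs ys)
AllPairs-cartesianProductWith f h k [] sys = []
AllPairs-cartesianProductWith {R = R} {T = T} f {ys} h k {x ∷ xs} (rx ∷ rxs) sys =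
  AllPairs.++⁺ (AllPairs.map⁺ (AllPairs.map k sys))
    (AllPairs-cartesianProductWith f h k rxs sys)
    (All.map⁺ (All.tabulate λ y∈ → cross y∈ rx))
  where
  cross : ∀ {y zs} → y ∈ ys → All (R x) zs → All (T (f x y)) (cartesianProductWith f zs ys)
  cross y∈ []         = []
  cross y∈ (rz ∷ rzs) = All.++⁺ (All.map⁺ (All.tabulate λ y′∈ → h y∈ y′∈ rz)) (cross y∈ rzs)

AllPairs-∈ : {R : 𝔸 → 𝔸 → Set ℓ₄} {xs : List 𝔸} → AllPairs R xs → AllPairs (λ x y → R x y × x ∈ xs × y ∈ xs) xs
AllPairs-∈ []         = []
AllPairs-∈ (rx ∷ rxs) = All.tabulate (λ m → All.lookup rx m , here refl , there m)
                      ∷ AllPairs.map (λ (r , m , m′) → r , there m , there m′) (AllPairs-∈ rxs)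

∑𝟙≤1 : {R : 𝔸 → 𝔸 → Set ℓ₄} {P : 𝔸 → Set ℓ₅} (P? : ∀ x → Dec (P x)) →
       (∀ {x y} → R x y → P x → P y → ⊥) → ∀ {xs} → AllPairs R xs → ∑ xs (𝟙 ∘ P?) ≤ 1
∑𝟙≤1 P? h [] = z≤n
∑𝟙≤1 {𝔸 = 𝔸} {R = R} {P = P} P? h (_∷_ {x} rx rxs) with P? x
... | no _   = ∑𝟙≤1 P? h rxs
... | yes px = ≤-reflexive (cong suc (zero-tail rx))
  where
  zero-tail : ∀ {ys} → All (R x) ys → ∑ ys (𝟙 ∘ P?) ≡ 0
  zero-tail [] = refl
  zero-tail (_∷_ {y} ry rys) with P? y
  ... | yes py = ⊥-elim (h ry px py)
  ... | no _   = zero-tail rys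

∑𝟙≥1 : {P : 𝔸 → Set ℓ₅} (P? : ∀ x → Dec (P x)) {xs : List 𝔸} {x : 𝔸} → x ∈ xs → P x → 1 ≤ ∑ xs (𝟙 ∘ P?)
∑𝟙≥1 P? {x ∷ xs} (here refl) px = ≤-trans (≤-reflexive (sym (𝟙-yes (P? x) px))) (m≤m+n _ _)
∑𝟙≥1 P? {x ∷ xs} (there y∈)  py = ≤-trans (∑𝟙≥1 P? y∈ py) (m≤n+m _ (𝟙 (P? x)))

-- Pigeonhole principles and classes of a family

remove : {y : 𝔸} {ys : List 𝔸} → y ∈ ys →
         Σ (List 𝔸) λ zs → length ys ≡ suc (length zs) × (∀ {z} → z ∈ ys → z ≡ y ⊎ z ∈ zs)
remove {ys = y ∷ ys} (here refl) = ys , refl , λ { (here z≡y) → inj₁ z≡y ; (there z∈) → inj₂ z∈ }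
remove {ys = x ∷ ys} (there y∈) = let zs , eq , h = remove y∈ in
  x ∷ zs , cong suc eq , λ { (here refl) → inj₂ (here refl) ; (there z∈) → shift (h z∈) }
  where
  shift : ∀ {x y z zs} → z ≡ y ⊎ z ∈ zs → z ≡ y ⊎ z ∈ x ∷ zs
  shift (inj₁ e) = inj₁ e
  shift (inj₂ m) = inj₂ (there m)

-- A relation instead of a function: the partner of x is only known to exist under double negation,
-- and R need only separate elements related by D.
pigeonhole : {D : 𝔸 → 𝔸 → Set ℓ₄} (R : 𝔸 → 𝔹 → Set ℓ₅) → (∀ {x x′ y} → D x x′ → R x y → R x′ y → ⊥) →
             ∀ {xs} ys → AllPairs D xs → (∀ {x} → x ∈ xs → DN (Σ 𝔹 λ y → y ∈ ys × R x y)) →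
             length xs ≤ length ys
pigeonhole R h ys [] f = z≤n
pigeonhole {D = D} R h ys (_∷_ {x} {xs} dx dxs) f = run do
  y , y∈ys , rxy ← f (here refl)
  let zs , eq , split = remove y∈ys
      avoid : ∀ {x′} → x′ ∈ xs → Σ _ (λ y′ → y′ ∈ ys × R x′ y′) → Σ _ (λ y′ → y′ ∈ zs × R x′ y′)
      avoid x′∈xs = λ (y′ , y′∈ys , r′) → case-split x′∈xs r′ (split y′∈ys) rxy
  pure (subst (suc (length xs) ≤_) (sym eq) (s≤s (pigeonhole R h zs dxs λ x′∈ → f (there x′∈) >>= (pure ∘ avoid x′∈))))
  where
  case-split : ∀ {x′ y y′ zs} → x′ ∈ xs → R x′ y′ → y′ ≡ y ⊎ y′ ∈ zs → R x y → Σ _ (λ y′ → y′ ∈ zs × R x′ y′)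
  case-split x′∈ r′ (inj₁ refl) r = ⊥-elim (h (All.lookup dx x′∈) r r′)
  case-split x′∈ r′ (inj₂ m)    r = _ , m , r′

removeAll : {zs ys : List 𝔸} → Unique zs → (∀ {z} → z ∈ zs → z ∈ ys) →
            Σ (List 𝔸) λ ws → length ys ≡ length zs + length ws × (∀ {y} → y ∈ ys → y ∈ zs ⊎ y ∈ ws)
removeAll {ys = ys} [] sub = ys , refl , inj₂
removeAll {ys = ys} (_∷_ {z} {zs} z∉ uzs) sub =
  let ws , eq , split = remove (sub (here refl))
      vs , eq′ , split′ = removeAll uzs (λ m → other (All.lookup z∉ m) (split (sub (there m))))
  in vs , trans eq (cong suc eq′) , λ m → combine split′ (split m)
  where
  other : ∀ {y ws} → z ≢ y → y ≡ z ⊎ y ∈ ws → y ∈ ws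
  other ne (inj₁ e) = ⊥-elim (ne (sym e))
  other ne (inj₂ m) = m
  combine : ∀ {y ws vs} → (∀ {y} → y ∈ ws → y ∈ zs ⊎ y ∈ vs) → y ≡ z ⊎ y ∈ ws → y ∈ z ∷ zs ⊎ y ∈ vs
  combine s (inj₁ refl) = inj₁ (here refl)
  combine s (inj₂ m) with s m
  ... | inj₁ m′ = inj₁ (there m′)
  ... | inj₂ m′ = inj₂ m′

-- The lists owned by different elements are disjoint, so they can be removed from `ys` one after
-- the other.
multiPigeonhole : {D : 𝔸 → 𝔸 → Set ℓ₄} (R : 𝔸 → 𝔹 → Set ℓ₅) → (∀ {x x′ y} → D x x′ → R x y → R x′ y → ⊥) →
  ∀ (r : ℕ) {xs} ys → AllPairs D xs →
  (∀ {x} → x ∈ xs → Σ (List 𝔹) λ zs → Unique zs × All (R x) zs × (∀ {z} → z ∈ zs → z ∈ ys) × r ≤ length zs) →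
  length xs * r ≤ length ys
multiPigeonhole R h r ys [] f = z≤n
multiPigeonhole {D = D} R h r ys (_∷_ {x} {xs} dx dxs) f =
  let zs , uzs , rzs , sub , r≤ = f (here refl)
      ws , eq , split = removeAll uzs sub
      avoid : ∀ {x′ vs} → x′ ∈ xs → All (R x′) vs → (∀ {z} → z ∈ vs → z ∈ ys) → ∀ {z} → z ∈ vs → z ∈ ws
      avoid = λ x′∈ rvs sub′ m → pick (All.lookup rvs m) rzs x′∈ (split (sub′ m))
  in ≤-trans (+-mono-≤ r≤ (multiPigeonhole R h r ws dxs λ x′∈ →
       let vs , uvs , rvs , sub′ , r≤′ = f (there x′∈) in vs , uvs , rvs , avoid x′∈ rvs sub′ , r≤′))
     (≤-reflexive (sym eq))
  where
  pick : ∀ {x′ z zs ws} → R x′ z → All (R x) zs → x′ ∈ xs → z ∈ zs ⊎ z ∈ ws → z ∈ ws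
  pick r rzs x′∈ (inj₁ m) = ⊥-elim (h (All.lookup dx x′∈) (All.lookup rzs m) r)
  pick r rzs x′∈ (inj₂ m) = m

length-partition : {P : 𝔸 → Set ℓ₄} (P? : ∀ x → Dec (P x)) (xs : List 𝔸) →
  length xs ≡ length (filter P? xs) + length (filter (¬? ∘ P?) xs)
length-partition P? [] = refl
length-partition P? (x ∷ xs) with P? x
... | yes _ = cong suc (length-partition P? xs)
... | no _  = trans (cong suc (length-partition P? xs)) (sym (+-suc _ _))

-- A class over y has at most l/k elements; the fraction is kept as a pair to avoid division.
grouping : Finite 𝔸 → {D : 𝔸 → 𝔸 → Set ℓ₄} (R : 𝔸 → 𝔹 → Set ℓ₅) (k l : ℕ) →
  (∀ y → ∀ {xs} → AllPairs D xs → All (λ x → R x y) xs → length xs * k ≤ l) →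
  ∀ {xs} ys → AllPairs D xs → (∀ {x} → x ∈ xs → DN (Σ 𝔹 λ y → y ∈ ys × R x y)) →
  length xs * k ≤ length ys * l
grouping fin R k l bound {[]} [] dxs f = z≤n
grouping fin R k l bound {x ∷ xs} [] dxs f = ⊥-elim (f (here refl) λ ())
grouping {𝔸 = 𝔸} {𝔹 = 𝔹} fin R k l bound {xs} (y ∷ ys) dxs f = run do
  d ← decide fin (λ x → R x y)
  let tail : ∀ {x} → x ∈ filter (¬? ∘ d) xs → DN (Σ 𝔹 λ y → y ∈ ys × R x y)
      tail = λ m → let m′ , ¬r = ∈-filter⁻ (¬? ∘ d) m in f m′ >>= (pure ∘ drop ¬r)
  pure (begin
    length xs * k ≡⟨ cong (_* k) (length-partition d xs) ⟩
    (length (filter d xs) + length (filter (¬? ∘ d) xs)) * k ≡⟨ *-distribʳ-+ k (length (filter d xs)) _ ⟩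
    length (filter d xs) * k + length (filter (¬? ∘ d) xs) * k
      ≤⟨ +-mono-≤ (bound y (AllPairs.filter⁺ d dxs) (All.all-filter d xs))
                  (grouping fin R k l bound ys (AllPairs.filter⁺ (¬? ∘ d) dxs) tail) ⟩
    l + length ys * l ∎)
  where
  open ≤-Reasoning
  drop : ∀ {x} → ¬ R x y → Σ 𝔹 (λ z → z ∈ y ∷ ys × R x z) → Σ 𝔹 (λ z → z ∈ ys × R x z)
  drop ¬r (_ , here refl , r) = ⊥-elim (¬r r)
  drop ¬r (z , there m , r)   = z , m , r

-- Greedy extension, which stops because of the bound L. With R saying "different", maximality
-- yields representatives; with R saying "disjoint translates", it yields coverings.
maximal : (Q : 𝔸 → Set ℓ₄) (R : 𝔸 → 𝔸 → Set ℓ₅) (L : ℕ) →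
  (∀ xs → AllPairs R xs → All Q xs → length xs ≤ L) →
  DN (Σ (List 𝔸) λ xs → AllPairs R xs × All Q xs × (∀ x → Q x → ¬ All (R x) xs))
maximal {𝔸 = 𝔸} Q R L bound = extend (suc L) [] [] [] (s≤s (m≤n⇒m≤n+o 0 ≤-refl))
  where
  Extension = λ (xs : List 𝔸) → Σ 𝔸 λ x → Q x × All (R x) xs
  extend : ∀ fuel xs → AllPairs R xs → All Q xs → suc L ≤ fuel + length xs →
           DN (Σ (List 𝔸) λ xs → AllPairs R xs × All Q xs × (∀ x → Q x → ¬ All (R x) xs))
  extend zero       xs rxs qxs h = ⊥-elim (<⇒≱ h (bound xs rxs qxs))
  extend (suc fuel) xs rxs qxs h = do
    yes (x , qx , rx) ← dec (Extension xs)
      where no ¬ext → pure (xs , rxs , qxs , λ x qx rx → ¬ext (x , qx , rx))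
    extend fuel (x ∷ xs) (rx ∷ rxs) (qx ∷ qxs) (≤-trans h (≤-reflexive (sym (+-suc fuel (length xs)))))

-- `once` states unique representation as the value of a sum, so that it can be inserted as a factor
-- 1 in `∑-reps`.
record Representatives {𝔸 : Set ℓ₁} {_~_ : 𝔸 → 𝔸 → Set ℓ₄} (_~?_ : ∀ x y → Dec (x ~ y)) (xs : List 𝔸) : Set (ℓ₁ ⊔ ℓ₄) where
  field
    reps     : List 𝔸
    distinct : AllPairs (λ x y → ¬ x ~ y) reps
    reps⊆    : ∀ {x} → x ∈ reps → x ∈ xs
    once     : ∀ {x} → x ∈ xs → ∑ reps (λ u → 𝟙 (u ~? x)) ≡ 1

  ∑-reps : (f : 𝔸 → ℕ) → ∑ xs f ≡ ∑ reps (λ u → ∑ xs (λ x → 𝟙 (u ~? x) * f x))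
  ∑-reps f = begin-equality
    ∑ xs f                                          ≡⟨ ∑-cong-∈ xs (λ {x} m → trans (sym (*-identityˡ (f x))) (cong (_* f x) (sym (once m)))) ⟩
    ∑ xs (λ x → ∑ reps (λ u → 𝟙 (u ~? x)) * f x)    ≡⟨ ∑-cong xs (λ x → sym (∑-*ʳ reps _ (f x))) ⟩
    ∑ xs (λ x → ∑ reps (λ u → 𝟙 (u ~? x) * f x))    ≡⟨ ∑-swap xs reps _ ⟩
    ∑ reps (λ u → ∑ xs (λ x → 𝟙 (u ~? x) * f x))    ∎
    where open ≤-Reasoning

module _ {𝔸 : Set ℓ₁} {_~_ : 𝔸 → 𝔸 → Set ℓ₄} (~-refl : ∀ {x} → x ~ x)
         (~-sym : ∀ {x y} → x ~ y → y ~ x) (~-trans : ∀ {x y z} → x ~ y → y ~ z → x ~ z)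
         (_~?_ : ∀ x y → Dec (x ~ y)) where

  representatives : (xs : List 𝔸) → Representatives _~?_ xs
  representatives [] = record { reps = [] ; distinct = [] ; reps⊆ = λ () ; once = λ () }
  representatives (x ∷ xs) with representatives xs
  ... | R with All.all? (λ u → ¬? (u ~? x)) (Representatives.reps R)
  ...   | yes fresh = record
    { reps     = x ∷ reps
    ; distinct = All.map (λ ne e → ne (~-sym e)) fresh ∷ distinct
    ; reps⊆    = λ { (here refl) → here refl ; (there m) → there (reps⊆ m) }
    ; once     = λ { (here refl) → cong₂ _+_ (𝟙-yes (x ~? x) ~-refl) (none fresh)
                   ; (there m)   → ≤-antisym
                       (∑𝟙≤1 (_~? _) (λ ne e e′ → ne (~-trans e (~-sym e′)))
                          (All.map (λ ne e → ne (~-sym e)) fresh ∷ distinct))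
                       (≤-trans (≤-reflexive (sym (once m))) (m≤n+m _ _)) }
    }
    where
    open Representatives R
    none : ∀ {us} → All (λ u → ¬ u ~ x) us → ∑ us (λ u → 𝟙 (u ~? x)) ≡ 0
    none [] = refl
    none (_∷_ {u} ne nes) with u ~? x
    ... | yes e = ⊥-elim (ne e)
    ... | no _  = none nes
  ...   | no stale = record
    { reps     = reps
    ; distinct = distinct
    ; reps⊆    = there ∘ reps⊆
    ; once     = λ { (here refl) → ≤-antisym (∑𝟙≤1 (_~? x) (λ ne e e′ → ne (~-trans e (~-sym e′))) distinct) found
                   ; (there m)   → once m }
    }
    where
    open Representatives R
    found : 1 ≤ ∑ reps (λ u → 𝟙 (u ~? x))
    found = run do
      u , m , e ← ¬All⇒DNAny reps stale
      pure (∑𝟙≥1 (_~? x) m e)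

  -- With μ the size of a class, Σ μ is `length xs` and Σ μ² is the number of equivalent pairs. This
  -- is Cauchy-Schwarz over at most L classes.
  energy-bound : (L : ℕ) (xs : List 𝔸) → (∀ ys → AllPairs (λ x y → ¬ x ~ y) ys → All (_∈ xs) ys → length ys ≤ L) →
                 length xs * length xs ≤ L * ∑ xs (λ x → ∑ xs (λ y → 𝟙 (x ~? y)))
  energy-bound L xs bound = begin
    length xs * length xs                             ≡⟨ cong₂ _*_ eq eq ⟩
    ∑ reps μ * ∑ reps μ                               ≤⟨ cauchy-schwarz reps μ ⟩
    length reps * ∑ reps (λ u → μ u * μ u)            ≤⟨ *-monoˡ-≤ _ (bound reps distinct (All.tabulate reps⊆)) ⟩
    L * ∑ reps (λ u → μ u * μ u)                      ≡⟨ cong (L *_) (∑-cong reps λ u → sym (∑-*ʳ xs _ (μ u))) ⟩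
    L * ∑ reps (λ u → ∑ xs (λ x → 𝟙 (u ~? x) * μ u))  ≤⟨ *-monoʳ-≤ L (∑-mono reps λ u → ∑-mono xs λ x → 𝟙* (u ~? x) λ e →
                                                           ∑-mono xs λ y → 𝟙-mono (u ~? y) (x ~? y) (~-trans (~-sym e))) ⟩
    L * ∑ reps (λ u → ∑ xs (λ x → 𝟙 (u ~? x) * μ x))  ≡⟨ cong (L *_) (sym (∑-reps μ)) ⟩
    L * ∑ xs μ ∎
    where
    open ≤-Reasoning
    open Representatives (representatives xs)
    μ : 𝔸 → ℕ
    μ x = ∑ xs (λ y → 𝟙 (x ~? y))
    eq : length xs ≡ ∑ reps μ
    eq = trans (length≡∑ xs) (trans (∑-reps (λ _ → 1)) (∑-cong reps λ u → ∑-cong xs λ x → *-identityʳ _))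

unique-count : {P : 𝔸 → Set ℓ₄} (P? : ∀ x → Dec (P x)) {xs ys : List 𝔸} → Unique xs →
               (∀ {x} → x ∈ xs → x ∈ ys) → (∀ {x} → x ∈ xs → P x) → length xs ≤ ∑ ys (𝟙 ∘ P?)
unique-count P? {xs} {ys} u sub h = ≤-trans
  (pigeonhole _≡_ (λ { ne refl refl → ne refl }) (filter P? ys) u (λ x∈ → pure (_ , ∈-filter⁺ P? (sub x∈) (h x∈) , refl)))
  (≤-reflexive (length-filter≡∑ P? ys))

∑-≤⇒∃ : (xs : List 𝔸) (f g : 𝔸 → ℕ) → 0 < length xs → ∑ xs f ≤ ∑ xs g → Σ 𝔸 λ x → x ∈ xs × f x ≤ g x
∑-≤⇒∃ xs f g ne h = let x , x∈ , lt = ∑-<⇒∃ xs f (suc ∘ g) (≤-<-trans h lemma) in x , x∈ , ≤-pred lt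
  where
  lemma : ∑ xs g < ∑ xs (suc ∘ g)
  lemma = ≤-trans (+-monoˡ-≤ (∑ xs g) (≤-trans ne (≤-reflexive (length≡∑ xs)))) (≤-reflexive (sym (∑-+ xs (λ _ → 1) g)))

square-cancel-≤ : ∀ {m n} → m * m ≤ n * n → m ≤ n
square-cancel-≤ {m} {n} h = ≮⇒≥ λ n<m → <⇒≱ (*-mono-< n<m n<m) h

𝟙-× : {P : Set ℓ₄} {Q : Set ℓ₅} (d : Dec P) (e : Dec Q) → 𝟙 (d ×-dec e) ≡ 𝟙 d * 𝟙 e
𝟙-× (yes _) (yes _) = refl
𝟙-× (yes _) (no _)  = refl
𝟙-× (no _)  (yes _) = refl
𝟙-× (no _)  (no _)  = refl

module _ {𝔸 : Set ℓ₁} {_~_ : 𝔸 → 𝔸 → Set ℓ₄} (~-refl : ∀ {x} → x ~ x)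
         (~-sym : ∀ {x y} → x ~ y → y ~ x) (~-trans : ∀ {x y z} → x ~ y → y ~ z → x ~ z)
         (_~?_ : ∀ x y → Dec (x ~ y)) where

  -- 2 μ β ≤ μ² + β² on every class
  partial-injection-bound : (c : 𝔸 → 𝔸 → Set ℓ₅) (c? : ∀ x y → Dec (c x y)) →
    (∀ {x y y′} → c x y → y ~ y′ → c x y′) →
    (∀ {x x′ y} → c x y → c x′ y → x ~ x′) →
    (∀ {x y y′} → c x y → c x y′ → y ~ y′) →
    (xs : List 𝔸) →
    ∑ xs (λ x → ∑ xs (λ y → 𝟙 (c? x y))) ≤ ∑ xs (λ x → ∑ xs (λ y → 𝟙 (x ~? y)))
  partial-injection-bound c c? resp inj fun xs = *-cancelˡ-≤ 2 (begin
    2 * ∑ xs (λ x → ∑ xs (λ y → 𝟙 (c? x y)))   ≡⟨ cong (2 *_) (∑-swap xs xs _) ⟩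
    2 * ∑ xs β                                 ≡⟨ cong (2 *_) (∑-reps β) ⟩
    2 * ∑ reps (λ u → ∑ xs (λ x → 𝟙 (u ~? x) * β x))
      ≤⟨ *-monoʳ-≤ 2 (∑-mono reps λ u → ∑-mono xs λ x → 𝟙* (u ~? x) (λ e → ∑-mono xs λ k → 𝟙-mono (c? k x) (c? k u) (λ w → resp w (~-sym e)))) ⟩
    2 * ∑ reps (λ u → ∑ xs (λ x → 𝟙 (u ~? x) * β u)) ≡⟨ cong (2 *_) (∑-cong reps λ u → ∑-*ʳ xs _ (β u)) ⟩
    2 * ∑ reps (λ u → μ u * β u)               ≡⟨ ∑-*ˡ reps 2 _ ⟨
    ∑ reps (λ u → 2 * (μ u * β u))             ≤⟨ ∑-mono reps (λ u → 2ab≤a²+b² (μ u) (β u)) ⟩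
    ∑ reps (λ u → μ u * μ u + β u * β u)       ≡⟨ ∑-+ reps _ _ ⟩
    ∑ reps (λ u → μ u * μ u) + ∑ reps (λ u → β u * β u) ≤⟨ +-mono-≤ first second ⟩
    ∑ xs μ + ∑ xs μ                            ≡⟨ cong (∑ xs μ +_) (sym (+-identityʳ _)) ⟩
    2 * ∑ xs μ                                 ∎)
    where
    open ≤-Reasoning
    open Representatives (representatives ~-refl ~-sym ~-trans _~?_ xs)
    μ β : 𝔸 → ℕ
    μ x = ∑ xs (λ y → 𝟙 (x ~? y))
    β y = ∑ xs (λ x → 𝟙 (c? x y))
    first : ∑ reps (λ u → μ u * μ u) ≤ ∑ xs μ
    first = begin
      ∑ reps (λ u → μ u * μ u)                     ≡⟨ (∑-cong reps λ u → sym (∑-*ʳ xs _ (μ u))) ⟩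
      ∑ reps (λ u → ∑ xs (λ x → 𝟙 (u ~? x) * μ u)) ≤⟨ (∑-mono reps λ u → ∑-mono xs λ x → 𝟙* (u ~? x) λ e →
                                                        ∑-mono xs λ y → 𝟙-mono (u ~? y) (x ~? y) (~-trans (~-sym e))) ⟩
      ∑ reps (λ u → ∑ xs (λ x → 𝟙 (u ~? x) * μ x)) ≡⟨ sym (∑-reps μ) ⟩
      ∑ xs μ                                       ∎
    second : ∑ reps (λ u → β u * β u) ≤ ∑ xs μ
    second = begin
      ∑ reps (λ u → β u * β u)                     ≡⟨ (∑-cong reps λ u → sym (∑-*ʳ xs _ (β u))) ⟩
      ∑ reps (λ u → ∑ xs (λ k → 𝟙 (c? k u) * β u)) ≤⟨ (∑-mono reps λ u → ∑-mono xs λ k → 𝟙* (c? k u) λ w →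
                                                        ∑-mono xs λ k′ → 𝟙-mono (c? k′ u) (k ~? k′) (inj w)) ⟩
      ∑ reps (λ u → ∑ xs (λ k → 𝟙 (c? k u) * μ k)) ≡⟨ ∑-swap reps xs _ ⟩
      ∑ xs (λ k → ∑ reps (λ u → 𝟙 (c? k u) * μ k)) ≡⟨ (∑-cong xs λ k → ∑-*ʳ reps _ (μ k)) ⟩
      ∑ xs (λ k → ∑ reps (λ u → 𝟙 (c? k u)) * μ k) ≤⟨ (∑-mono xs λ k → *-monoˡ-≤ (μ k)
                                                        (∑𝟙≤1 (c? k) (λ ne w w′ → ne (fun w w′)) distinct)) ⟩
      ∑ xs (λ k → 1 * μ k)                         ≡⟨ (∑-cong xs λ k → *-identityˡ (μ k)) ⟩
      ∑ xs μ                                       ∎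

  distinct⇒≡ : ∀ {xs x y} → AllPairs (λ x y → ¬ x ~ y) xs → x ∈ xs → y ∈ xs → x ~ y → x ≡ y
  distinct⇒≡ (d ∷ ds) (here refl) (here refl) e = refl
  distinct⇒≡ (d ∷ ds) (here refl) (there m)   e = ⊥-elim (All.lookup d m e)
  distinct⇒≡ (d ∷ ds) (there m)   (here refl) e = ⊥-elim (All.lookup d m (~-sym e))
  distinct⇒≡ (d ∷ ds) (there m)   (there m′)  e = distinct⇒≡ ds m m′ e

^-distribʳ-* : ∀ k x y → (x * y) ^ k ≡ x ^ k * y ^ k
^-distribʳ-* zero    x y = refl
^-distribʳ-* (suc k) x y = trans (cong (x * y *_) (^-distribʳ-* k x y)) (lemma x y (x ^ k) (y ^ k))
  where
  lemma : ∀ a b c d → a * b * (c * d) ≡ a * c * (b * d)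
  lemma = solve-∀

-- The Balog–Szemerédi–Gowers theorem

𝟙-split : ∀ {p q} {P : Set p} {Q : Set q} (a : Dec P) (b : Dec Q) {x y : ℕ} → (¬ Q → x ≤ y) →
          𝟙 a * x ≤ 𝟙 (a ×-dec b) * x + 𝟙 a * y
𝟙-split (no _)  b       h = z≤n
𝟙-split (yes _) (yes _) h = m≤m+n _ _
𝟙-split (yes _) (no ¬q) h = +-monoˡ-≤ 0 (h ¬q)

≤-𝟙-or : ∀ {p q} {P : Set p} {Q : Set q} (a : Dec P) (b : Dec Q) {x y : ℕ} → (¬ P → ¬ Q → x ≤ y) →
         x ≤ y + (𝟙 a * x + 𝟙 b * x)
≤-𝟙-or (yes _) b       {x} {y} h = ≤-trans (≤-trans (m≤m+n x 0) (m≤m+n _ _)) (m≤n+m _ y)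
≤-𝟙-or (no _)  (yes _) {x} {y} h = ≤-trans (m≤m+n x 0) (m≤n+m _ y)
≤-𝟙-or (no ¬p) (no ¬q)         h = ≤-trans (h ¬p ¬q) (m≤m+n _ _)

𝟙*𝟙>0 : ∀ {p q} {P : Set p} {Q : Set q} (a : Dec P) (b : Dec Q) → 0 < 𝟙 a * 𝟙 b → P × Q
𝟙*𝟙>0 (yes p) (yes q) _ = p , q

∑-zero-or-∃ : ∀ {a p} {A : Set a} (xs : List A) (f : A → ℕ) (P : ℕ → Set p) → P 0 →
              (∀ x → x ∈ xs → 0 < f x → P (∑ xs f)) → P (∑ xs f)
∑-zero-or-∃ xs f P p₀ h = go (∑ xs f) refl
  where
  go : ∀ s → ∑ xs f ≡ s → P (∑ xs f)
  go zero    eq = subst P (sym eq) p₀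
  go (suc s) eq = let x , x∈ , lt = ∑-<⇒∃ xs (λ _ → 0) f (subst (_< ∑ xs f) (sym (trans (∑-const xs 0) (*-zeroʳ (length xs)))) (subst (0 <_) (sym eq) (s≤s z≤n)))
                  in h x x∈ lt

lookup-injective : ∀ {a p} {A : Set a} {_~_ : A → A → Set p} → (∀ {x y} → x ~ y → y ~ x) →
  ∀ {xs} → AllPairs (λ x y → ¬ x ~ y) xs → ∀ i j → lookup xs i ~ lookup xs j → i ≡ j
lookup-injective s (d ∷ ds) Fin.zero    Fin.zero    e = refl
lookup-injective s (d ∷ ds) Fin.zero    (Fin.suc j) e = ⊥-elim (All.lookup d (∈-lookup j) e)
lookup-injective s (d ∷ ds) (Fin.suc i) Fin.zero    e = ⊥-elim (All.lookup d (∈-lookup i) (s e))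
lookup-injective s (d ∷ ds) (Fin.suc i) (Fin.suc j) e = cong Fin.suc (lookup-injective s ds i j e)

module _ {K : ℕ} (2≤K : 2 ≤ K) where
  2^≤ : ∀ e → 2 ^ e ≤ K ^ e
  2^≤ e = ^-monoˡ-≤ e 2≤K

  -- A record rather than a synonym, so that the exponent can be inferred.
  record _≼_ (x a : ℕ) : Set where
    constructor wrap
    field unwrap : x ≤ K ^ a
  open _≼_ public

  infixl 7 _⊛_
  _⊛_ : ∀ {x y a b} → x ≼ a → y ≼ b → (x * y) ≼ (a + b)
  _⊛_ {a = a} {b} (wrap p) (wrap q) = wrap (≤-trans (*-mono-≤ p q) (≤-reflexive (sym (^-distribˡ-+-* K a b))))

  K≼1 : K ≼ 1
  K≼1 = wrap (≤-reflexive (sym (*-identityʳ K)))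

  numeral : ∀ x e → x ≤ 2 ^ e → x ≼ e
  numeral x e h = wrap (≤-trans h (2^≤ e))

  -- The constant `Λ` of the Balog-Szemerédi-Gowers theorem, written out. Numerals are rounded up to
  -- powers of 2, hence of K: 4 + 1 + 20 + 8 + 12 = 45. The next two constants cost 10 and 6 more.
  Λ-bound : (12 * K * (256 * (K * K) * (256 * (K * K))) * (16 * (K * K * (K * K))) * (8 * K * (8 * K * (8 * K)))) ≼ 45
  Λ-bound = numeral 12 4 (m≤m+n 12 4) ⊛ K≼1 ⊛ (c ⊛ c) ⊛ (numeral 16 4 ≤-refl ⊛ (K≼1 ⊛ K≼1 ⊛ (K≼1 ⊛ K≼1))) ⊛ (e ⊛ (e ⊛ e))
    where
    c : (256 * (K * K)) ≼ 10
    c = numeral 256 8 ≤-refl ⊛ (K≼1 ⊛ K≼1)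
    e : (8 * K) ≼ 4
    e = numeral 8 3 ≤-refl ⊛ K≼1

  M-bound : ∀ l → l ≼ 45 → (l * (24 * K * (8 * K))) ≼ 55
  M-bound l h = h ⊛ (numeral 24 5 (m≤m+n 24 8) ⊛ K≼1 ⊛ (numeral 8 3 ≤-refl ⊛ K≼1))

  24KM-bound : ∀ l → l ≼ 55 → (24 * K * l) ≼ 61
  24KM-bound l h = numeral 24 5 (m≤m+n 24 8) ⊛ K≼1 ⊛ h

module BSG {c ℓ} (G : Group c ℓ) where
  open Group G renaming (refl to ≈-refl; sym to ≈-sym; trans to ≈-trans)
  open import Algebra.Properties.Group G using (∙-cancelˡ; ∙-cancelʳ)

  quotient-quotient : ∀ x y z → (x ⁻¹ ∙ y) ∙ (z ⁻¹ ∙ y) ⁻¹ ≈ x ⁻¹ ∙ z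
  quotient-quotient x y z = begin
    (x ⁻¹ ∙ y) ∙ (z ⁻¹ ∙ y) ⁻¹       ≈⟨ ∙-congˡ (⁻¹-anti-homo-∙ (z ⁻¹) y) ⟩
    (x ⁻¹ ∙ y) ∙ (y ⁻¹ ∙ (z ⁻¹) ⁻¹)  ≈⟨ assoc _ _ _ ⟩
    x ⁻¹ ∙ (y ∙ (y ⁻¹ ∙ (z ⁻¹) ⁻¹))  ≈⟨ ∙-congˡ (assoc _ _ _) ⟨
    x ⁻¹ ∙ ((y ∙ y ⁻¹) ∙ (z ⁻¹) ⁻¹)  ≈⟨ ∙-congˡ (∙-cong (inverseʳ y) (⁻¹-involutive z)) ⟩
    x ⁻¹ ∙ (ε ∙ z)                   ≈⟨ ∙-congˡ (identityˡ z) ⟩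
    x ⁻¹ ∙ z                         ∎
    where
    open import Relation.Binary.Reasoning.Setoid setoid
    open import Algebra.Properties.Group G using (⁻¹-anti-homo-∙; ⁻¹-involutive)

  -- |S⁻¹S| ≤ L, without forming the set of quotients, which would require deciding equality.
  FewQuotients : {q : ℕ} → (Fin q → Carrier) → ℕ → Set ℓ
  FewQuotients {q} S L = (zs : List (Fin q × Fin q)) →
    AllPairs (λ (i , j) (k , l) → ¬ S i ⁻¹ ∙ S j ≈ S k ⁻¹ ∙ S l) zs → length zs ≤ L

  module Popular {I : Set} (is : List I) (g : I → Carrier)
    (_~?_ : ∀ i j → Dec (g i ≈ g j))
    (Q?   : ∀ i j k l → Dec (g i ⁻¹ ∙ g j ≈ g k ⁻¹ ∙ g l)) where

    m : ℕ
    m = length is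

    μ : I → ℕ
    μ i = ∑ is (λ j → 𝟙 (i ~? j))

    E : ℕ
    E = ∑ is μ

    r : I → I → ℕ
    r i j = ∑ is (λ k → ∑ is (λ l → 𝟙 (Q? i j k l)))

    -- For fixed i and j the equation defining `r` determines the value of g l from that of g k and
    -- conversely: it is a partial injection between values.
    r≤E : ∀ i j → r i j ≤ E
    r≤E i j = partial-injection-bound ≈-refl ≈-sym ≈-trans _~?_ (λ k l → g i ⁻¹ ∙ g j ≈ g k ⁻¹ ∙ g l) (Q? i j)
      (λ e f → ≈-trans e (∙-congˡ f))
      (λ {k} {k′} {l} e f → ⁻¹-injective (∙-cancelʳ (g l) _ _ (≈-trans (≈-sym e) f)))
      (λ {k} {l} {l′} e f → ∙-cancelˡ (g k ⁻¹) _ _ (≈-trans (≈-sym e) f)) is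
      where open import Algebra.Properties.Group G using (⁻¹-injective)

    module Dense (K : ℕ) .{{_ : NonZero K}} .{{_ : NonZero E}} .{{_ : NonZero m}}
      (energy : m * m * E ≤ K * ∑ is (λ i → ∑ is (λ j → r i j))) where

      open ≤-Reasoning

      pop? : ∀ i j → Dec (E ≤ 2 * K * r i j)
      pop? i j = E ≤? 2 * K * r i j

      -- The mean of μ is E/m. Indices of much larger multiplicity are discarded, because `fixed-θ`
      -- multiplies three multiplicities.
      Good : I → Set
      Good i = μ i * m ≤ 8 * K * E

      good? : ∀ i → Dec (Good i)
      good? i = μ i * m ≤? 8 * K * E

      #pop #bad : ℕ
      #pop = ∑ is (λ i → ∑ is (λ j → 𝟙 (pop? i j)))
      #bad = ∑ is (λ i → 𝟙 (¬? (good? i)))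

      m²≤2K#pop : m * m ≤ 2 * K * #pop
      m²≤2K#pop = *-cancelʳ-≤ (m * m) (2 * K * #pop) E (+-cancelʳ-≤ (m * m * E) _ _ (begin
        m * m * E + m * m * E ≡⟨ lemma₁ (m * m * E) ⟩
        2 * (m * m * E) ≤⟨ *-monoʳ-≤ 2 energy ⟩
        2 * (K * ∑ is (λ i → ∑ is (λ j → r i j))) ≡⟨ *-assoc 2 K _ ⟨
        2 * K * ∑ is (λ i → ∑ is (λ j → r i j)) ≡⟨ ∑-*ˡ is (2 * K) _ ⟨
        ∑ is (λ i → 2 * K * ∑ is (λ j → r i j)) ≡⟨ ∑-cong is (λ i → sym (∑-*ˡ is (2 * K) _)) ⟩
        ∑ is (λ i → ∑ is (λ j → 2 * K * r i j)) ≤⟨ ∑-mono is (λ i → ∑-mono is (λ j → step i j)) ⟩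
        ∑ is (λ i → ∑ is (λ j → 𝟙 (pop? i j) * (2 * K * E) + E)) ≡⟨ ∑-cong is (λ i → trans (∑-+ is _ _) (cong₂ _+_ (∑-*ʳ is _ (2 * K * E)) (∑-const is E))) ⟩
        ∑ is (λ i → ∑ is (λ j → 𝟙 (pop? i j)) * (2 * K * E) + m * E) ≡⟨ trans (∑-+ is _ _) (cong₂ _+_ (∑-*ʳ is _ (2 * K * E)) (∑-const is (m * E))) ⟩
        #pop * (2 * K * E) + m * (m * E) ≡⟨ lemma₂ #pop K E m ⟩
        2 * K * #pop * E + m * m * E ∎))
        where
        lemma₁ : ∀ x → x + x ≡ 2 * x
        lemma₁ = solve-∀
        lemma₂ : ∀ p K E m → p * (2 * K * E) + m * (m * E) ≡ 2 * K * p * E + m * m * E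
        lemma₂ = solve-∀
        step : ∀ i j → 2 * K * r i j ≤ 𝟙 (pop? i j) * (2 * K * E) + E
        step i j with pop? i j
        ... | yes _ = ≤-trans (*-monoʳ-≤ (2 * K) (r≤E i j)) (≤-trans (m≤m+n _ 0) (m≤m+n _ E))
        ... | no h  = <⇒≤ (≰⇒> h)

      #bad-bound : #bad * (8 * K) ≤ m
      #bad-bound = *-cancelʳ-≤ (#bad * (8 * K)) m E (begin
        #bad * (8 * K) * E ≡⟨ *-assoc #bad (8 * K) E ⟩
        #bad * (8 * K * E) ≡⟨ ∑-*ʳ is _ (8 * K * E) ⟨
        ∑ is (λ i → 𝟙 (¬? (good? i)) * (8 * K * E)) ≤⟨ ∑-mono is (λ i → 𝟙*≤ (¬? (good? i)) (λ h → <⇒≤ (≰⇒> h))) ⟩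
        ∑ is (λ i → μ i * m) ≡⟨ ∑-*ʳ is μ m ⟩
        E * m ≡⟨ *-comm E m ⟩
        m * E ∎)

      Γ : I → I → Set
      Γ i j = (E ≤ 2 * K * r i j) × Good i × Good j

      Γ? : ∀ i j → Dec (Γ i j)
      Γ? i j = pop? i j ×-dec (good? i ×-dec good? j)

      deg : I → ℕ
      deg j = ∑ is (λ i → 𝟙 (Γ? i j))

      #Γ : ℕ
      #Γ = ∑ is deg

      -- By Markov's inequality at most m/8K indices are not good; they destroy at most m²/4K of the
      -- m²/2K popular pairs.
      m²≤4K#Γ : m * m ≤ 4 * K * #Γ
      m²≤4K#Γ = +-cancelʳ-≤ (m * m) _ _ (begin
        m * m + m * m ≤⟨ +-mono-≤ m²≤2K#pop m²≤2K#pop ⟩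
        2 * K * #pop + 2 * K * #pop ≡⟨ lemma₁ K #pop ⟩
        4 * K * #pop ≤⟨ *-monoʳ-≤ (4 * K) pop≤ ⟩
        4 * K * (#Γ + (m * #bad + m * #bad)) ≡⟨ lemma₂ K #Γ m #bad ⟩
        4 * K * #Γ + m * (#bad * (8 * K)) ≤⟨ +-monoʳ-≤ (4 * K * #Γ) (*-monoʳ-≤ m #bad-bound) ⟩
        4 * K * #Γ + m * m ∎)
        where
        lemma₁ : ∀ K p → 2 * K * p + 2 * K * p ≡ 4 * K * p
        lemma₁ = solve-∀
        lemma₂ : ∀ K g m b → 4 * K * (g + (m * b + m * b)) ≡ 4 * K * g + m * (b * (8 * K))
        lemma₂ = solve-∀
        step : ∀ i j → 𝟙 (pop? i j) ≤ 𝟙 (Γ? i j) + (𝟙 (¬? (good? i)) + 𝟙 (¬? (good? j)))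
        step i j with pop? i j | good? i | good? j
        ... | no _  | _     | _     = z≤n
        ... | yes _ | yes _ | yes _ = s≤s z≤n
        ... | yes _ | yes _ | no _  = s≤s z≤n
        ... | yes _ | no _  | _     = s≤s z≤n
        pop≤ : #pop ≤ #Γ + (m * #bad + m * #bad)
        pop≤ = begin
          #pop ≤⟨ ∑-mono is (λ i → ∑-mono is (step i)) ⟩
          ∑ is (λ i → ∑ is (λ j → 𝟙 (Γ? i j) + (𝟙 (¬? (good? i)) + 𝟙 (¬? (good? j))))) ≡⟨ ∑-cong is (λ i → trans (∑-+ is _ _) (cong (∑ is (λ j → 𝟙 (Γ? i j)) +_) (trans (∑-+ is _ _) (cong (_+ #bad) (∑-const is _))))) ⟩
          ∑ is (λ i → ∑ is (λ j → 𝟙 (Γ? i j)) + (m * 𝟙 (¬? (good? i)) + #bad)) ≡⟨ trans (∑-+ is _ _) (cong₂ _+_ (∑-swap is is _) (trans (∑-+ is _ _) (cong₂ _+_ (∑-*ˡ is m _) (∑-const is #bad)))) ⟩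
          #Γ + (m * #bad + m * #bad) ∎

      m³≤16K²∑deg² : m * m * m ≤ 16 * (K * K) * ∑ is (λ j → deg j * deg j)
      m³≤16K²∑deg² = *-cancelˡ-≤ m (begin
        m * (m * m * m) ≡⟨ lemma₁ m ⟩
        (m * m) * (m * m) ≤⟨ *-mono-≤ m²≤4K#Γ m²≤4K#Γ ⟩
        (4 * K * #Γ) * (4 * K * #Γ) ≡⟨ lemma₂ K #Γ ⟩
        16 * (K * K) * (#Γ * #Γ) ≤⟨ *-monoʳ-≤ (16 * (K * K)) (cauchy-schwarz is deg) ⟩
        16 * (K * K) * (m * D) ≡⟨ lemma₃ K m D ⟩
        m * (16 * (K * K) * D) ∎)
        where
        D = ∑ is (λ j → deg j * deg j)
        lemma₁ : ∀ m → m * (m * m * m) ≡ (m * m) * (m * m)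
        lemma₁ = solve-∀
        lemma₂ : ∀ K g → (4 * K * g) * (4 * K * g) ≡ 16 * (K * K) * (g * g)
        lemma₂ = solve-∀
        lemma₃ : ∀ K m D → 16 * (K * K) * (m * D) ≡ m * (16 * (K * K) * D)
        lemma₃ = solve-∀

      -- Pairs with fewer than m/C₁ common neighbours count as bad. With this value, `centre` leaves
      -- at most d²/8 bad pairs in a neighbourhood of size d.
      C₁ : ℕ
      C₁ = 256 * (K * K)

      codeg : I → I → ℕ
      codeg i i′ = ∑ is (λ j → 𝟙 (Γ? i j) * 𝟙 (Γ? i′ j))

      β? : ∀ i i′ → Dec (codeg i i′ * C₁ < m)
      β? i i′ = codeg i i′ * C₁ <? m

      #β : I → ℕ
      #β j = ∑ is (λ i → ∑ is (λ i′ → 𝟙 (β? i i′) * (𝟙 (Γ? i j) * 𝟙 (Γ? i′ j))))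

      ∑#β-bound : C₁ * ∑ is #β ≤ m * m * m
      ∑#β-bound = begin
        C₁ * ∑ is #β ≡⟨ cong (C₁ *_) (trans (∑-swap is is _) (∑-cong is λ i → trans (∑-swap is is _) (∑-cong is λ i′ → ∑-*ˡ is (𝟙 (β? i i′)) _))) ⟩
        C₁ * ∑ is (λ i → ∑ is (λ i′ → 𝟙 (β? i i′) * codeg i i′)) ≡⟨ trans (sym (∑-*ˡ is C₁ _)) (∑-cong is λ i → sym (∑-*ˡ is C₁ _)) ⟩
        ∑ is (λ i → ∑ is (λ i′ → C₁ * (𝟙 (β? i i′) * codeg i i′))) ≤⟨ ∑-mono is (λ i → ∑-mono is (λ i′ → step i i′)) ⟩
        ∑ is (λ i → ∑ is (λ i′ → m)) ≡⟨ trans (∑-cong is λ i → ∑-const is m) (∑-const is (m * m)) ⟩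
        m * (m * m) ≡⟨ *-assoc m m m ⟨
        m * m * m ∎
        where
        lemma : ∀ a b c → a * (b * c) ≡ b * (c * a)
        lemma = solve-∀
        step : ∀ i i′ → C₁ * (𝟙 (β? i i′) * codeg i i′) ≤ m
        step i i′ = ≤-trans (≤-reflexive (lemma C₁ (𝟙 (β? i i′)) (codeg i i′))) (𝟙*≤ (β? i i′) <⇒≤)

      -- Averaging one quantity, 32K² deg² - C₁ #β - m², over all j: its sum is nonnegative, so some
      -- neighbourhood is large and at the same time has few bad pairs.
      centre : Σ I λ j → j ∈ is × C₁ * #β j + m * m ≤ 32 * (K * K) * (deg j * deg j)
      centre = ∑-≤⇒∃ is (λ j → C₁ * #β j + m * m) (λ j → 32 * (K * K) * (deg j * deg j)) (>-nonZero⁻¹ m) (begin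
        ∑ is (λ j → C₁ * #β j + m * m) ≡⟨ trans (∑-+ is _ _) (cong₂ _+_ (∑-*ˡ is C₁ #β) (∑-const is (m * m))) ⟩
        C₁ * ∑ is #β + m * (m * m) ≤⟨ +-monoˡ-≤ _ ∑#β-bound ⟩
        m * m * m + m * (m * m) ≡⟨ lemma₁ m ⟩
        2 * (m * m * m) ≤⟨ *-monoʳ-≤ 2 m³≤16K²∑deg² ⟩
        2 * (16 * (K * K) * D) ≡⟨ lemma₂ K D ⟩
        32 * (K * K) * D ≡⟨ ∑-*ˡ is (32 * (K * K)) _ ⟨
        ∑ is (λ j → 32 * (K * K) * (deg j * deg j)) ∎)
        where
        D = ∑ is (λ j → deg j * deg j)
        lemma₁ : ∀ m → m * m * m + m * (m * m) ≡ 2 * (m * m * m)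
        lemma₁ = solve-∀
        lemma₂ : ∀ K D → 2 * (16 * (K * K) * D) ≡ 32 * (K * K) * D
        lemma₂ = solve-∀

      c₀ Λ : ℕ
      c₀ = 12 * K * (C₁ * C₁) * (16 * (K * K * (K * K)))
      Λ  = c₀ * (8 * K * (8 * K * (8 * K)))

      Triples = cartesianProduct is (cartesianProduct is is)
      Pairs   = cartesianProduct is is
      Octuples = cartesianProduct (cartesianProduct Pairs Pairs) (cartesianProduct Pairs Pairs)

      Triple Octuple : Set
      Triple  = I × I × I
      Octuple = ((I × I) × (I × I)) × ((I × I) × (I × I))

      -- The path i, j, h, j′, i′ in the bipartite graph Γ; its ends and its middle are on the same
      -- side.
      Path : I × I → Triple → Set
      Path (i , i′) (h , j , j′) = (Γ i j × Γ h j) × (Γ i′ j′ × Γ h j′)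

      path? : ∀ z t → Dec (Path z t)
      path? (i , i′) (h , j , j′) = (Γ? i j ×-dec Γ? h j) ×-dec (Γ? i′ j′ ×-dec Γ? h j′)

      _≐_ : I × I → I × I → Set ℓ
      (i , j) ≐ (k , l) = g i ⁻¹ ∙ g j ≈ g k ⁻¹ ∙ g l

      _≐?_ : ∀ z z′ → Dec (z ≐ z′)
      (i , j) ≐? (k , l) = Q? i j k l

      -- The four quotients along the path, each rewritten by an arbitrary representation.
      -- Popularity gives at least (E/2K)⁴ such θ for each path.
      Rep : I × I → Triple → Octuple → Set ℓ
      Rep (i , i′) (h , j , j′) ((p₁ , p₂) , (p₃ , p₄)) =
        ((i , j) ≐ p₁ × (h , j) ≐ p₂) × ((i′ , j′) ≐ p₃ × (h , j′) ≐ p₄)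

      rep? : ∀ z t θ → Dec (Rep z t θ)
      rep? (i , i′) (h , j , j′) ((p₁ , p₂) , (p₃ , p₄)) =
        (((i , j) ≐? p₁) ×-dec ((h , j) ≐? p₂)) ×-dec (((i′ , j′) ≐? p₃) ×-dec ((h , j′) ≐? p₄))

      Φ : I × I → ℕ
      Φ z = ∑ Triples (λ t → ∑ Octuples (λ θ → 𝟙 (path? z t) * 𝟙 (rep? z t θ)))

      ∑rep : ∀ i i′ h j j′ → ∑ Octuples (λ θ → 𝟙 (rep? (i , i′) (h , j , j′) θ)) ≡ (r i j * r h j) * (r i′ j′ * r h j′)
      ∑rep i i′ h j j′ = begin-equality
        ∑ Octuples (λ θ → 𝟙 (rep? (i , i′) (h , j , j′) θ)) ≡⟨ ∑-cartesianProduct PP PP _ ⟩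
        ∑ PP (λ p → ∑ PP (λ q → 𝟙 (rep? (i , i′) (h , j , j′) (p , q)))) ≡⟨ ∑-cong PP (λ p → ∑-cong PP λ q → 𝟙-× (((i , j) ≐? proj₁ p) ×-dec ((h , j) ≐? proj₂ p)) (((i′ , j′) ≐? proj₁ q) ×-dec ((h , j′) ≐? proj₂ q))) ⟩
        ∑ PP (λ p → ∑ PP (λ q → f i j h p * f i′ j′ h q)) ≡⟨ ∑-∑-* PP PP (f i j h) (f i′ j′ h) ⟩
        ∑ PP (f i j h) * ∑ PP (f i′ j′ h) ≡⟨ cong₂ _*_ (∑f i j h) (∑f i′ j′ h) ⟩
        (r i j * r h j) * (r i′ j′ * r h j′) ∎
        where
        PP = cartesianProduct Pairs Pairs
        f : I → I → I → (I × I) × (I × I) → ℕ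
        f i j h (p₁ , p₂) = 𝟙 (((i , j) ≐? p₁) ×-dec ((h , j) ≐? p₂))
        ∑f : ∀ i j h → ∑ PP (f i j h) ≡ r i j * r h j
        ∑f i j h = begin-equality
          ∑ PP (f i j h) ≡⟨ ∑-cartesianProduct Pairs Pairs _ ⟩
          ∑ Pairs (λ p₁ → ∑ Pairs (λ p₂ → f i j h (p₁ , p₂))) ≡⟨ ∑-cong Pairs (λ p₁ → ∑-cong Pairs λ p₂ → 𝟙-× ((i , j) ≐? p₁) ((h , j) ≐? p₂)) ⟩
          ∑ Pairs (λ p₁ → ∑ Pairs (λ p₂ → 𝟙 ((i , j) ≐? p₁) * 𝟙 ((h , j) ≐? p₂))) ≡⟨ ∑-∑-* Pairs Pairs _ _ ⟩
          ∑ Pairs (λ p₁ → 𝟙 ((i , j) ≐? p₁)) * ∑ Pairs (λ p₂ → 𝟙 ((h , j) ≐? p₂)) ≡⟨ cong₂ _*_ (∑-cartesianProduct is is _) (∑-cartesianProduct is is _) ⟩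
          r i j * r h j ∎

      twoPaths : I → I → ℕ
      twoPaths i i′ = ∑ is (λ h → codeg i h * codeg i′ h)

      ∑path : ∀ i i′ → ∑ Triples (λ t → 𝟙 (path? (i , i′) t)) ≡ twoPaths i i′
      ∑path i i′ = begin-equality
        ∑ Triples (λ t → 𝟙 (path? (i , i′) t)) ≡⟨ trans (∑-cartesianProduct is _ _) (∑-cong is λ h → ∑-cartesianProduct is is _) ⟩
        ∑ is (λ h → ∑ is (λ j → ∑ is (λ j′ → 𝟙 (path? (i , i′) (h , j , j′)))))
          ≡⟨ ∑-cong is (λ h → ∑-cong is λ j → ∑-cong is λ j′ → trans (𝟙-× (Γ? i j ×-dec Γ? h j) (Γ? i′ j′ ×-dec Γ? h j′)) (cong₂ _*_ (𝟙-× (Γ? i j) (Γ? h j)) (𝟙-× (Γ? i′ j′) (Γ? h j′)))) ⟩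
        ∑ is (λ h → ∑ is (λ j → ∑ is (λ j′ → (𝟙 (Γ? i j) * 𝟙 (Γ? h j)) * (𝟙 (Γ? i′ j′) * 𝟙 (Γ? h j′))))) ≡⟨ ∑-cong is (λ h → ∑-∑-* is is _ _) ⟩
        twoPaths i i′ ∎

      E⁴ : ℕ
      E⁴ = (E * E) * (E * E)

      E⁴twoPaths≤ : ∀ i i′ → E⁴ * twoPaths i i′ ≤ 16 * (K * K * (K * K)) * Φ (i , i′)
      E⁴twoPaths≤ i i′ = begin
        E⁴ * twoPaths i i′ ≡⟨ trans (cong (E⁴ *_) (sym (∑path i i′))) (sym (∑-*ˡ Triples E⁴ _)) ⟩
        ∑ Triples (λ t → E⁴ * 𝟙 (path? (i , i′) t)) ≤⟨ ∑-mono Triples step ⟩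
        ∑ Triples (λ t → 16 * (K * K * (K * K)) * ∑ Octuples (λ θ → 𝟙 (path? (i , i′) t) * 𝟙 (rep? (i , i′) t θ))) ≡⟨ ∑-*ˡ Triples (16 * (K * K * (K * K))) (λ t → ∑ Octuples (λ θ → 𝟙 (path? (i , i′) t) * 𝟙 (rep? (i , i′) t θ))) ⟩
        16 * (K * K * (K * K)) * Φ (i , i′) ∎
        where
        regroup : ∀ K a b c d → ((2 * K * a) * (2 * K * b)) * ((2 * K * c) * (2 * K * d)) ≡ 16 * (K * K * (K * K)) * ((a * b) * (c * d))
        regroup = solve-∀
        swap : ∀ a b c → a * (b * c) ≡ b * (a * c)
        swap = solve-∀
        step : ∀ t → E⁴ * 𝟙 (path? (i , i′) t) ≤ 16 * (K * K * (K * K)) * ∑ Octuples (λ θ → 𝟙 (path? (i , i′) t) * 𝟙 (rep? (i , i′) t θ))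
        step t@(h , j , j′) = begin
          E⁴ * 𝟙 (path? (i , i′) t) ≡⟨ *-comm E⁴ _ ⟩
          𝟙 (path? (i , i′) t) * E⁴ ≤⟨ 𝟙* (path? (i , i′) t) (λ (((a , _) , (b , _)) , ((c , _) , (d , _))) → ≤-trans (*-mono-≤ (*-mono-≤ a b) (*-mono-≤ c d)) (≤-reflexive (regroup K (r i j) (r h j) (r i′ j′) (r h j′)))) ⟩
          𝟙 (path? (i , i′) t) * (16 * (K * K * (K * K)) * ((r i j * r h j) * (r i′ j′ * r h j′))) ≡⟨ swap (𝟙 (path? (i , i′) t)) (16 * (K * K * (K * K))) _ ⟩
          16 * (K * K * (K * K)) * (𝟙 (path? (i , i′) t) * ((r i j * r h j) * (r i′ j′ * r h j′))) ≡⟨ cong (λ x → 16 * (K * K * (K * K)) * (𝟙 (path? (i , i′) t) * x)) (sym (∑rep i i′ h j j′)) ⟩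
          16 * (K * K * (K * K)) * (𝟙 (path? (i , i′) t) * ∑ Octuples (λ θ → 𝟙 (rep? (i , i′) t θ))) ≡⟨ cong (16 * (K * K * (K * K)) *_) (sym (∑-*ˡ Octuples (𝟙 (path? (i , i′) t)) _)) ⟩
          16 * (K * K * (K * K)) * ∑ Octuples (λ θ → 𝟙 (path? (i , i′) t) * 𝟙 (rep? (i , i′) t θ)) ∎

      -- θ fixes the four quotients along the path, and by `quotient-quotient` these combine to the
      -- quotient of the endpoints.
      Rep-determines-pair : ∀ {z t z′ t′ θ} → Rep z t θ → Rep z′ t′ θ → z ≐ z′
      Rep-determines-pair {i , i′} {h , j , j′} {k , k′} {h₂ , l , l′} ((a , b) , (c , d)) ((a′ , b′) , (c′ , d′)) =
        ≈-trans (≈-sym (chain i j h j′ i′)) (≈-trans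
          (∙-cong (∙-cong (≈-trans a (≈-sym a′)) (⁻¹-cong (≈-trans b (≈-sym b′))))
                  (⁻¹-cong (∙-cong (≈-trans c (≈-sym c′)) (⁻¹-cong (≈-trans d (≈-sym d′))))))
          (chain k l h₂ l′ k′))
        where
        chain : ∀ i j h j′ i′ → ((g i ⁻¹ ∙ g j) ∙ (g h ⁻¹ ∙ g j) ⁻¹) ∙ ((g i′ ⁻¹ ∙ g j′) ∙ (g h ⁻¹ ∙ g j′) ⁻¹) ⁻¹ ≈ g i ⁻¹ ∙ g i′
        chain i j h j′ i′ = ≈-trans (∙-cong (quotient-quotient (g i) (g j) (g h)) (⁻¹-cong (quotient-quotient (g i′) (g j′) (g h)))) (quotient-quotient (g i) (g h) (g i′))

      _~³_ : Triple → Triple → Set ℓ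
      (h , j , j′) ~³ (h₂ , l , l′) = g h ≈ g h₂ × g j ≈ g l × g j′ ≈ g l′

      -- With the endpoints known, the first and third quotients give g j and g j′; then the second
      -- gives g h.
      Rep-determines-triple : ∀ {z t t′ θ} → Rep z t θ → Rep z t′ θ → t ~³ t′
      Rep-determines-triple {i , i′} {h , j , j′} {h₂ , l , l′} ((a , b) , (c , d)) ((a′ , b′) , (c′ , d′)) = hh , jj , jj′
        where
        open import Algebra.Properties.Group G using (⁻¹-injective)
        jj : g j ≈ g l
        jj = ∙-cancelˡ (g i ⁻¹) _ _ (≈-trans a (≈-sym a′))
        jj′ : g j′ ≈ g l′
        jj′ = ∙-cancelˡ (g i′ ⁻¹) _ _ (≈-trans c (≈-sym c′))
        hh : g h ≈ g h₂
        hh = ⁻¹-injective (∙-cancelʳ (g j) _ _ (≈-trans (≈-trans b (≈-sym b′)) (∙-congˡ (≈-sym jj))))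

      triple? : ∀ t t′ → Dec (t ~³ t′)
      triple? (h , j , j′) (h₂ , l , l′) = (h ~? h₂) ×-dec ((j ~? l) ×-dec (j′ ~? l′))

      ∑triple : ∀ h j j′ → ∑ Triples (λ t → 𝟙 (triple? (h , j , j′) t)) ≡ μ h * (μ j * μ j′)
      ∑triple h j j′ = begin-equality
        ∑ Triples (λ t → 𝟙 (triple? (h , j , j′) t)) ≡⟨ trans (∑-cartesianProduct is _ _) (∑-cong is λ h₂ → ∑-cartesianProduct is is _) ⟩
        ∑ is (λ h₂ → ∑ is (λ l → ∑ is (λ l′ → 𝟙 (triple? (h , j , j′) (h₂ , l , l′)))))
          ≡⟨ ∑-cong is (λ h₂ → ∑-cong is λ l → ∑-cong is λ l′ → trans (𝟙-× (h ~? h₂) _) (cong (𝟙 (h ~? h₂) *_) (𝟙-× (j ~? l) (j′ ~? l′)))) ⟩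
        ∑ is (λ h₂ → ∑ is (λ l → ∑ is (λ l′ → 𝟙 (h ~? h₂) * (𝟙 (j ~? l) * 𝟙 (j′ ~? l′)))))
          ≡⟨ ∑-cong is (λ h₂ → trans (∑-cong is λ l → ∑-*ˡ is (𝟙 (h ~? h₂)) _) (trans (∑-*ˡ is (𝟙 (h ~? h₂)) _) (cong (𝟙 (h ~? h₂) *_) (∑-∑-* is is _ _)))) ⟩
        ∑ is (λ h₂ → 𝟙 (h ~? h₂) * (μ j * μ j′)) ≡⟨ ∑-*ʳ is _ _ ⟩
        μ h * (μ j * μ j′) ∎

      cube : ℕ → ℕ
      cube x = x * (x * x)

      -- Once θ is fixed, at most one z of the list contributes, and its middle triple is determined
      -- up to equality in the group. Such a triple has multiplicity μ h μ j μ j′, at most (8KE/m)³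
      -- since these indices are good.
      fixed-θ : ∀ zs → AllPairs (λ z z′ → ¬ z ≐ z′) zs → ∀ θ →
                cube m * ∑ zs (λ z → ∑ Triples (λ t → 𝟙 (path? z t) * 𝟙 (rep? z t θ))) ≤ cube (8 * K * E)
      fixed-θ zs distinct θ = ∑-zero-or-∃ zs (λ z → ∑ Triples (W z)) (λ s → cube m * s ≤ cube (8 * K * E))
        (≤-trans (≤-reflexive (*-zeroʳ (cube m))) z≤n)
        λ z₀ z₀∈ lt → nonempty z₀ z₀∈ (∑-<⇒∃ Triples (λ _ → 0) (W z₀)
          (≤-trans (s≤s (≤-reflexive (trans (∑-const Triples 0) (*-zeroʳ (length Triples))))) lt))
        where
        W : I × I → Triple → ℕ
        W z t = 𝟙 (path? z t) * 𝟙 (rep? z t θ)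
        regroup : ∀ m a b c → m * (m * m) * (a * (b * c)) ≡ (a * m) * ((b * m) * (c * m))
        regroup = solve-∀
        both : ∀ {z z₀ t t₀} → z ∈ zs → z₀ ∈ zs → Rep z₀ t₀ θ → Rep z t θ → z ≐ z₀ × t₀ ~³ t
        both {z} {z₀} {t} {t₀} z∈ z₀∈ ρ₀ ρ = e , Rep-determines-triple {z₀} {t₀} {t} {θ} ρ₀
          (subst (λ z → Rep z t θ) (distinct⇒≡ ≈-refl ≈-sym ≈-trans _≐?_ distinct z∈ z₀∈ e) ρ)
          where
          e : z ≐ z₀
          e = Rep-determines-pair {z} {t} {z₀} {t₀} {θ} ρ ρ₀
        bound : ∀ {z z₀ t₀} → z ∈ zs → z₀ ∈ zs → Rep z₀ t₀ θ → ∀ t → W z t ≤ 𝟙 (z ≐? z₀) * 𝟙 (triple? t₀ t)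
        bound {z} {z₀} {t₀} z∈ z₀∈ ρ₀ t = ≤-trans
          (𝟙*≤ (path? z t) (λ _ → 𝟙-mono (rep? z t θ) ((z ≐? z₀) ×-dec triple? t₀ t) (both {z} {z₀} {t} {t₀} z∈ z₀∈ ρ₀)))
          (≤-reflexive (𝟙-× (z ≐? z₀) (triple? t₀ t)))
        estimate : ∀ z₀ t₀ → z₀ ∈ zs → Path z₀ t₀ → Rep z₀ t₀ θ → cube m * ∑ zs (λ z → ∑ Triples (W z)) ≤ cube (8 * K * E)
        estimate z₀ t₀@(h , j , j′) z₀∈ ((((_ , _ , gj) , (_ , gh , _)) , ((_ , _ , gj′) , _))) ρ₀ = begin
          cube m * ∑ zs (λ z → ∑ Triples (W z)) ≤⟨ *-monoʳ-≤ (cube m) (∑-mono-∈ zs λ {z} z∈ → ∑-mono Triples (bound {z} {z₀} {t₀} z∈ z₀∈ ρ₀)) ⟩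
          cube m * ∑ zs (λ z → ∑ Triples (λ t → 𝟙 (z ≐? z₀) * 𝟙 (triple? t₀ t))) ≡⟨ cong (cube m *_) (∑-∑-* zs Triples (λ z → 𝟙 (z ≐? z₀)) (λ t → 𝟙 (triple? t₀ t))) ⟩
          cube m * (∑ zs (λ z → 𝟙 (z ≐? z₀)) * ∑ Triples (λ t → 𝟙 (triple? t₀ t))) ≤⟨ *-monoʳ-≤ (cube m) (*-monoˡ-≤ _ (∑𝟙≤1 (_≐? z₀) (λ ne e e′ → ne (≈-trans e (≈-sym e′))) distinct)) ⟩
          cube m * (1 * ∑ Triples (λ t → 𝟙 (triple? t₀ t))) ≡⟨ cong (cube m *_) (trans (*-identityˡ _) (∑triple h j j′)) ⟩
          cube m * (μ h * (μ j * μ j′)) ≡⟨ regroup m (μ h) (μ j) (μ j′) ⟩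
          (μ h * m) * ((μ j * m) * (μ j′ * m)) ≤⟨ *-mono-≤ gh (*-mono-≤ gj gj′) ⟩
          cube (8 * K * E) ∎
        nonempty : ∀ z₀ → z₀ ∈ zs → (Σ Triple λ t → t ∈ Triples × 0 < W z₀ t) → cube m * ∑ zs (λ z → ∑ Triples (W z)) ≤ cube (8 * K * E)
        nonempty z₀ z₀∈ (t₀ , _ , lt) = let p , ρ = 𝟙*𝟙>0 (path? z₀ t₀) (rep? z₀ t₀ θ) lt in estimate z₀ t₀ z₀∈ p ρ

      ∑Φ-bound : ∀ zs → AllPairs (λ z z′ → ¬ z ≐ z′) zs → cube m * ∑ zs Φ ≤ length Octuples * cube (8 * K * E)
      ∑Φ-bound zs distinct = begin
        cube m * ∑ zs Φ ≡⟨ cong (cube m *_) (trans (∑-cong zs λ z → ∑-swap Triples Octuples _) (∑-swap zs Octuples _)) ⟩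
        cube m * ∑ Octuples (λ θ → ∑ zs (λ z → ∑ Triples (λ t → 𝟙 (path? z t) * 𝟙 (rep? z t θ)))) ≡⟨ ∑-*ˡ Octuples (cube m) _ ⟨
        ∑ Octuples (λ θ → cube m * ∑ zs (λ z → ∑ Triples (λ t → 𝟙 (path? z t) * 𝟙 (rep? z t θ)))) ≤⟨ ∑-≤const Octuples (cube (8 * K * E)) (λ {θ} _ → fixed-θ zs distinct θ) ⟩
        length Octuples * cube (8 * K * E) ∎

      module Centred (j₀ : I) (central : C₁ * #β j₀ + m * m ≤ 32 * (K * K) * (deg j₀ * deg j₀)) where

        d : ℕ
        d = deg j₀

        Nbr : List I
        Nbr = filter (λ i → Γ? i j₀) is

        length-Nbr : length Nbr ≡ d
        length-Nbr = length-filter≡∑ (λ i → Γ? i j₀) is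

        m≤6Kd : m ≤ 6 * K * d
        m≤6Kd = square-cancel-≤ (begin
          m * m ≤⟨ m≤n+m _ (C₁ * #β j₀) ⟩
          C₁ * #β j₀ + m * m ≤⟨ central ⟩
          32 * (K * K) * (d * d) ≤⟨ *-monoˡ-≤ (d * d) (*-monoˡ-≤ (K * K) (m≤m+n 32 4)) ⟩
          36 * (K * K) * (d * d) ≡⟨ lemma K d ⟩
          6 * K * d * (6 * K * d) ∎)
          where
          lemma : ∀ K d → 36 * (K * K) * (d * d) ≡ 6 * K * d * (6 * K * d)
          lemma = solve-∀

        instance
          d-nonZero : NonZero d
          d-nonZero = ≢-nonZero λ d≡0 → <⇒≱ (>-nonZero⁻¹ m) (≤-trans m≤6Kd (≤-reflexive (trans (cong (6 * K *_) d≡0) (*-zeroʳ (6 * K)))))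

        8#β≤d² : 8 * #β j₀ ≤ d * d
        8#β≤d² = *-cancelˡ-≤ (32 * (K * K)) {{m*n≢0 32 (K * K) {{_}} {{m*n≢0 K K}}}} (begin
          32 * (K * K) * (8 * #β j₀) ≡⟨ lemma K (#β j₀) ⟩
          C₁ * #β j₀ ≤⟨ m≤m+n _ (m * m) ⟩
          C₁ * #β j₀ + m * m ≤⟨ central ⟩
          32 * (K * K) * (d * d) ∎)
          where
          lemma : ∀ K b → 32 * (K * K) * (8 * b) ≡ 256 * (K * K) * b
          lemma = solve-∀

        badIn : I → ℕ
        badIn i = ∑ Nbr (λ i′ → 𝟙 (β? i i′))

        ∑badIn : ∑ Nbr badIn ≡ #β j₀
        ∑badIn = begin-equality
          ∑ Nbr badIn ≡⟨ ∑-filter _ is badIn ⟩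
          ∑ is (λ i → 𝟙 (Γ? i j₀) * badIn i) ≡⟨ ∑-cong is (λ i → cong (𝟙 (Γ? i j₀) *_) (∑-filter _ is _)) ⟩
          ∑ is (λ i → 𝟙 (Γ? i j₀) * ∑ is (λ i′ → 𝟙 (Γ? i′ j₀) * 𝟙 (β? i i′))) ≡⟨ ∑-cong is (λ i → trans (sym (∑-*ˡ is (𝟙 (Γ? i j₀)) _)) (∑-cong is λ i′ → lemma (𝟙 (Γ? i j₀)) (𝟙 (Γ? i′ j₀)) (𝟙 (β? i i′)))) ⟩
          #β j₀ ∎
          where
          lemma : ∀ a b c → a * (b * c) ≡ c * (a * b)
          lemma = solve-∀

        Core : I → Set
        Core i = Γ i j₀ × 4 * badIn i ≤ d

        core? : ∀ i → Dec (Core i)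
        core? i = Γ? i j₀ ×-dec (4 * badIn i ≤? d)

        #core : ℕ
        #core = ∑ is (λ i → 𝟙 (core? i))

        -- The at most d²/8 bad pairs leave at most d/2 neighbours with more than d/4 bad partners.
        d≤2#core : d ≤ 2 * #core
        d≤2#core = *-cancelʳ-≤ d (2 * #core) d (+-cancelʳ-≤ (d * d) _ _ (begin
          d * d + d * d ≡⟨ lemma₁ d ⟩
          2 * (d * d) ≡⟨ cong (2 *_) (∑-*ʳ is _ d) ⟨
          2 * ∑ is (λ i → 𝟙 (Γ? i j₀) * d) ≤⟨ *-monoʳ-≤ 2 (∑-mono is step) ⟩
          2 * ∑ is (λ i → 𝟙 (core? i) * d + 𝟙 (Γ? i j₀) * (4 * badIn i)) ≡⟨ cong (2 *_) (trans (∑-+ is _ _) (cong₂ _+_ (∑-*ʳ is _ d) (trans (sym (∑-filter _ is _)) (∑-*ˡ Nbr 4 badIn)))) ⟩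
          2 * (#core * d + 4 * ∑ Nbr badIn) ≡⟨ cong (λ x → 2 * (#core * d + 4 * x)) ∑badIn ⟩
          2 * (#core * d + 4 * #β j₀) ≡⟨ lemma₂ #core d (#β j₀) ⟩
          2 * #core * d + 8 * #β j₀ ≤⟨ +-monoʳ-≤ (2 * #core * d) 8#β≤d² ⟩
          2 * #core * d + d * d ∎))
          where
          lemma₁ : ∀ d → d * d + d * d ≡ 2 * (d * d)
          lemma₁ = solve-∀
          lemma₂ : ∀ c d b → 2 * (c * d + 4 * b) ≡ 2 * c * d + 8 * b
          lemma₂ = solve-∀
          step : ∀ i → 𝟙 (Γ? i j₀) * d ≤ 𝟙 (core? i) * d + 𝟙 (Γ? i j₀) * (4 * badIn i)
          step i = 𝟙-split (Γ? i j₀) (4 * badIn i ≤? d) λ h → <⇒≤ (≰⇒> h)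

        m≤12K#core : m ≤ 12 * K * #core
        m≤12K#core = begin
          m ≤⟨ m≤6Kd ⟩
          6 * K * d ≤⟨ *-monoʳ-≤ (6 * K) d≤2#core ⟩
          6 * K * (2 * #core) ≡⟨ lemma K #core ⟩
          12 * K * #core ∎
          where
          lemma : ∀ K c → 6 * K * (2 * c) ≡ 12 * K * c
          lemma = solve-∀

        -- At least d - d/4 - d/4 neighbours h of `j₀` are bad with neither endpoint, and each
        -- offers (m/C₁)² choices of j and j′.
        dm²≤2C₁²twoPaths : ∀ {i i′} → Core i → Core i′ → d * (m * m) ≤ 2 * (C₁ * C₁) * twoPaths i i′
        dm²≤2C₁²twoPaths {i} {i′} (_ , bi) (_ , bi′) = *-cancelˡ-≤ 2 (+-cancelʳ-≤ (2 * (d * (m * m))) _ _ (begin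
          2 * (d * (m * m)) + 2 * (d * (m * m)) ≡⟨ lemma₁ (d * (m * m)) ⟩
          4 * (d * (m * m)) ≡⟨ cong (4 *_) (trans (cong (_* (m * m)) (sym length-Nbr)) (sym (∑-const Nbr (m * m)))) ⟩
          4 * ∑ Nbr (λ h → m * m) ≤⟨ *-monoʳ-≤ 4 (∑-mono Nbr step) ⟩
          4 * ∑ Nbr (λ h → C₁ * C₁ * (codeg i h * codeg i′ h) + (𝟙 (β? i h) * (m * m) + 𝟙 (β? i′ h) * (m * m)))
            ≡⟨ cong (4 *_) (trans (∑-+ Nbr _ _) (cong₂ _+_ (∑-*ˡ Nbr (C₁ * C₁) _) (trans (∑-+ Nbr _ _) (cong₂ _+_ (∑-*ʳ Nbr _ (m * m)) (∑-*ʳ Nbr _ (m * m)))))) ⟩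
          4 * (C₁ * C₁ * X + (badIn i * (m * m) + badIn i′ * (m * m))) ≡⟨ lemma₂ (C₁ * C₁ * X) (badIn i) (badIn i′) (m * m) ⟩
          4 * (C₁ * C₁ * X) + (4 * badIn i + 4 * badIn i′) * (m * m) ≤⟨ +-mono-≤ (*-monoʳ-≤ 4 (*-monoʳ-≤ (C₁ * C₁) X≤)) (*-monoˡ-≤ (m * m) (+-mono-≤ bi bi′)) ⟩
          4 * (C₁ * C₁ * twoPaths i i′) + (d + d) * (m * m) ≡⟨ lemma₃ (C₁ * C₁) (twoPaths i i′) d (m * m) ⟩
          2 * (2 * (C₁ * C₁) * twoPaths i i′) + 2 * (d * (m * m)) ∎))
          where
          X = ∑ Nbr (λ h → codeg i h * codeg i′ h)
          X≤ : X ≤ twoPaths i i′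
          X≤ = ≤-trans (≤-reflexive (∑-filter _ is _)) (∑-mono is λ h → 𝟙*≤ (Γ? h j₀) λ _ → ≤-refl)
          lemma₁ : ∀ x → 2 * x + 2 * x ≡ 4 * x
          lemma₁ = solve-∀
          lemma₂ : ∀ x b c m → 4 * (x + (b * m + c * m)) ≡ 4 * x + (4 * b + 4 * c) * m
          lemma₂ = solve-∀
          lemma₃ : ∀ c x d m → 4 * (c * x) + (d + d) * m ≡ 2 * (2 * c * x) + 2 * (d * m)
          lemma₃ = solve-∀
          lemma₄ : ∀ a b c → (a * c) * (b * c) ≡ c * c * (a * b)
          lemma₄ = solve-∀
          step : ∀ h → m * m ≤ C₁ * C₁ * (codeg i h * codeg i′ h) + (𝟙 (β? i h) * (m * m) + 𝟙 (β? i′ h) * (m * m))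
          step h = ≤-𝟙-or (β? i h) (β? i′ h) λ p q →
            ≤-trans (*-mono-≤ (≮⇒≥ p) (≮⇒≥ q)) (≤-reflexive (lemma₄ (codeg i h) (codeg i′ h) C₁))

        -- Double counting of paths with representations: each z has at least m³E⁴/c₀ of them, and
        -- all z together have at most m⁸(8KE/m)³. So there are at most Λ times the effective size
        -- m²/E of quotients.
        few-quotients : ∀ zs → AllPairs (λ z z′ → ¬ z ≐ z′) zs → All (λ (i , i′) → Core i × Core i′) zs →
                        length zs * E ≤ Λ * (m * m)
        few-quotients zs distinct core = *-cancelʳ-≤ _ _ (cube m * cube m * cube E) {{nz}} (begin
          length zs * E * (cube m * cube m * cube E) ≡⟨ regroup₁ (length zs) E m ⟩
          cube m * (length zs * (cube m * E⁴)) ≤⟨ *-monoʳ-≤ (cube m) (∑-≥const zs (cube m * E⁴) (λ z∈ → each (proj₁ (All.lookup core z∈)) (proj₂ (All.lookup core z∈)))) ⟩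
          cube m * ∑ zs (λ z → c₀ * Φ z) ≡⟨ cong (cube m *_) (∑-*ˡ zs c₀ Φ) ⟩
          cube m * (c₀ * ∑ zs Φ) ≡⟨ swap (cube m) c₀ (∑ zs Φ) ⟩
          c₀ * (cube m * ∑ zs Φ) ≤⟨ *-monoʳ-≤ c₀ (∑Φ-bound zs distinct) ⟩
          c₀ * (length Octuples * cube (8 * K * E)) ≡⟨ cong (λ x → c₀ * (x * cube (8 * K * E))) length-Octuples ⟩
          c₀ * ((m * m * (m * m) * (m * m * (m * m))) * cube (8 * K * E)) ≡⟨ regroup₂ c₀ m (8 * K) E ⟩
          Λ * (m * m) * (cube m * cube m * cube E) ∎)
          where
          nz : NonZero (cube m * cube m * cube E)
          nz = m*n≢0 _ _ {{m*n≢0 _ _ {{cube-nz m}} {{cube-nz m}}}} {{cube-nz E}}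
            where
            cube-nz : ∀ x .{{_ : NonZero x}} → NonZero (cube x)
            cube-nz x {{nz}} = m*n≢0 x (x * x) {{nz}} {{m*n≢0 x x {{nz}} {{nz}}}}
          swap : ∀ a b c → a * (b * c) ≡ b * (a * c)
          swap = solve-∀
          regroup₁ : ∀ z E m → z * E * (m * (m * m) * (m * (m * m)) * (E * (E * E))) ≡ m * (m * m) * (z * (m * (m * m) * ((E * E) * (E * E))))
          regroup₁ = solve-∀
          regroup₂ : ∀ c m k E → c * ((m * m * (m * m) * (m * m * (m * m))) * ((k * E) * ((k * E) * (k * E)))) ≡ c * (k * (k * k)) * (m * m) * (m * (m * m) * (m * (m * m)) * (E * (E * E)))
          regroup₂ = solve-∀
          length-Octuples : length Octuples ≡ m * m * (m * m) * (m * m * (m * m))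
          length-Octuples = trans (length-cartesianProduct PP PP) (cong₂ _*_ pp pp)
            where
            PP = cartesianProduct Pairs Pairs
            pp : length PP ≡ m * m * (m * m)
            pp = trans (length-cartesianProduct Pairs Pairs) (cong₂ _*_ (length-cartesianProduct is is) (length-cartesianProduct is is))
          regroup₃ : ∀ m e → m * (m * m) * e ≡ m * ((m * m) * e)
          regroup₃ = solve-∀
          regroup₄ : ∀ k d m e → 6 * k * d * ((m * m) * e) ≡ 6 * k * e * (d * (m * m))
          regroup₄ = solve-∀
          regroup₅ : ∀ k e c t → 6 * k * e * (2 * c * t) ≡ 12 * k * c * (e * t)
          regroup₅ = solve-∀
          each : ∀ {i i′} → Core i → Core i′ → cube m * E⁴ ≤ c₀ * Φ (i , i′)
          each {i} {i′} ci ci′ = begin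
            cube m * E⁴ ≡⟨ regroup₃ m E⁴ ⟩
            m * ((m * m) * E⁴) ≤⟨ *-monoˡ-≤ ((m * m) * E⁴) m≤6Kd ⟩
            6 * K * d * ((m * m) * E⁴) ≡⟨ regroup₄ K d m E⁴ ⟩
            6 * K * E⁴ * (d * (m * m)) ≤⟨ *-monoʳ-≤ (6 * K * E⁴) (dm²≤2C₁²twoPaths ci ci′) ⟩
            6 * K * E⁴ * (2 * (C₁ * C₁) * twoPaths i i′) ≡⟨ regroup₅ K E⁴ (C₁ * C₁) (twoPaths i i′) ⟩
            12 * K * (C₁ * C₁) * (E⁴ * twoPaths i i′) ≤⟨ *-monoʳ-≤ (12 * K * (C₁ * C₁)) (E⁴twoPaths≤ i i′) ⟩
            12 * K * (C₁ * C₁) * (16 * (K * K * (K * K)) * Φ (i , i′)) ≡⟨ *-assoc (12 * K * (C₁ * C₁)) _ _ ⟨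
            c₀ * Φ (i , i′) ∎

        coreList : List I
        coreList = filter core? is

        module Distinct (R : Representatives _~?_ coreList) where
          open Representatives R using (reps; distinct; reps⊆; ∑-reps)

          reps-core : ∀ {u} → u ∈ reps → Core u
          reps-core u∈ = proj₂ (∈-filter⁻ core? {xs = is} (reps⊆ u∈))

          mult : I → ℕ
          mult u = ∑ coreList (λ x → 𝟙 (u ~? x))

          mult≤μ : ∀ u → mult u ≤ μ u
          mult≤μ u = ≤-trans (≤-reflexive (∑-filter core? is _)) (∑-mono is λ x → 𝟙*≤ (core? x) λ _ → ≤-refl)

          #core≡∑mult : #core ≡ ∑ reps mult
          #core≡∑mult = trans (sym (length-filter≡∑ core? is)) (trans (length≡∑ coreList)
            (trans (∑-reps (λ _ → 1)) (∑-cong reps λ u → ∑-cong coreList λ x → *-identityʳ (𝟙 (u ~? x)))))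

          -- Dividing by the fixed element `u₀` turns distinct elements into distinct quotients, so
          -- the number of classes is bounded as well.
          quotient-list : ∀ {us} → AllPairs (λ u v → ¬ g u ≈ g v) us → (∀ {u} → u ∈ us → Core u) → length us * E ≤ Λ * (m * m)
          quotient-list {[]}     ds core = z≤n
          quotient-list {u₀ ∷ us} ds core = subst (λ l → l * E ≤ Λ * (m * m)) (length-map (_, u₀) (u₀ ∷ us))
            (few-quotients (map (_, u₀) (u₀ ∷ us))
              (AllPairs.map⁺ (AllPairs.map (λ ne e → ne (⁻¹-injective (∙-cancelʳ (g u₀) _ _ e))) ds))
              (All.map⁺ (All.tabulate λ u∈ → core u∈ , core (here refl))))
            where open import Algebra.Properties.Group G using (⁻¹-injective)

          -- Choosing one representative for each class could create concentration. Classes of small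
          -- multiplicity are dropped, so that counting in S is controlled by counting in the
          -- family.
          heavy? : ∀ u → Dec (E ≤ 24 * K * Λ * m * mult u)
          heavy? u = E ≤? 24 * K * Λ * m * mult u

          S : List I
          S = filter heavy? reps

          S-core : ∀ {u} → u ∈ S → Core u
          S-core = reps-core ∘ proj₁ ∘ ∈-filter⁻ heavy? {xs = reps}

          S-distinct : AllPairs (λ u v → ¬ g u ≈ g v) S
          S-distinct = AllPairs.filter⁺ heavy? distinct

          q : ℕ
          q = length S

          Λ-nonZero : NonZero Λ
          Λ-nonZero = m*n≢0 c₀ _ {{m*n≢0 (12 * K * (C₁ * C₁)) _ {{m*n≢0 (12 * K) _ {{m*n≢0 12 K}} {{m*n≢0 C₁ C₁ {{c1}} {{c1}}}}}} {{m*n≢0 16 (K * K * (K * K)) {{_}} {{m*n≢0 (K * K) (K * K) {{kk}} {{kk}}}}}}}}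
                               {{m*n≢0 (8 * K) _ {{k8}} {{m*n≢0 (8 * K) (8 * K) {{k8}} {{k8}}}}}}
            where
            kk : NonZero (K * K)
            kk = m*n≢0 K K
            k8 : NonZero (8 * K)
            k8 = m*n≢0 8 K
            c1 : NonZero C₁
            c1 = m*n≢0 256 (K * K) {{_}} {{kk}}

          -- There are at most Λm²/E classes, and each light one has multiplicity below E/(24KΛm).
          light-bound : ∑ reps (λ u → 𝟙 (¬? (heavy? u)) * mult u) * (24 * K) ≤ m
          light-bound = *-cancelʳ-≤ _ m (Λ * m) {{m*n≢0 Λ m {{Λ-nonZero}}}} (begin
            X * (24 * K) * (Λ * m) ≡⟨ regroup X K Λ m ⟩
            X * (24 * K * Λ * m) ≡⟨ ∑-*ʳ reps _ (24 * K * Λ * m) ⟨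
            ∑ reps (λ u → 𝟙 (¬? (heavy? u)) * mult u * (24 * K * Λ * m)) ≤⟨ ∑-≤const reps E (λ {u} _ → light u) ⟩
            length reps * E ≤⟨ quotient-list distinct reps-core ⟩
            Λ * (m * m) ≡⟨ swap Λ m ⟩
            m * (Λ * m) ∎)
            where
            X = ∑ reps (λ u → 𝟙 (¬? (heavy? u)) * mult u)
            regroup : ∀ X K Λ m → X * (24 * K) * (Λ * m) ≡ X * (24 * K * Λ * m)
            regroup = solve-∀
            swap : ∀ l m → l * (m * m) ≡ m * (l * m)
            swap = solve-∀
            light : ∀ u → 𝟙 (¬? (heavy? u)) * mult u * (24 * K * Λ * m) ≤ E
            light u = ≤-trans (≤-reflexive (*-assoc (𝟙 (¬? (heavy? u))) _ _))
              (𝟙*≤ (¬? (heavy? u)) λ h → ≤-trans (≤-reflexive (*-comm (mult u) _)) (<⇒≤ (≰⇒> h)))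

          m≤24K∑heavy : m ≤ 24 * K * ∑ S mult
          m≤24K∑heavy = +-cancelʳ-≤ m _ _ (begin
            m + m ≤⟨ +-mono-≤ m≤12K#core m≤12K#core ⟩
            12 * K * #core + 12 * K * #core ≡⟨ regroup₁ K #core ⟩
            24 * K * #core ≡⟨ cong (24 * K *_) #core≡∑mult ⟩
            24 * K * ∑ reps mult ≤⟨ *-monoʳ-≤ (24 * K) (∑-mono reps λ u → 𝟙-cover (heavy? u) (mult u)) ⟩
            24 * K * ∑ reps (λ u → 𝟙 (heavy? u) * mult u + 𝟙 (¬? (heavy? u)) * mult u) ≡⟨ cong (24 * K *_) (trans (∑-+ reps _ _) (cong (_+ X) (sym (∑-filter heavy? reps mult)))) ⟩
            24 * K * (∑ S mult + X) ≡⟨ regroup₂ K (∑ S mult) X ⟩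
            24 * K * ∑ S mult + X * (24 * K) ≤⟨ +-monoʳ-≤ (24 * K * ∑ S mult) light-bound ⟩
            24 * K * ∑ S mult + m ∎)
            where
            X = ∑ reps (λ u → 𝟙 (¬? (heavy? u)) * mult u)
            regroup₁ : ∀ K c → 12 * K * c + 12 * K * c ≡ 24 * K * c
            regroup₁ = solve-∀
            regroup₂ : ∀ K s x → 24 * K * (s + x) ≡ 24 * K * s + x * (24 * K)
            regroup₂ = solve-∀

          m²≤cqE : m * m ≤ 24 * K * (8 * K) * q * E
          m²≤cqE = begin
            m * m ≤⟨ *-monoˡ-≤ m m≤24K∑heavy ⟩
            24 * K * ∑ S mult * m ≡⟨ *-assoc (24 * K) _ m ⟩
            24 * K * (∑ S mult * m) ≡⟨ cong (24 * K *_) (sym (∑-*ʳ S mult m)) ⟩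
            24 * K * ∑ S (λ u → mult u * m) ≤⟨ *-monoʳ-≤ (24 * K) (∑-≤const S (8 * K * E) λ {u} u∈ → ≤-trans (*-monoˡ-≤ m (mult≤μ u)) (proj₁ (proj₂ (proj₁ (S-core u∈))))) ⟩
            24 * K * (q * (8 * K * E)) ≡⟨ regroup K q E ⟩
            24 * K * (8 * K) * q * E ∎
            where
            regroup : ∀ K q E → 24 * K * (q * (8 * K * E)) ≡ 24 * K * (8 * K) * q * E
            regroup = solve-∀

          M : ℕ
          M = Λ * (24 * K * (8 * K))

          S-quotients : ∀ zs → AllPairs (λ z z′ → ¬ z ≐ z′) zs → All (λ (i , i′) → i ∈ S × i′ ∈ S) zs → length zs ≤ M * q
          S-quotients zs ds in-S = *-cancelʳ-≤ _ _ E (begin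
            length zs * E ≤⟨ few-quotients zs ds (All.map (λ (i∈ , i′∈) → S-core i∈ , S-core i′∈) in-S) ⟩
            Λ * (m * m) ≤⟨ *-monoʳ-≤ Λ m²≤cqE ⟩
            Λ * (24 * K * (8 * K) * q * E) ≡⟨ regroup Λ (24 * K * (8 * K)) q E ⟩
            M * q * E ∎)
            where
            regroup : ∀ a b c d → a * (b * c * d) ≡ a * b * c * d
            regroup = solve-∀

          -- Every element of S with property C accounts for at least E/(24KΛm) indices with this
          -- property, and by `m²≤cqE` the effective size m²/E is at most a constant times q.
          S-concentration : ∀ {p} (C : Carrier → Set p) → (∀ {x y} → C x → x ≈ y → C y) → (C? : ∀ i → Dec (C (g i))) → ∀ B →
            ∑ is (𝟙 ∘ C?) * B ≤ m → ∀ {xs} → AllPairs (λ u v → ¬ g u ≈ g v) xs → (∀ {u} → u ∈ xs → u ∈ S × C (g u)) →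
            length xs * B ≤ 24 * K * M * q
          S-concentration C resp C? B bound {xs} ds h = *-cancelʳ-≤ _ _ E (begin
            length xs * B * E ≡⟨ regroup₁ (length xs) B E ⟩
            B * (length xs * E) ≤⟨ *-monoʳ-≤ B (∑-≥const xs E λ u∈ → proj₂ (∈-filter⁻ heavy? {xs = reps} (proj₁ (h u∈)))) ⟩
            B * ∑ xs (λ u → 24 * K * Λ * m * mult u) ≡⟨ cong (B *_) (∑-*ˡ xs (24 * K * Λ * m) mult) ⟩
            B * (24 * K * Λ * m * ∑ xs mult) ≤⟨ *-monoʳ-≤ B (*-monoʳ-≤ (24 * K * Λ * m) total) ⟩
            B * (24 * K * Λ * m * ∑ is (𝟙 ∘ C?)) ≡⟨ regroup₂ B (24 * K * Λ) m (∑ is (𝟙 ∘ C?)) ⟩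
            24 * K * Λ * m * (∑ is (𝟙 ∘ C?) * B) ≤⟨ *-monoʳ-≤ (24 * K * Λ * m) bound ⟩
            24 * K * Λ * m * m ≡⟨ *-assoc (24 * K * Λ) m m ⟩
            24 * K * Λ * (m * m) ≤⟨ *-monoʳ-≤ (24 * K * Λ) m²≤cqE ⟩
            24 * K * Λ * (24 * K * (8 * K) * q * E) ≡⟨ regroup₃ (24 * K) Λ (24 * K * (8 * K)) q E ⟩
            24 * K * M * q * E ∎)
            where
            regroup₁ : ∀ x B E → x * B * E ≡ B * (x * E)
            regroup₁ = solve-∀
            regroup₂ : ∀ B c m x → B * (c * m * x) ≡ c * m * (x * B)
            regroup₂ = solve-∀
            regroup₃ : ∀ a l b q E → a * l * (b * q * E) ≡ a * (l * b) * q * E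
            regroup₃ = solve-∀
            once : ∀ x → ∑ xs (λ u → 𝟙 (u ~? x)) ≤ 𝟙 (C? x)
            once x = ∑-zero-or-∃ xs (λ u → 𝟙 (u ~? x)) (_≤ 𝟙 (C? x)) z≤n λ u u∈ lt →
              ≤-trans (∑𝟙≤1 (_~? x) (λ ne e e′ → ne (≈-trans e (≈-sym e′))) ds)
                (≤-reflexive (sym (𝟙-yes (C? x) (resp (proj₂ (h u∈)) (𝟙>0 (u ~? x) lt)))))
            total : ∑ xs mult ≤ ∑ is (𝟙 ∘ C?)
            total = begin
              ∑ xs mult ≡⟨ ∑-swap xs coreList _ ⟩
              ∑ coreList (λ x → ∑ xs (λ u → 𝟙 (u ~? x))) ≤⟨ ∑-mono coreList once ⟩
              ∑ coreList (𝟙 ∘ C?) ≡⟨ ∑-filter core? is _ ⟩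
              ∑ is (λ x → 𝟙 (core? x) * 𝟙 (C? x)) ≤⟨ ∑-mono is (λ x → 𝟙*≤ (core? x) λ _ → ≤-refl) ⟩
              ∑ is (𝟙 ∘ C?) ∎

          module _ (2≤K : 2 ≤ K) where
            Λ≤ : Λ ≤ K ^ 45
            Λ≤ = unwrap (Λ-bound 2≤K)

            M≤ : M ≤ K ^ 55
            M≤ = unwrap (M-bound 2≤K Λ (Λ-bound 2≤K))

            24KM≤ : 24 * K * M ≤ K ^ 61
            24KM≤ = unwrap (24KM-bound 2≤K M (M-bound 2≤K Λ (Λ-bound 2≤K)))

            0<q : 0 < q
            0<q = n≢0⇒n>0 λ q≡0 → <⇒≱ (*-mono-< (>-nonZero⁻¹ m) (>-nonZero⁻¹ m)) (≤-trans m²≤cqE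
              (≤-reflexive (trans (cong (λ q → 24 * K * (8 * K) * q * E) q≡0) (cong (_* E) (*-zeroʳ (24 * K * (8 * K)))))))

            few : FewQuotients (g ∘ lookup S) (K ^ 55 * q)
            few zs ds = begin
              length zs ≡⟨ length-map _ zs ⟨
              length (map (λ (a , b) → lookup S a , lookup S b) zs) ≤⟨ S-quotients _ (AllPairs.map⁺ ds) (All.map⁺ (All.tabulate λ {(a , b)} _ → ∈-lookup a , ∈-lookup b)) ⟩
              M * q ≤⟨ *-monoˡ-≤ q M≤ ⟩
              K ^ 55 * q ∎

            conc : ∀ {p} (C : Carrier → Set p) → (∀ {x y} → C x → x ≈ y → C y) → (C? : ∀ i → Dec (C (g i))) → ∀ B →
              ∑ is (𝟙 ∘ C?) * B ≤ m → ∀ {xs} → Unique xs → All (C ∘ g ∘ lookup S) xs → length xs * B ≤ K ^ 61 * q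
            conc C resp C? B bound {xs} u cs = begin
              length xs * B ≡⟨ cong (_* B) (sym (length-map (lookup S) xs)) ⟩
              length (map (lookup S) xs) * B ≤⟨ S-concentration C resp C? B bound
                (AllPairs.map⁺ (AllPairs.map (λ ne e → ne (lookup-injective ≈-sym S-distinct _ _ e)) u))
                (λ m∈ → All.lookup (All.map⁺ {P = λ u → u ∈ S × C (g u)} (All.map (λ {a} ca → ∈-lookup a , ca) cs)) m∈) ⟩
              24 * K * M * q ≤⟨ *-monoˡ-≤ q 24KM≤ ⟩
              K ^ 61 * q ∎

            result : ∀ {p} → Σ ℕ λ q → Σ (Fin q → Carrier) λ S →
              0 < q × (∀ a b → S a ≈ S b → a ≡ b) × FewQuotients S (K ^ 55 * q) × q * E ≤ K ^ 45 * (m * m) ×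
              (∀ (C : Carrier → Set p) → (∀ {x y} → C x → x ≈ y → C y) → (C? : ∀ i → Dec (C (g i))) → ∀ B →
                ∑ is (𝟙 ∘ C?) * B ≤ m → ∀ {xs} → Unique xs → All (C ∘ S) xs → length xs * B ≤ K ^ 61 * q)
            result = q , g ∘ lookup S , 0<q , lookup-injective ≈-sym S-distinct
              , few , ≤-trans (quotient-list S-distinct S-core) (*-monoˡ-≤ (m * m) Λ≤) , conc

  -- Multiplicities are allowed, so m²/E takes the place of the cardinality, and the hypothesis is a
  -- lower bound for the multiplicative energy. The last clause carries any bound on concentration
  -- from the family to S, at the cost of `K ^ 61`.
  balog-szemerédi-gowers : ∀ {p} {I : Set} (is : List I) (g : I → Carrier)
    (_~?_ : ∀ i j → Dec (g i ≈ g j)) (Q? : ∀ i j k l → Dec (g i ⁻¹ ∙ g j ≈ g k ⁻¹ ∙ g l)) →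
    let m = length is
        E = ∑ is (λ i → ∑ is (λ j → 𝟙 (i ~? j)))
    in ∀ K → 2 ≤ K → 0 < m →
    m * m * E ≤ K * ∑ is (λ i → ∑ is (λ j → ∑ is (λ k → ∑ is (λ l → 𝟙 (Q? i j k l))))) →
    Σ ℕ λ q → Σ (Fin q → Carrier) λ S →
      0 < q × (∀ a b → S a ≈ S b → a ≡ b) × FewQuotients S (K ^ 55 * q) × q * E ≤ K ^ 45 * (m * m) ×
      (∀ (C : Carrier → Set p) → (∀ {x y} → C x → x ≈ y → C y) → (C? : ∀ i → Dec (C (g i))) → ∀ B →
        ∑ is (𝟙 ∘ C?) * B ≤ m → ∀ {xs} → Unique xs → All (C ∘ S) xs → length xs * B ≤ K ^ 61 * q)
  balog-szemerédi-gowers is g _~?_ Q? K 2≤K 0<m energy =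
    D.Centred.Distinct.result (proj₁ D.centre) (proj₂ (proj₂ D.centre))
      (representatives ≈-refl ≈-sym ≈-trans _~?_ _) 2≤K
    where
    module P = Popular is g _~?_ Q?
    instance
      K-nonZero : NonZero K
      K-nonZero = >-nonZero (≤-trans (s≤s z≤n) 2≤K)
      m-nonZero : NonZero P.m
      m-nonZero = >-nonZero 0<m
      E-nonZero : NonZero P.E
      E-nonZero = >-nonZero (≤-trans 0<m (≤-trans (≤-reflexive (length≡∑ is)) (∑-mono-∈ is λ {i} i∈ → ∑𝟙≥1 (i ~?_) i∈ ≈-refl)))
    module D = P.Dense K energy

-- Popular quotients

finite-Fin : ∀ n → Finite (Fin n)
finite-Fin n = allFin n , ∈-allFin

length-allFin : ∀ n → length (allFin n) ≡ n
length-allFin n = length-tabulate {n = n} id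

module Popularity {c ℓ} (G : Group c ℓ) where
  open Group G renaming (refl to ≈-refl; sym to ≈-sym; trans to ≈-trans)
  open import Algebra.Properties.Group G using (∙-cancelˡ; ∙-cancelʳ; ⁻¹-injective; ⁻¹-anti-homo-∙; ⁻¹-involutive)
  open BSG G using (FewQuotients)
  module ≈-Reasoning where
    open import Relation.Binary.Reasoning.Setoid setoid public

  -- This exchanges left and right quotients inside an energy: P consists of quotients SS⁻¹, whereas
  -- the doubling hypothesis concerns S⁻¹S.
  swap-quotient : ∀ x y z w → x ∙ y ⁻¹ ≈ z ∙ w ⁻¹ → z ⁻¹ ∙ x ≈ w ⁻¹ ∙ y
  swap-quotient x y z w e = begin
    z ⁻¹ ∙ x                   ≈⟨ ∙-congˡ (≈-trans (assoc x (y ⁻¹) y) (≈-trans (∙-congˡ (inverseˡ y)) (identityʳ x))) ⟨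
    z ⁻¹ ∙ ((x ∙ y ⁻¹) ∙ y)    ≈⟨ ∙-congˡ (∙-congʳ e) ⟩
    z ⁻¹ ∙ ((z ∙ w ⁻¹) ∙ y)    ≈⟨ ∙-congˡ (assoc _ _ _) ⟩
    z ⁻¹ ∙ (z ∙ (w ⁻¹ ∙ y))    ≈⟨ assoc _ _ _ ⟨
    (z ⁻¹ ∙ z) ∙ (w ⁻¹ ∙ y)    ≈⟨ ∙-congʳ (inverseˡ z) ⟩
    ε ∙ (w ⁻¹ ∙ y)             ≈⟨ identityˡ _ ⟩
    w ⁻¹ ∙ y                   ∎
    where open ≈-Reasoning

  unswap-quotient : ∀ x y z w → z ⁻¹ ∙ x ≈ w ⁻¹ ∙ y → x ∙ y ⁻¹ ≈ z ∙ w ⁻¹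
  unswap-quotient x y z w e = begin
    x ∙ y ⁻¹                   ≈⟨ ∙-congʳ (≈-trans (≈-sym (assoc z (z ⁻¹) x)) (≈-trans (∙-congʳ (inverseʳ z)) (identityˡ x))) ⟨
    (z ∙ (z ⁻¹ ∙ x)) ∙ y ⁻¹    ≈⟨ ∙-congʳ (∙-congˡ e) ⟩
    (z ∙ (w ⁻¹ ∙ y)) ∙ y ⁻¹    ≈⟨ ∙-congʳ (assoc _ _ _) ⟨
    ((z ∙ w ⁻¹) ∙ y) ∙ y ⁻¹    ≈⟨ assoc _ _ _ ⟩
    (z ∙ w ⁻¹) ∙ (y ∙ y ⁻¹)    ≈⟨ ∙-congˡ (inverseʳ y) ⟩
    (z ∙ w ⁻¹) ∙ ε             ≈⟨ identityʳ _ ⟩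
    z ∙ w ⁻¹                   ∎
    where open ≈-Reasoning

  -- M bounds the doubling. The popularity threshold ρ is the ceiling of q/2M, described by two
  -- inequalities; being positive, its powers can be cancelled.
  record SmallSet : Set (c ⊔ ℓ) where
    field
      q         : ℕ
      S         : Fin q → Carrier
      injective : ∀ a b → S a ≈ S b → a ≡ b
      base      : Fin q
      M         : ℕ
      M>0       : 0 < M
      few       : FewQuotients S (M * q)
      ρ         : ℕ
      {{ρ>0}}   : NonZero ρ
      q≤2Mρ     : q ≤ 2 * M * ρ
      <ρ⇒       : ∀ {x} → x < ρ → 2 * M * x ≤ q

  smallSet : ∀ {q} (S : Fin q → Carrier) → (∀ a b → S a ≈ S b → a ≡ b) → Fin q →
             ∀ {M} → 0 < M → FewQuotients S (M * q) → SmallSet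
  smallSet {q} S inj a {M} M>0 few = record
    { S = S ; injective = inj ; base = a ; M>0 = M>0 ; few = few
    ; ρ = suc (pred q / (2 * M)) ; q≤2Mρ = q≤ ; <ρ⇒ = <⇒ }
    where
    open ≤-Reasoning
    instance
      2M-nonZero : NonZero (2 * M)
      2M-nonZero = m*n≢0 2 M {{_}} {{>-nonZero M>0}}
    q≤ : q ≤ 2 * M * suc (pred q / (2 * M))
    q≤ = begin
      q                                             ≤⟨ n≤1+pred q ⟩
      suc (pred q)                                  ≡⟨ cong suc (m≡m%n+[m/n]*n (pred q) (2 * M)) ⟩
      suc (pred q % (2 * M) + pred q / (2 * M) * (2 * M)) ≤⟨ +-monoˡ-≤ (pred q / (2 * M) * (2 * M)) (m%n<n (pred q) (2 * M)) ⟩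
      suc (pred q / (2 * M)) * (2 * M)              ≡⟨ *-comm (suc (pred q / (2 * M))) (2 * M) ⟩
      2 * M * suc (pred q / (2 * M))                ∎
      where
      n≤1+pred : ∀ n → n ≤ suc (pred n)
      n≤1+pred zero    = z≤n
      n≤1+pred (suc n) = ≤-refl
    <⇒ : ∀ {x} → x < suc (pred q / (2 * M)) → 2 * M * x ≤ q
    <⇒ {x} x<ρ = begin
      2 * M * x                       ≤⟨ *-monoʳ-≤ (2 * M) (≤-pred x<ρ) ⟩
      2 * M * (pred q / (2 * M))      ≡⟨ *-comm (2 * M) _ ⟩
      (pred q / (2 * M)) * (2 * M)    ≤⟨ m/n*n≤m (pred q) (2 * M) ⟩
      pred q                          ≤⟨ pred[n]≤n ⟩
      q                               ∎

  module Powers (𝕊 : SmallSet) where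
    open SmallSet 𝕊

    instance
      M-nonZero : NonZero M
      M-nonZero = >-nonZero M>0

    q>0 : 0 < q
    q>0 = nonempty base
      where
      nonempty : ∀ {n} → Fin n → 0 < n
      nonempty Fin.zero    = s≤s z≤n
      nonempty (Fin.suc _) = s≤s z≤n

    SameQuotient : Fin q × Fin q → Fin q × Fin q → Set ℓ
    SameQuotient (a , b) (c , d) = S a ∙ S b ⁻¹ ≈ S c ∙ S d ⁻¹

    record Popular (a b : Fin q) : Set ℓ where
      constructor popular
      field
        witnesses : List (Fin q × Fin q)
        unique    : Unique witnesses
        same      : All (SameQuotient (a , b)) witnesses
        many      : ρ ≤ length witnesses

    P : Carrier → Set ℓ
    P x = Σ (Fin q × Fin q) λ (a , b) → Popular a b × x ≈ S a ∙ S b ⁻¹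

    quotient-inverse : ∀ x y → (x ∙ y ⁻¹) ⁻¹ ≈ y ∙ x ⁻¹
    quotient-inverse x y = ≈-trans (⁻¹-anti-homo-∙ x (y ⁻¹)) (∙-congʳ (⁻¹-involutive y))

    P-inverse : ∀ {x} → P x → P (x ⁻¹)
    P-inverse ((a , b) , popular ws u s m , e) = (b , a) , popular (map flip ws)
        (Unique.map⁺ (λ {x} {y} eq → cong flip eq) u)
        (All.map⁺ (All.map (λ {(c , d)} h → ≈-trans (≈-sym (quotient-inverse _ _)) (≈-trans (⁻¹-cong h) (quotient-inverse _ _))) s))
        (subst (ρ ≤_) (sym (length-map flip ws)) m)
      , ≈-trans (⁻¹-cong e) (quotient-inverse _ _)
      where
      flip : Fin q × Fin q → Fin q × Fin q
      flip (c , d) = d , c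

    P-identity : P ε
    P-identity = (base , base) , popular (map (λ a → a , a) (allFin q))
        (Unique.map⁺ ,-injectiveˡ (Unique.allFin⁺ q))
        (All.map⁺ (All.tabulate λ {a} _ → ≈-trans (inverseʳ (S base)) (≈-sym (inverseʳ (S a)))))
        (subst (ρ ≤_) (sym (trans (length-map _ (allFin q)) (length-allFin q))) ρ≤q)
      , ≈-sym (inverseʳ (S base))
      where
      ρ≤q : ρ ≤ q
      ρ≤q = ≮⇒≥ λ q<ρ → <⇒≱ (m<n*m q>0) (<ρ⇒ q<ρ)
        where
        m<n*m : 0 < q → q < 2 * M * q
        m<n*m q>0 = subst (_< 2 * M * q) (*-identityˡ q) (*-monoˡ-< q {{>-nonZero q>0}} (*-mono-≤ {2} ≤-refl M>0))

    data Pow : ℕ → Carrier → Set (c ⊔ ℓ) where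
      empty  : ∀ {x} → x ≈ ε → Pow zero x
      append : ∀ {k x} p y → P p → Pow k y → x ≈ p ∙ y → Pow (suc k) x

    Pow-resp : ∀ k {x y} → x ≈ y → Pow k x → Pow k y
    Pow-resp zero    x≈y (empty e)             = empty (≈-trans (≈-sym x≈y) e)
    Pow-resp (suc k) x≈y (append p z Pp Pz e)  = append p z Pp Pz (≈-trans (≈-sym x≈y) e)

    Pow-one : ∀ {x} → P x → Pow 1 x
    Pow-one {x} Px = append x ε Px (empty ≈-refl) (≈-sym (identityʳ x))

    Pow-∙ : ∀ j k {x y} → Pow j x → Pow k y → Pow (j + k) (x ∙ y)
    Pow-∙ zero    k {x} {y} (empty e)         Py = Pow-resp k (≈-sym (≈-trans (∙-congʳ e) (identityˡ y))) Py
    Pow-∙ (suc j) k (append p z Pp Pz e)  Py = append p _ Pp (Pow-∙ j k Pz Py) (≈-trans (∙-congʳ e) (assoc _ _ _))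

    Pow-inverse : ∀ k {x} → Pow k x → Pow k (x ⁻¹)
    Pow-inverse zero    (empty e) = empty (≈-trans (⁻¹-cong e) ε⁻¹≈ε)
      where open import Algebra.Properties.Group G using (ε⁻¹≈ε)
    Pow-inverse (suc k) {x} (append p z Pp Pz e) = subst (λ j → Pow j (x ⁻¹)) (+-comm k 1)
      (Pow-resp (k + 1) (≈-sym (≈-trans (⁻¹-cong e) (⁻¹-anti-homo-∙ p z)))
        (Pow-∙ k 1 (Pow-inverse k Pz) (Pow-one (P-inverse Pp))))

    Pow-suc : ∀ k {x} → Pow k x → Pow (suc k) x
    Pow-suc k {x} Px = append ε x P-identity Px (≈-sym (identityˡ x))

    Pow-+ : ∀ j k {x} → Pow k x → Pow (j + k) x
    Pow-+ zero    k Px = Px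
    Pow-+ (suc j) k Px = Pow-suc (j + k) (Pow-+ j k Px)

    Idx : Set
    Idx = Fin q × Fin q

    quot : Idx → Carrier
    quot (a , b) = S a ⁻¹ ∙ S b

    -- Letters are taken from a list D that represents S⁻¹S, by way of `name`, so that there are
    -- only `M * q` of them.
    module Words (D : List Idx) (D≤ : length D ≤ M * q) (name : Idx → Idx)
                 (name∈ : ∀ z → name z ∈ D) (name≈ : ∀ z → quot z ≈ quot (name z)) where

      Word : ℕ → Set
      Word k = Fin q × Vec Idx k

      vecs : ∀ k → List (Vec Idx k)
      vecs zero    = [] ∷ []
      vecs (suc k) = cartesianProductWith _∷_ D (vecs k)

      words : ∀ k → List (Word k)
      words k = cartesianProduct (allFin q) (vecs k)

      length-words : ∀ k → length (words k) ≤ q * (M * q) ^ k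
      length-words k = ≤-trans (≤-reflexive (trans (length-cartesianProduct (allFin q) (vecs k)) (cong (_* length (vecs k)) (length-allFin q)))) (*-monoʳ-≤ q (go k))
        where
        go : ∀ k → length (vecs k) ≤ (M * q) ^ k
        go zero    = ≤-refl
        go (suc k) = ≤-trans (≤-reflexive (length-cartesianProductWith _∷_ D (vecs k))) (*-mono-≤ D≤ (go k))

      ∏ : ∀ {k} → Vec Idx k → Carrier
      ∏ []       = ε
      ∏ (z ∷ zs) = quot z ∙ ∏ zs

      eval : ∀ {k} → Word k → Carrier
      eval (a , zs) = S a ∙ ∏ zs

      record Spellings (k : ℕ) (x : Carrier) : Set ℓ where
        constructor spellings
        field
          list     : List (Word k)
          unique   : Unique list
          correct  : All (λ w → x ≈ eval w) list
          in-words : ∀ {w} → w ∈ list → w ∈ words k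
          many     : ρ ^ k ≤ length list

      spell-base : ∀ a → Spellings 0 (S a)
      spell-base a = spellings ((a , []) ∷ []) ([] ∷ []) (≈-sym (identityʳ (S a)) ∷ [])
        (λ { (here refl) → ∈-cartesianProduct⁺ (∈-allFin a) (here refl) }) ≤-refl

      -- x = (a b⁻¹)(a₁ w) = a (b⁻¹ a₁) w
      spell-∙ : ∀ {k p y} → P p → Spellings k y → Spellings (suc k) (p ∙ y)
      spell-∙ {k} {p} {y} ((a₀ , b₀) , popular ws uws sws mws , e) (spellings ys uys cys iys mys) =
        spellings (map extend pairs) unique correct in-words many
        where
        extend : (Idx) × Word k → Word (suc k)
        extend ((a , b) , (a₁ , zs)) = a , name (b , a₁) ∷ zs
        pairs : List (Idx × Word k)
        pairs = cartesianProduct ws ys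
        ∈ˡ : ∀ {u v} → (u , v) ∈ pairs → u ∈ ws × v ∈ ys
        ∈ˡ = ∈-cartesianProduct⁻ ws ys
        p≈ : ∀ {a b} → (a , b) ∈ ws → p ≈ S a ∙ S b ⁻¹
        p≈ m = ≈-trans e (All.lookup sws m)
        -- The word and the product p recover all choices: a is the first letter, p = a b⁻¹ gives b,
        -- and the name of b⁻¹ a₁ gives a₁.
        inj : ∀ {u v} → u ∈ pairs → v ∈ pairs → extend u ≡ extend v → u ≡ v
        inj {(a , b) , (a₁ , zs)} {(a′ , b′) , (a₁′ , zs′)} u∈ v∈ eq with ,-injectiveˡ eq
        ... | refl with ∷-injective (,-injectiveʳ eq)
          where open import Data.Vec.Properties using (∷-injective)
        ... | eq′ , refl with injective b b′ (⁻¹-injective (∙-cancelˡ (S a) _ _ (≈-trans (≈-sym (p≈ (proj₁ (∈ˡ u∈)))) (p≈ (proj₁ (∈ˡ v∈))))))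
        ... | refl with injective a₁ a₁′ (∙-cancelˡ (S b ⁻¹) _ _ (≈-trans (name≈ (b , a₁)) (≈-trans (reflexive (cong quot eq′)) (≈-sym (name≈ (b , a₁′))))))
        ... | refl = refl
        unique-map : ∀ {us} → Unique us → (∀ {u} → u ∈ us → u ∈ pairs) → Unique (map extend us)
        unique-map []         sub = []
        unique-map (n ∷ uus) sub = All.map⁺ (All.tabulate λ m eq → All.lookup n m (inj (sub (here refl)) (sub (there m)) eq)) ∷ unique-map uus (sub ∘ there)
        unique = unique-map (Unique.cartesianProduct⁺ uws uys) id
        correct : All (λ w → p ∙ y ≈ eval w) (map extend pairs)
        correct = All.map⁺ (All.tabulate λ {((a , b) , (a₁ , zs))} m → begin
          p ∙ y                                    ≈⟨ ∙-cong (p≈ (proj₁ (∈ˡ m))) (All.lookup cys (proj₂ (∈ˡ m))) ⟩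
          (S a ∙ S b ⁻¹) ∙ (S a₁ ∙ ∏ zs)           ≈⟨ assoc _ _ _ ⟩
          S a ∙ (S b ⁻¹ ∙ (S a₁ ∙ ∏ zs))           ≈⟨ ∙-congˡ (assoc _ _ _) ⟨
          S a ∙ (quot (b , a₁) ∙ ∏ zs)             ≈⟨ ∙-congˡ (∙-congʳ (name≈ (b , a₁))) ⟩
          S a ∙ (quot (name (b , a₁)) ∙ ∏ zs)      ∎)
          where open ≈-Reasoning
        in-words : ∀ {w} → w ∈ map extend pairs → w ∈ words (suc k)
        in-words m with ∈-map⁻ extend m
        ... | ((a , b) , (a₁ , zs)) , m′ , refl = ∈-cartesianProduct⁺ (∈-allFin a)
          (∈-cartesianProductWith⁺ _∷_ (name∈ (b , a₁)) (proj₂ (∈-cartesianProduct⁻ (allFin q) (vecs k) (iys (proj₂ (∈ˡ m′))))))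
        many : ρ ^ suc k ≤ length (map extend pairs)
        many = ≤-trans (*-mono-≤ mws mys) (≤-reflexive (sym (trans (length-map extend pairs) (length-cartesianProduct ws ys))))

      respell : ∀ {k x y} → x ≈ y → Spellings k x → Spellings k y
      respell x≈y (spellings l u c i m) = spellings l u (All.map (≈-trans (≈-sym x≈y)) c) i m

      spell : ∀ k {x} → Pow k x → Spellings k (x ∙ S base)
      spell zero    {x} (empty e) = respell (≈-sym (≈-trans (∙-congʳ e) (identityˡ _))) (spell-base base)
      spell (suc k) {x} (append p y Pp Py e) = respell (≈-sym (≈-trans (∙-congʳ e) (assoc _ _ _))) (spell-∙ Pp (spell k Py))

      -- Every element of Pᵏ, multiplied by `S base`, has at least ρᵏ spellings among the at most
      -- q(Mq)ᵏ words, and a word has only one value.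
      few-powers : ∀ k xs → AllPairs (λ x y → ¬ x ≈ y) xs → All (Pow k) xs → length xs ≤ q * (2 * (M * M)) ^ k
      few-powers k xs ds ps = *-cancelʳ-≤ _ _ (ρ ^ k) {{m^n≢0 ρ k}} (begin
        length xs * ρ ^ k ≤⟨ multiPigeonhole {D = λ x y → ¬ x ≈ y} (λ x (w : Word k) → x ∙ S base ≈ eval w)
          (λ ne e e′ → ne (∙-cancelʳ (S base) _ _ (≈-trans e (≈-sym e′)))) (ρ ^ k) (words k) ds
          (λ x∈ → let sp = spell k (All.lookup ps x∈) in Spellings.list sp , Spellings.unique sp , Spellings.correct sp , Spellings.in-words sp , Spellings.many sp) ⟩
        length (words k) ≤⟨ length-words k ⟩
        q * (M * q) ^ k ≤⟨ *-monoʳ-≤ q (^-monoˡ-≤ k (≤-trans (*-monoʳ-≤ M q≤2Mρ) (≤-reflexive (regroup M ρ)))) ⟩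
        q * (2 * (M * M) * ρ) ^ k ≡⟨ cong (q *_) (^-distribʳ-* k (2 * (M * M)) ρ) ⟩
        q * ((2 * (M * M)) ^ k * ρ ^ k) ≡⟨ *-assoc q _ _ ⟨
        q * (2 * (M * M)) ^ k * ρ ^ k ∎)
        where
        open ≤-Reasoning
        regroup : ∀ M r → M * (2 * M * r) ≡ 2 * (M * M) * r
        regroup = solve-∀

    few-powers : ∀ k xs → AllPairs (λ x y → ¬ x ≈ y) xs → All (Pow k) xs → length xs ≤ q * (2 * (M * M)) ^ k
    few-powers k xs ds ps = run do
      D , dD , _ , max ← maximal (λ (_ : Idx) → ⊤) (λ z z′ → ¬ quot z ≈ quot z′) (M * q) (λ zs ds _ → few zs ds)
      names ← choice (finite-Fin q ×-finite finite-Fin q) (λ z → ¬All⇒DNAny {P = λ z′ → quot z ≈ quot z′} D (max z tt))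
      pure (Words.few-powers D (few D dD) (proj₁ ∘ names) (λ z → proj₁ (proj₂ (names z))) (λ z → proj₂ (proj₂ (names z))) k xs ds ps)

    -- Few quotients force Σ r ≥ q³/M by Cauchy-Schwarz. Unpopular pairs contribute at most half of
    -- this, so at least q²/2M pairs are popular, and some column b contains the average number.
    many-popular : DN (Σ (Fin q) λ b → Σ (List (Fin q)) λ as → Unique as × All (λ a → Popular a b) as × q ≤ 2 * M * length as)
    many-popular = do
      d ← decide (fin² ×-finite fin²) (λ (z , z′) → SameQuotient z z′)
      pure (Decided.result λ z z′ → d (z , z′))
      where
      fin² = finite-Fin q ×-finite finite-Fin q
      module Decided (d : ∀ z z′ → Dec (SameQuotient z z′)) where
        open ≤-Reasoning
        qs = allFin q
        pairs = cartesianProduct qs qs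
        r : Idx → ℕ
        r z = ∑ pairs (λ z′ → 𝟙 (d z z′))
        pop? : ∀ z → Dec (ρ ≤ r z)
        pop? z = ρ ≤? r z
        mkPopular : ∀ a b → ρ ≤ r (a , b) → Popular a b
        mkPopular a b h = popular (filter (d (a , b)) pairs)
          (Unique.filter⁺ (d (a , b)) (Unique.cartesianProduct⁺ (Unique.allFin⁺ q) (Unique.allFin⁺ q)))
          (All.all-filter (d (a , b)) pairs)
          (≤-trans h (≤-reflexive (sym (length-filter≡∑ (d (a , b)) pairs))))
        unswapped? : ∀ z z′ → Dec (quot z ≈ quot z′)
        unswapped? (c , a) (e , b) = Dec.map′ (swap-quotient (S a) (S b) (S c) (S e)) (unswap-quotient (S a) (S b) (S c) (S e)) (d (a , b) (c , e))
        total : ℕ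
        total = ∑ pairs r
        length-pairs : length pairs ≡ q * q
        length-pairs = trans (length-cartesianProduct qs qs) (cong₂ _*_ (length-allFin q) (length-allFin q))
        rearrange : ∑ pairs (λ z → ∑ pairs (λ z′ → 𝟙 (unswapped? z z′))) ≤ total
        rearrange = begin
          ∑ pairs (λ z → ∑ pairs (λ z′ → 𝟙 (unswapped? z z′))) ≡⟨ trans (∑-cartesianProduct qs qs _) (∑-cong qs λ c → ∑-cong qs λ a → ∑-cartesianProduct qs qs _) ⟩
          ∑ qs (λ c → ∑ qs (λ a → ∑ qs (λ e → ∑ qs (λ b → 𝟙 (unswapped? (c , a) (e , b))))))
            ≤⟨ ∑-mono qs (λ c → ∑-mono qs λ a → ∑-mono qs λ e → ∑-mono qs λ b → 𝟙-mono (unswapped? (c , a) (e , b)) (d (a , b) (c , e)) (unswap-quotient (S a) (S b) (S c) (S e))) ⟩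
          ∑ qs (λ c → ∑ qs (λ a → ∑ qs (λ e → ∑ qs (λ b → 𝟙 (d (a , b) (c , e)))))) ≡⟨ ∑-cong qs (λ c → ∑-cong qs λ a → ∑-swap qs qs _) ⟩
          ∑ qs (λ c → ∑ qs (λ a → ∑ qs (λ b → ∑ qs (λ e → 𝟙 (d (a , b) (c , e)))))) ≡⟨ ∑-swap qs qs _ ⟩
          ∑ qs (λ a → ∑ qs (λ c → ∑ qs (λ b → ∑ qs (λ e → 𝟙 (d (a , b) (c , e)))))) ≡⟨ ∑-cong qs (λ a → ∑-swap qs qs _) ⟩
          ∑ qs (λ a → ∑ qs (λ b → ∑ qs (λ c → ∑ qs (λ e → 𝟙 (d (a , b) (c , e)))))) ≡⟨ ∑-cong qs (λ a → ∑-cong qs λ b → sym (∑-cartesianProduct qs qs _)) ⟩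
          ∑ qs (λ a → ∑ qs (λ b → r (a , b))) ≡⟨ ∑-cartesianProduct qs qs r ⟨
          total ∎
        q³≤M*total : q * q * q ≤ M * total
        q³≤M*total = *-cancelʳ-≤ _ _ q {{>-nonZero q>0}} (begin
          q * q * q * q ≡⟨ regroup₁ q ⟩
          (q * q) * (q * q) ≡⟨ cong₂ _*_ length-pairs length-pairs ⟨
          length pairs * length pairs ≤⟨ energy-bound ≈-refl ≈-sym ≈-trans unswapped? (M * q) pairs (λ zs ds _ → few zs ds) ⟩
          M * q * ∑ pairs (λ z → ∑ pairs (λ z′ → 𝟙 (unswapped? z z′))) ≤⟨ *-monoʳ-≤ (M * q) rearrange ⟩
          M * q * total ≡⟨ regroup₂ M q total ⟩
          M * total * q ∎)
          where
          regroup₁ : ∀ q → q * q * q * q ≡ (q * q) * (q * q)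
          regroup₁ = solve-∀
          regroup₂ : ∀ M q t → M * q * t ≡ M * t * q
          regroup₂ = solve-∀
        r≤q : ∀ z → r z ≤ q
        r≤q z = begin
          r z ≡⟨ ∑-cartesianProduct qs qs _ ⟩
          ∑ qs (λ c → ∑ qs (λ e → 𝟙 (d z (c , e)))) ≤⟨ ∑-≤const qs 1 (λ {c} _ → ∑𝟙≤1 (λ e → d z (c , e))
            (λ ne h h′ → ne (injective _ _ (⁻¹-injective (∙-cancelˡ (S c) _ _ (≈-trans (≈-sym h) h′))))) (Unique.allFin⁺ q)) ⟩
          length qs * 1 ≡⟨ trans (*-identityʳ _) (length-allFin q) ⟩
          q ∎
        #pop : ℕ
        #pop = ∑ qs (λ b → ∑ qs (λ a → 𝟙 (pop? (a , b))))
        bound : ∀ z → 2 * M * r z ≤ 𝟙 (pop? z) * (2 * M * q) + q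
        bound z = ≤-𝟙-else (pop? z) (*-monoʳ-≤ (2 * M) (r≤q z)) (λ h → <ρ⇒ (≰⇒> h))
          where
          ≤-𝟙-else : ∀ {p} {P : Set p} (d : Dec P) {x y z : ℕ} → x ≤ y → (¬ P → x ≤ z) → x ≤ 𝟙 d * y + z
          ≤-𝟙-else (yes _) h _ = ≤-trans h (≤-trans (m≤m+n _ 0) (m≤m+n _ _))
          ≤-𝟙-else (no ¬p) _ h = h ¬p
        q²≤2M#pop : q * q ≤ 2 * M * #pop
        q²≤2M#pop = *-cancelʳ-≤ _ _ q {{>-nonZero q>0}} (+-cancelʳ-≤ (q * q * q) _ _ (begin
          q * q * q + q * q * q ≡⟨ regroup₁ (q * q * q) ⟩
          2 * (q * q * q) ≤⟨ *-monoʳ-≤ 2 q³≤M*total ⟩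
          2 * (M * total) ≡⟨ *-assoc 2 M total ⟨
          2 * M * total ≡⟨ ∑-*ˡ pairs (2 * M) r ⟨
          ∑ pairs (λ z → 2 * M * r z) ≤⟨ ∑-mono pairs bound ⟩
          ∑ pairs (λ z → 𝟙 (pop? z) * (2 * M * q) + q) ≡⟨ trans (∑-+ pairs _ _) (cong₂ _+_ (∑-*ʳ pairs _ (2 * M * q)) (trans (∑-const pairs q) (cong (_* q) length-pairs))) ⟩
          ∑ pairs (λ z → 𝟙 (pop? z)) * (2 * M * q) + q * q * q ≡⟨ cong (λ x → x * (2 * M * q) + q * q * q) (trans (∑-cartesianProduct qs qs _) (∑-swap qs qs _)) ⟩
          #pop * (2 * M * q) + q * q * q ≡⟨ cong (_+ q * q * q) (regroup₂ #pop (2 * M) q) ⟩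
          2 * M * #pop * q + q * q * q ∎))
          where
          regroup₁ : ∀ x → x + x ≡ 2 * x
          regroup₁ = solve-∀
          regroup₂ : ∀ x y z → x * (y * z) ≡ y * x * z
          regroup₂ = solve-∀
        Result : Set ℓ
        Result = Σ (Fin q) λ b → Σ (List (Fin q)) λ as → Unique as × All (λ a → Popular a b) as × q ≤ 2 * M * length as
        fromColumn : (Σ (Fin q) λ b → b ∈ qs × q ≤ 2 * M * ∑ qs (λ a → 𝟙 (pop? (a , b)))) → Result
        fromColumn (b , _ , h) = b , filter (λ a → pop? (a , b)) qs , Unique.filter⁺ _ (Unique.allFin⁺ q)
          , All.map (mkPopular _ b) (All.all-filter (λ a → pop? (a , b)) qs)
          , ≤-trans h (≤-reflexive (cong (2 * M *_) (sym (length-filter≡∑ (λ a → pop? (a , b)) qs))))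
        result : Result
        result = fromColumn (∑-≤⇒∃ qs (λ _ → q) (λ b → 2 * M * ∑ qs (λ a → 𝟙 (pop? (a , b)))) (subst (0 <_) (sym (length-allFin q)) q>0)
          (≤-trans (≤-reflexive (trans (∑-const qs q) (cong (_* q) (length-allFin q)))) (≤-trans q²≤2M#pop (≤-reflexive (sym (∑-*ˡ qs (2 * M) (λ b → ∑ qs (λ a → 𝟙 (pop? (a , b))))))))))

-- Affine maps

-- Coefficients are integers, mapped to multiples of 1: the solver must compare coefficients, and
-- equality in R cannot be tested.
module RingSolver {c ℓ} (R : CommutativeRing c ℓ) where
  open CommutativeRing R
    renaming (refl to ≈-refl; sym to ≈-sym; trans to ≈-trans; _+_ to _⊕_; _*_ to _⊗_; -_ to ⊖_;
      +-identityˡ to ⊕-identityˡ; +-identityʳ to ⊕-identityʳ; +-comm to ⊕-comm; +-assoc to ⊕-assoc)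
  open import Algebra.Properties.Ring ring
  open import Algebra.Properties.AbelianGroup +-abelianGroup using (⁻¹-∙-comm; ⁻¹-involutive; ε⁻¹≈ε)
  open import Algebra.Properties.Semiring.Mult.TCOptimised semiring using (×-homo-+; ×1-homo-*; 1+×) renaming (_×_ to _·_)
  open import Algebra.Solver.Ring.AlmostCommutativeRing using (fromCommutativeRing; _-Raw-AlmostCommutative⟶_)
  open import Data.Integer as ℤ using (ℤ; +_; -[1+_])
  import Data.Integer.Properties as ℤ
  import Data.Sign as Sign
  open import Data.Maybe using (Maybe; just; nothing)
  open import Relation.Binary.Reasoning.Setoid setoid

  private
    n· : ℕ → Carrier
    n· n = n · 1#

    ⟦_⟧ : ℤ → Carrier
    ⟦ + n ⟧      = n· n
    ⟦ -[1+ n ] ⟧ = ⊖ n· (suc n)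

    cancel : ∀ x a b → (x ⊕ a) ⊕ ⊖ (x ⊕ b) ≈ a ⊕ ⊖ b
    cancel x a b = begin
      (x ⊕ a) ⊕ ⊖ (x ⊕ b)        ≈⟨ +-cong (⊕-comm x a) (≈-sym (⁻¹-∙-comm x b)) ⟩
      (a ⊕ x) ⊕ (⊖ x ⊕ ⊖ b)      ≈⟨ ⊕-assoc a x _ ⟩
      a ⊕ (x ⊕ (⊖ x ⊕ ⊖ b))      ≈⟨ +-congˡ (≈-sym (⊕-assoc x _ _)) ⟩
      a ⊕ ((x ⊕ ⊖ x) ⊕ ⊖ b)      ≈⟨ +-congˡ (+-congʳ (-‿inverseʳ x)) ⟩
      a ⊕ (0# ⊕ ⊖ b)             ≈⟨ +-congˡ (⊕-identityˡ _) ⟩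
      a ⊕ ⊖ b                    ∎

    ⟦⊖⟧ : ∀ m n → ⟦ m ℤ.⊖ n ⟧ ≈ n· m ⊕ ⊖ n· n
    ⟦⊖⟧ zero    zero    = ≈-sym (-‿inverseʳ 0#)
    ⟦⊖⟧ (suc m) zero    = ≈-sym (≈-trans (+-congˡ ε⁻¹≈ε) (⊕-identityʳ _))
    ⟦⊖⟧ zero    (suc n) = ≈-sym (⊕-identityˡ _)
    ⟦⊖⟧ (suc m) (suc n) = begin
      ⟦ suc m ℤ.⊖ suc n ⟧              ≡⟨ cong ⟦_⟧ (ℤ.[1+m]⊖[1+n]≡m⊖n m n) ⟩
      ⟦ m ℤ.⊖ n ⟧                      ≈⟨ ⟦⊖⟧ m n ⟩
      n· m ⊕ ⊖ n· n                    ≈⟨ cancel 1# (n· m) (n· n) ⟨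
      (1# ⊕ n· m) ⊕ ⊖ (1# ⊕ n· n)      ≈⟨ +-cong (1+× m 1#) (-‿cong (1+× n 1#)) ⟨
      n· (suc m) ⊕ ⊖ n· (suc n)        ∎

    ⟦+⟧ : ∀ i j → ⟦ i ℤ.+ j ⟧ ≈ ⟦ i ⟧ ⊕ ⟦ j ⟧
    ⟦+⟧ (+ m)      (+ n)      = ×-homo-+ 1# m n
    ⟦+⟧ (+ m)      -[1+ n ]   = ⟦⊖⟧ m (suc n)
    ⟦+⟧ -[1+ m ]   (+ n)      = ≈-trans (⟦⊖⟧ n (suc m)) (⊕-comm _ _)
    ⟦+⟧ -[1+ m ]   -[1+ n ]   = begin
      ⊖ n· (suc (suc (m + n)))      ≡⟨ cong (λ k → ⊖ n· (suc k)) (+ℕ-suc m n) ⟨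
      ⊖ n· (suc m + suc n)          ≈⟨ -‿cong (×-homo-+ 1# (suc m) (suc n)) ⟩
      ⊖ (n· (suc m) ⊕ n· (suc n))   ≈⟨ ⁻¹-∙-comm _ _ ⟨
      ⊖ n· (suc m) ⊕ ⊖ n· (suc n)   ∎
      where +ℕ-suc = Data.Nat.Properties.+-suc

    ⟦-◃⟧ : ∀ n → ⟦ Sign.- ℤ.◃ n ⟧ ≈ ⊖ n· n
    ⟦-◃⟧ zero    = ≈-sym ε⁻¹≈ε
    ⟦-◃⟧ (suc n) = ≈-refl

    ⟦+◃⟧ : ∀ n → ⟦ Sign.+ ℤ.◃ n ⟧ ≈ n· n
    ⟦+◃⟧ zero    = ≈-refl
    ⟦+◃⟧ (suc n) = ≈-refl

    ⟦*⟧ : ∀ i j → ⟦ i ℤ.* j ⟧ ≈ ⟦ i ⟧ ⊗ ⟦ j ⟧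
    ⟦*⟧ (+ m)      (+ n)      = ≈-trans (⟦+◃⟧ (m * n)) (×1-homo-* m n)
    ⟦*⟧ (+ m)      -[1+ n ]   = ≈-trans (⟦-◃⟧ (m * suc n)) (≈-trans (-‿cong (×1-homo-* m (suc n))) (-‿distribʳ-* _ _))
    ⟦*⟧ -[1+ m ]   (+ n)      = ≈-trans (⟦-◃⟧ (suc m * n)) (≈-trans (-‿cong (×1-homo-* (suc m) n)) (-‿distribˡ-* _ _))
    ⟦*⟧ -[1+ m ]   -[1+ n ]   = begin
      ⟦ -[1+ m ] ℤ.* -[1+ n ] ⟧        ≈⟨ ⟦+◃⟧ (suc m * suc n) ⟩
      n· (suc m * suc n)               ≈⟨ ×1-homo-* (suc m) (suc n) ⟩
      n· (suc m) ⊗ n· (suc n)          ≈⟨ ⁻¹-involutive _ ⟨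
      ⊖ ⊖ (n· (suc m) ⊗ n· (suc n))    ≈⟨ -‿cong (-‿distribʳ-* _ _) ⟩
      ⊖ (n· (suc m) ⊗ ⊖ n· (suc n))    ≈⟨ -‿distribˡ-* _ _ ⟩
      ⊖ n· (suc m) ⊗ ⊖ n· (suc n)      ∎

    ⟦-⟧ : ∀ i → ⟦ ℤ.- i ⟧ ≈ ⊖ ⟦ i ⟧
    ⟦-⟧ (+ zero)  = ≈-sym ε⁻¹≈ε
    ⟦-⟧ (+ suc n) = ≈-refl
    ⟦-⟧ -[1+ n ]  = ≈-sym (⁻¹-involutive _)

    ℤ-rawRing : RawRing _ _
    ℤ-rawRing = CommutativeRing.rawRing ℤ.+-*-commutativeRing

    morphism : ℤ-rawRing -Raw-AlmostCommutative⟶ fromCommutativeRing R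
    morphism = record { ⟦_⟧ = ⟦_⟧ ; +-homo = ⟦+⟧ ; *-homo = ⟦*⟧ ; -‿homo = ⟦-⟧ ; 0-homo = ≈-refl ; 1-homo = ≈-refl }

    coeff≟ : ∀ i j → Maybe (⟦ i ⟧ ≈ ⟦ j ⟧)
    coeff≟ i j with i ℤ.≟ j
    ... | yes refl = just ≈-refl
    ... | no _     = nothing

  open import Algebra.Solver.Ring ℤ-rawRing (fromCommutativeRing R) morphism coeff≟ public
    using (Polynomial; con; _:+_; _:*_; _:-_; :-_; _:=_; solve)

  :1 : ∀ {n} → Polynomial n
  :1 = con (+ 1)

  :0 : ∀ {n} → Polynomial n
  :0 = con (+ 0)

  -- Reasoning modulo a hypothesis: the solver proves x - y = k(l - r) as a polynomial identity.
  -- Nested uses show membership in an ideal with explicit coefficients.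
  by : ∀ k {x y l r} → l ≈ r → x ≈ y ⊕ k ⊗ (l ⊕ ⊖ r) → x ≈ y
  by k {x} {y} {l} {r} l≈r e = begin
    x                      ≈⟨ e ⟩
    y ⊕ k ⊗ (l ⊕ ⊖ r)      ≈⟨ +-congˡ (*-congˡ (≈-trans (+-congʳ l≈r) (-‿inverseʳ r))) ⟩
    y ⊕ k ⊗ 0#             ≈⟨ +-congˡ (zeroʳ k) ⟩
    y ⊕ 0#                 ≈⟨ ⊕-identityʳ y ⟩
    y                      ∎

module Affine {c ℓ} (K : Field c ℓ) (dim : ℕ) where
  open Field K public
    using (commutativeRing; 0#; 1#; 0≉1; inverse; *-cong; *-congˡ; *-congʳ; +-cong; +-congˡ; +-congʳ; -‿cong; zeroʳ; zeroˡ)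
    renaming (Carrier to F; _≈_ to _≈ᶠ_; refl to ≈-refl; sym to ≈-sym; trans to ≈-trans; _+_ to _⊕_; _*_ to _⊗_; -_ to ⊖_)
  open RingSolver commutativeRing public

  V : Set c
  V = Fin dim → F

  _≈ᵛ_ : V → V → Set ℓ
  v ≈ᵛ w = ∀ i → v i ≈ᶠ w i

  -- Only scalar linear parts occur. The inverse of the scale is stored so that inversion needs no
  -- proof argument; `_≈ᵃ_` may ignore it by `inverse-unique`.
  record Aff : Set (c ⊔ ℓ) where
    no-eta-equality
    constructor aff
    field
      scale scale⁻¹ : F
      shift         : V
      unit          : scale ⊗ scale⁻¹ ≈ᶠ 1#
  open Aff public

  record _≈ᵃ_ (g h : Aff) : Set ℓ where
    constructor _,ᵃ_
    field
      scale≈ : scale g ≈ᶠ scale h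
      shift≈ : shift g ≈ᵛ shift h
  open _≈ᵃ_ public

  act : Aff → V → V
  act g v i = scale g ⊗ v i ⊕ shift g i

  _∘ᵃ_ : Aff → Aff → Aff
  scale   (g ∘ᵃ h)   = scale g ⊗ scale h
  scale⁻¹ (g ∘ᵃ h)   = scale⁻¹ g ⊗ scale⁻¹ h
  shift   (g ∘ᵃ h) i = scale g ⊗ shift h i ⊕ shift g i
  unit    (g ∘ᵃ h)   = by (scale h ⊗ scale⁻¹ h) (unit g) (≈-trans
    (≈-sym (by (⊖ 1#) (unit h) (solve 4 (λ a a′ b b′ → :1 :+ (b :* b′) :* (a :* a′ :- :1) := (a :* b) :* (a′ :* b′) :+ (:- :1) :* (b :* b′ :- :1)) ≈-refl
      (scale g) (scale⁻¹ g) (scale h) (scale⁻¹ h))))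
    ≈-refl)

  idᵃ : Aff
  idᵃ = aff 1# 1# (λ _ → 0#) (solve 0 (:1 :* :1 := :1) ≈-refl)

  invᵃ : Aff → Aff
  scale   (invᵃ g)   = scale⁻¹ g
  scale⁻¹ (invᵃ g)   = scale g
  shift   (invᵃ g) i = ⊖ (scale⁻¹ g ⊗ shift g i)
  unit    (invᵃ g)   = ≈-trans (solve 2 (λ a b → b :* a := a :* b) ≈-refl (scale g) (scale⁻¹ g)) (unit g)

  inverse-unique : ∀ {a a′ b b′} → a ⊗ a′ ≈ᶠ 1# → b ⊗ b′ ≈ᶠ 1# → a ≈ᶠ b → a′ ≈ᶠ b′
  inverse-unique {a} {a′} {b} {b′} ua ub a≈b = by (⊖ a′) ub (≈-trans
    (by b′ ua (≈-trans (by (⊖ (a′ ⊗ b′)) a≈b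
      (solve 4 (λ a a′ b b′ → a′ := (((b′ :+ (:- a′) :* (b :* b′ :- :1)) :+ b′ :* (a :* a′ :- :1)) :+ (:- (a′ :* b′)) :* (a :- b))) ≈-refl a a′ b b′))
      ≈-refl)) ≈-refl)

  affineGroup : Group (c ⊔ ℓ) ℓ
  affineGroup = record
    { Carrier = Aff
    ; _≈_     = _≈ᵃ_
    ; _∙_     = _∘ᵃ_
    ; ε       = idᵃ
    ; _⁻¹     = invᵃ
    ; isGroup = record
      { isMonoid = record
        { isSemigroup = record
          { isMagma = record
            { isEquivalence = record
              { refl  = ≈-refl ,ᵃ λ _ → ≈-refl
              ; sym   = λ (e ,ᵃ f) → ≈-sym e ,ᵃ λ i → ≈-sym (f i)
              ; trans = λ (e ,ᵃ f) (e′ ,ᵃ f′) → ≈-trans e e′ ,ᵃ λ i → ≈-trans (f i) (f′ i)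
              }
            ; ∙-cong = λ (e ,ᵃ f) (e′ ,ᵃ f′) → *-cong e e′ ,ᵃ λ i → +-cong (*-cong e (f′ i)) (f i)
            }
          ; assoc = λ g h k → solve 3 (λ a b c → (a :* b) :* c := a :* (b :* c)) ≈-refl (scale g) (scale h) (scale k)
              ,ᵃ λ i → solve 5 (λ a b u v w → (a :* b) :* w :+ (a :* v :+ u) := a :* (b :* w :+ v) :+ u) ≈-refl
                         (scale g) (scale h) (shift g i) (shift h i) (shift k i)
          }
        ; identity = (λ g → solve 1 (λ a → :1 :* a := a) ≈-refl (scale g)
                        ,ᵃ λ i → solve 1 (λ u → :1 :* u :+ :0 := u) ≈-refl (shift g i))
                   , (λ g → solve 1 (λ a → a :* :1 := a) ≈-refl (scale g)
                        ,ᵃ λ i → solve 2 (λ a u → a :* :0 :+ u := u) ≈-refl (scale g) (shift g i))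
        }
      ; inverse = (λ g → unit (invᵃ g)
                      ,ᵃ λ i → solve 2 (λ a u → a :* u :+ :- (a :* u) := :0) ≈-refl (scale⁻¹ g) (shift g i))
                , (λ g → unit g
                      ,ᵃ λ i → by (⊖ shift g i) (unit g)
                        (solve 3 (λ a a′ u → a :* (:- (a′ :* u)) :+ u := :0 :+ (:- u) :* (a :* a′ :- :1)) ≈-refl (scale g) (scale⁻¹ g) (shift g i)))
      ; ⁻¹-cong = λ {g} {h} (e ,ᵃ f) → let e⁻¹ = inverse-unique (unit g) (unit h) e in
                    e⁻¹ ,ᵃ λ i → -‿cong (*-cong e⁻¹ (f i))
      }
    }

  act-cong : ∀ {g h} → g ≈ᵃ h → ∀ {v w} → v ≈ᵛ w → act g v ≈ᵛ act h w
  act-cong (e ,ᵃ f) v≈w i = +-cong (*-cong e (v≈w i)) (f i)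

  act-∘ : ∀ g h v → act (g ∘ᵃ h) v ≈ᵛ act g (act h v)
  act-∘ g h v i = solve 5 (λ a b u w x → (a :* b) :* x :+ (a :* w :+ u) := a :* (b :* x :+ w) :+ u) ≈-refl
    (scale g) (scale h) (shift g i) (shift h i) (v i)

  act-inv : ∀ g v → act (invᵃ g) (act g v) ≈ᵛ v
  act-inv g v i = by (v i) (unit g) (solve 4 (λ a a′ u x → a′ :* (a :* x :+ u) :+ :- (a′ :* u) := x :+ x :* (a :* a′ :- :1)) ≈-refl
    (scale g) (scale⁻¹ g) (shift g i) (v i))

  nonzero-cancel : ∀ {x y} → ¬ x ≈ᶠ 0# → x ⊗ y ≈ᶠ 0# → y ≈ᶠ 0#
  nonzero-cancel {x} {y} x≉0 xy≈0 = let x′ , u = inverse x x≉0 in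
    by x′ xy≈0 (by (⊖ y) u (solve 3 (λ x x′ y → y := (:0 :+ x′ :* (x :* y :- :0)) :+ (:- y) :* (x :* x′ :- :1)) ≈-refl x x′ y))

  -≈0⇒≈ : ∀ {x y} → x ⊕ ⊖ y ≈ᶠ 0# → x ≈ᶠ y
  -≈0⇒≈ {x} {y} e = by 1# e (solve 2 (λ x y → x := y :+ :1 :* ((x :- y) :- :0)) ≈-refl x y)

-- Scalars almost preserving a set of vectors

two-related : ∀ {a p} {A : Set a} {R : A → A → Set p} {xs} → AllPairs R xs → 2 ≤ length xs →
              Σ A λ x → Σ A λ y → x ∈ xs × y ∈ xs × R x y
two-related ((r ∷ _) ∷ _) (s≤s (s≤s _)) = _ , _ , here refl , there (here refl) , r

module Characteristic {c ℓ} (K : Field c ℓ) where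
  open Affine K 0
  open Proj K using (_·1; HasCharacteristic)

  ·1-+ : ∀ m n → (m + n) ·1 ≈ᶠ (m ·1) ⊕ (n ·1)
  ·1-+ zero    n = solve 1 (λ x → x := :0 :+ x) ≈-refl (n ·1)
  ·1-+ (suc m) n = ≈-trans (+-congˡ (·1-+ m n)) (solve 2 (λ x y → :1 :+ (x :+ y) := (:1 :+ x) :+ y) ≈-refl (m ·1) (n ·1))

  -- The least m > 0 with m·1 = 0 is the characteristic and so exceeds L; strong induction supplies
  -- the minimality.
  no-torsion : ∀ L → (∀ p → HasCharacteristic p → L < p) → ∀ m → 0 < m → m ≤ L → ¬ ((m ·1) ≈ᶠ 0#)
  no-torsion L char = <-rec _ λ m ih 0<m m≤L e →
    <⇒≱ (char m (0<m , e , λ m′ 0<m′ m′<m → ih m′<m 0<m′ (≤-trans (<⇒≤ m′<m) m≤L))) m≤L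

  multiples-distinct : ∀ L → (∀ p → HasCharacteristic p → L < p) → AllPairs (λ m n → ¬ ((m ·1) ≈ᶠ (n ·1))) (upTo (suc L))
  multiples-distinct L char = AllPairs.applyUpTo⁺₁ id (suc L) λ {i} {j} i<j j<1+L e →
    no-torsion L char (j ∸ i) (m<n⇒0<n∸m i<j) (≤-trans (m∸n≤m j i) (≤-pred j<1+L))
      (difference (≤-trans (n≤1+n i) i<j) e)
    where
    difference : ∀ {i j} → i ≤ j → (i ·1) ≈ᶠ (j ·1) → ((j ∸ i) ·1) ≈ᶠ 0#
    difference {i} {j} i≤j e = by 1# (≈-trans (≈-sym (·1-+ i (j ∸ i))) (≈-trans (≈-reflexive (cong _·1 (m+[n∸m]≡n i≤j))) (≈-sym e)))
      (solve 2 (λ x y → y := :0 :+ :1 :* ((x :+ y) :- x)) ≈-refl (i ·1) ((j ∸ i) ·1))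
      where
      ≈-reflexive : ∀ {x y} → x ≡ y → x ≈ᶠ y
      ≈-reflexive refl = ≈-refl

module GoodScalars {c ℓ h} (K : Field c ℓ) (dim : ℕ) (H : (Fin dim → Field.Carrier K) → Set h) where
  open Affine K dim
  open Proj K using (_·1; HasCharacteristic)

  _≉_ : F → F → Set ℓ
  x ≉ y = ¬ x ≈ᶠ y

  -- H is symmetric, H + H is covered by κ translates of H, and W lists H without repetition. In the
  -- application H is V₄.
  record Covering : Set (c ⊔ ℓ ⊔ h) where
    field
      H-resp : ∀ {v w} → v ≈ᵛ w → H v → H w
      H-neg  : ∀ {v} → H v → H (λ i → ⊖ v i)
      X      : List V
      κ      : ℕ
      κ>0    : 0 < κ
      X≤κ    : length X ≤ κ
      H-+    : ∀ {v w} → H v → H w → DN (Σ V λ x → x ∈ X × H (λ i → (v i ⊕ w i) ⊕ ⊖ x i))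
      W      : List V
      W-≉    : AllPairs (λ v w → ¬ v ≈ᵛ w) W
      W-H    : All H W
      W-max  : ∀ {v} → H v → DN (Σ V λ w → w ∈ W × v ≈ᵛ w)

  module Closure (𝓒 : Covering) where
    open Covering 𝓒

    Good : F → ℕ → Set (c ⊔ h)
    Good s k = Σ (List V) λ Y → length Y ≤ k × (∀ v → H v → DN (Σ V λ y → y ∈ Y × H (λ i → s ⊗ v i ⊕ ⊖ y i)))

    good-mono : ∀ {s k l} → k ≤ l → Good s k → Good s l
    good-mono k≤l (Y , Y≤k , f) = Y , ≤-trans Y≤k k≤l , f

    good-⊖ : ∀ {s k} → Good s k → Good (⊖ s) k
    good-⊖ {s} (Y , Y≤k , f) = map (λ y i → ⊖ y i) Y , ≤-trans (≤-reflexive (length-map _ Y)) Y≤k , λ v Hv → do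
      y , y∈ , Hy ← f v Hv
      pure (_ , ∈-map⁺ _ y∈ , H-resp (λ i → solve 3 (λ s v y → :- (s :* v :- y) := (:- s) :* v :- (:- y)) ≈-refl s (v i) (y i)) (H-neg Hy))

    good-⊕ : ∀ {s t k l} → Good s k → Good t l → Good (s ⊕ t) (k * l * κ)
    good-⊕ {s} {t} (Y , Y≤k , f) (Z , Z≤l , g) = cartesianProductWith (λ y x i → y i ⊕ x i) (cartesianProductWith (λ y z i → y i ⊕ z i) Y Z) X
      , ≤-trans (≤-reflexive (trans (length-cartesianProductWith _ (cartesianProductWith _ Y Z) X) (cong (_* length X) (length-cartesianProductWith _ Y Z))))
          (*-mono-≤ (*-mono-≤ Y≤k Z≤l) X≤κ)
      , λ v Hv → do
        y , y∈ , Hy ← f v Hv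
        z , z∈ , Hz ← g v Hv
        x , x∈ , Hx ← H-+ Hy Hz
        pure (_ , ∈-cartesianProductWith⁺ (λ y x i → y i ⊕ x i) (∈-cartesianProductWith⁺ (λ y z i → y i ⊕ z i) y∈ z∈) x∈
          , H-resp (λ i → solve 6 (λ s t v y z x → ((s :* v :- y) :+ (t :* v :- z)) :- x := (s :+ t) :* v :- ((y :+ z) :+ x)) ≈-refl
                      s t (v i) (y i) (z i) (x i)) Hx)

    good-⊗ : ∀ {s t k l} → Good s k → Good t l → Good (s ⊗ t) (k * l)
    good-⊗ {s} {t} (Y , Y≤k , f) (Z , Z≤l , g) = cartesianProductWith (λ y z i → s ⊗ z i ⊕ y i) Y Z
      , ≤-trans (≤-reflexive (length-cartesianProductWith _ Y Z)) (*-mono-≤ Y≤k Z≤l)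
      , λ v Hv → do
        z , z∈ , Hz ← g v Hv
        y , y∈ , Hy ← f _ Hz
        pure (_ , ∈-cartesianProductWith⁺ (λ y z i → s ⊗ z i ⊕ y i) y∈ z∈
          , H-resp (λ i → solve 5 (λ s t v y z → s :* (t :* v :- z) :- y := (s :* t) :* v :- (s :* z :+ y)) ≈-refl s t (v i) (y i) (z i)) Hy)

    W⁴ : List ((V × V) × (V × V))
    W⁴ = cartesianProduct (cartesianProduct W W) (cartesianProduct W W)

    w : ℕ
    w = length W

    w⁴ : ℕ
    w⁴ = w * w * (w * w)

    length-W⁴ : length W⁴ ≡ w⁴
    length-W⁴ = trans (length-cartesianProduct (cartesianProduct W W) _) (cong₂ _*_ (length-cartesianProduct W W) (length-cartesianProduct W W))

    Determines : F → (V × V) × (V × V) → Set ℓ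
    Determines s ((v , v′) , (x , x′)) = ¬ v ≈ᵛ v′ × (∀ i → s ⊗ (v i ⊕ ⊖ v′ i) ≈ᶠ x i ⊕ ⊖ x′ i)

    determines-unique : ∀ {s s′ z} → s ≉ s′ → Determines s z → Determines s′ z → ⊥
    determines-unique {s} {s′} {(v , v′) , _} s≉s′ (v≉v′ , e) (_ , e′) = v≉v′ λ i → -≈0⇒≈
      (nonzero-cancel (s≉s′ ∘ -≈0⇒≈) (by 1# (≈-trans (e i) (≈-sym (e′ i)))
        (solve 4 (λ s s′ v v′ → (s :- s′) :* (v :- v′) := :0 :+ :1 :* (s :* (v :- v′) :- s′ :* (v :- v′))) ≈-refl s s′ (v i) (v′ i))))

    -- If k < |W|, two elements v, v′ of W have s v and s v′ in the same translate of H. Subtracting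
    -- gives s (v - v′) = x - x′ with x, x′ in W, and this quadruple determines s.
    good-determined : ∀ {s k} → k < w → Good s k → DN (Σ _ λ z → z ∈ W⁴ × Determines s z)
    good-determined {s} k<w (Y , Y≤k , f) none = <⇒≱ k<w (≤-trans (pigeonhole
        {D = λ v v′ → ¬ v ≈ᵛ v′ × v ∈ W × v′ ∈ W} (λ v y → H (λ i → s ⊗ v i ⊕ ⊖ y i)) (λ {v} {v′} {y} → collide {v} {v′} {y}) Y
        (AllPairs-∈ W-≉) (λ v∈ → f _ (All.lookup W-H v∈))) Y≤k)
      where
      collide : ∀ {v v′ y : V} → ¬ v ≈ᵛ v′ × v ∈ W × v′ ∈ W → H (λ i → s ⊗ v i ⊕ ⊖ y i) → H (λ i → s ⊗ v′ i ⊕ ⊖ y i) → ⊥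
      collide {v} {v′} {y} (v≉v′ , v∈ , v′∈) Hv Hv′ = W-max Hv λ (x , x∈ , e) → W-max Hv′ λ (x′ , x′∈ , e′) →
        none (_ , ∈-cartesianProduct⁺ (∈-cartesianProduct⁺ v∈ v′∈) (∈-cartesianProduct⁺ x∈ x′∈) , v≉v′ , λ i →
          by 1# (e i) (by (⊖ 1#) (e′ i) (solve 6 (λ s v v′ y x x′ →
            s :* (v :- v′) := ((x :- x′) :+ :1 :* ((s :* v :- y) :- x)) :+ (:- :1) :* ((s :* v′ :- y) :- x′)) ≈-refl s (v i) (v′ i) (y i) (x i) (x′ i))))

    few-good : ∀ {k} → k < w → ∀ ss → AllPairs _≉_ ss → All (λ s → Good s k) ss → length ss ≤ w⁴
    few-good k<w ss ds gs = ≤-trans (pigeonhole Determines determines-unique W⁴ ds (λ s∈ → good-determined k<w (All.lookup gs s∈))) (≤-reflexive length-W⁴)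

    module Step (T : List F) (T-≉ : AllPairs _≉_ T) {k : ℕ} (T-good : All (λ t → Good t k) T) (κ≤k : κ ≤ k) where

      -- num/den ∉ (T − T)/(T − T), with denominators cleared
      NotRatio : F → F → Set (c ⊔ ℓ)
      NotRatio num den = ∀ a b c d → a ∈ T → b ∈ T → c ∈ T → d ∈ T → ¬ c ≈ᶠ d → ¬ num ⊗ (c ⊕ ⊖ d) ≈ᶠ (a ⊕ ⊖ b) ⊗ den

      Pivot : Set (c ⊔ ℓ)
      Pivot = Σ F λ a → Σ F λ b → Σ F λ c → Σ F λ d → (a ∈ T × b ∈ T × c ∈ T × d ∈ T) ×
        ¬ c ≈ᶠ d × NotRatio ((a ⊕ ⊖ b) ⊕ (c ⊕ ⊖ d)) (c ⊕ ⊖ d)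

      Next : Set (c ⊔ ℓ ⊔ h)
      Next = Σ (List F) λ T′ → AllPairs _≉_ T′ × All (λ t → Good t (k ^ 13)) T′ × length T′ ≡ length T * length T

      -- Up to the factor `den`, the new set is T + (r + 1) T. A coincidence between two of its sums
      -- would exhibit r + 1 as a ratio.
      expand : Pivot → Next
      expand (a , b , c , d , (a∈ , b∈ , c∈ , d∈) , c≉d , notRatio) =
        cartesianProductWith f T T
        , AllPairs-cartesianProductWith f distinct₁ distinct₂ (AllPairs-∈ T-≉) (AllPairs-∈ T-≉)
        , All.tabulate good
        , length-cartesianProductWith f T T
        where
        den num : F
        den = c ⊕ ⊖ d
        num = (a ⊕ ⊖ b) ⊕ (c ⊕ ⊖ d)
        f : F → F → F
        f x y = den ⊗ x ⊕ num ⊗ y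
        distinct₁ : ∀ {x x′ y y′} → y ∈ T → y′ ∈ T → x ≉ x′ × x ∈ T × x′ ∈ T → f x y ≉ f x′ y′
        distinct₁ {x} {x′} {y} {y′} y∈ y′∈ (x≉x′ , x∈ , x′∈) e = notRatio x x′ y′ y x∈ x′∈ y′∈ y∈ y′≉y
          (by (⊖ 1#) e (solve 6 (λ n d x x′ y y′ → n :* (y′ :- y) := (x :- x′) :* d :+ (:- :1) :* ((d :* x :+ n :* y) :- (d :* x′ :+ n :* y′))) ≈-refl num den x x′ y y′))
          where
          y′≉y : ¬ y′ ≈ᶠ y
          y′≉y y′≈y = x≉x′ (-≈0⇒≈ (nonzero-cancel (c≉d ∘ -≈0⇒≈) (by 1# e (by num y′≈y
            (solve 6 (λ n d x x′ y y′ → d :* (x :- x′) := (:0 :+ :1 :* ((d :* x :+ n :* y) :- (d :* x′ :+ n :* y′))) :+ n :* (y′ :- y)) ≈-refl num den x x′ y y′)))))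
        distinct₂ : ∀ {x y y′} → y ≉ y′ × y ∈ T × y′ ∈ T → f x y ≉ f x y′
        -- Here `num` (y - y′) = 0, which would make r + 1 the ratio 0 = (y - y)/(y - y′).
        distinct₂ {x} {y} {y′} (y≉y′ , y∈ , y′∈) e = notRatio y y y y′ y∈ y∈ y∈ y′∈ y≉y′
          (by 1# e (solve 5 (λ n d x y y′ → n :* (y :- y′) := (y :- y) :* d :+ :1 :* ((d :* x :+ n :* y) :- (d :* x :+ n :* y′))) ≈-refl num den x y y′))
        good : ∀ {t} → t ∈ cartesianProductWith f T T → Good t (k ^ 13)
        good t∈ with ∈-cartesianProductWith⁻ f T T t∈
        ... | x , y , x∈ , y∈ , refl = good-mono bound
          (good-⊕ (good-⊗ (good-⊕ (all c∈) (good-⊖ (all d∈))) (all x∈))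
                  (good-⊗ (good-⊕ (good-⊕ (all a∈) (good-⊖ (all b∈))) (good-⊕ (all c∈) (good-⊖ (all d∈)))) (all y∈)))
          where
          all : ∀ {t} → t ∈ T → Good t k
          all = All.lookup T-good
          collect : ∀ k → k * k * k * k * (k * k * k * (k * k * k) * k * k) * k ≡ k * (k * (k * (k * (k * (k * (k * (k * (k * (k * (k * (k * (k * 1))))))))))))
          collect = solve-∀
          -- With κ ≤ k the exponents are 4 for `den` x, 8 for `num` y and 1 for adding them: 13 in
          -- all.
          bound : k * k * κ * k * (k * k * κ * (k * k * κ) * κ * k) * κ ≤ k ^ 13
          bound = ≤-trans (*-mono-≤ (*-mono-≤ (*-mono-≤ kk ≤-refl) (*-mono-≤ (*-mono-≤ (*-mono-≤ kk kk) κ≤k) ≤-refl)) κ≤k) (≤-reflexive (collect k))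
            where
            kk : k * k * κ ≤ k * k * k
            kk = *-monoʳ-≤ (k * k) κ≤k

      T⁴ : List ((F × F) × (F × F))
      T⁴ = cartesianProduct (cartesianProduct T T) (cartesianProduct T T)

      IsRatio : F → (F × F) × (F × F) → Set ℓ
      IsRatio x ((a , b) , (c , d)) = ¬ c ≈ᶠ d × x ⊗ (c ⊕ ⊖ d) ≈ᶠ a ⊕ ⊖ b

      ratio-unique : ∀ {x y z} → x ≉ y → IsRatio x z → IsRatio y z → ⊥
      ratio-unique {x} {y} {_ , (c , d)} x≉y (c≉d , e) (_ , e′) = c≉d (-≈0⇒≈ (nonzero-cancel (x≉y ∘ -≈0⇒≈)
        (by 1# (≈-trans e (≈-sym e′)) (solve 3 (λ x y c → (x :- y) :* c := :0 :+ :1 :* (x :* c :- y :* c)) ≈-refl x y (c ⊕ ⊖ d)))))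

      -- Without a pivot the ratios are closed under adding 1, and 0 is a ratio. Thus every m·1 is
      -- one, which is too many for |T|⁴ quadruples when the characteristic is large.
      multiples : ∀ {c d} → c ∈ T → d ∈ T → ¬ c ≈ᶠ d → ¬ Pivot → ∀ m → DN (Σ _ λ z → z ∈ T⁴ × IsRatio (m ·1) z)
      multiples {c} {d} c∈ d∈ c≉d ¬pivot zero = pure (_ , ∈-cartesianProduct⁺ (∈-cartesianProduct⁺ c∈ c∈) (∈-cartesianProduct⁺ c∈ d∈) , c≉d
        , solve 2 (λ c d → :0 :* (c :- d) := c :- c) ≈-refl c d)
      multiples c∈ d∈ c≉d ¬pivot (suc m) = do
        ((a , b) , (c , d)) , z∈ , c≉d , e ← multiples c∈ d∈ c≉d ¬pivot m
        let ab∈ , cd∈ = ∈-cartesianProduct⁻ (cartesianProduct T T) (cartesianProduct T T) z∈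
            a∈ , b∈ = ∈-cartesianProduct⁻ T T ab∈
            c∈ , d∈ = ∈-cartesianProduct⁻ T T cd∈
        λ none → ¬pivot (a , b , c , d , (a∈ , b∈ , c∈ , d∈) , c≉d , λ a′ b′ c′ d′ a′∈ b′∈ c′∈ d′∈ c′≉d′ e′ →
          none (((a′ , b′) , (c′ , d′)) , ∈-cartesianProduct⁺ (∈-cartesianProduct⁺ a′∈ b′∈) (∈-cartesianProduct⁺ c′∈ d′∈) , c′≉d′
            , -≈0⇒≈ (nonzero-cancel (c≉d ∘ -≈0⇒≈) (by (c′ ⊕ ⊖ d′) e (by 1# e′
                (solve 7 (λ m a b c d C D → (c :- d) :* ((:1 :+ m) :* C :- D)
                  := (:0 :+ C :* (m :* (c :- d) :- (a :- b))) :+ :1 :* (((a :- b) :+ (c :- d)) :* C :- D :* (c :- d))) ≈-refl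
                  (m ·1) a b c d (c′ ⊕ ⊖ d′) (a′ ⊕ ⊖ b′)))))))

      next : 2 ≤ length T → (∀ p → HasCharacteristic p → length T * length T * (length T * length T) < p) → DN Next
      next 2≤T char = do
        yes pivot ← dec Pivot
          where no ¬pivot → ⊥-elim (stuck ¬pivot (two-related T-≉ 2≤T))
        pure (expand pivot)
        where
        L = length T * length T * (length T * length T)
        stuck : ¬ Pivot → (Σ F λ c → Σ F λ d → c ∈ T × d ∈ T × c ≉ d) → ⊥
        stuck ¬pivot (c , d , c∈ , d∈ , c≉d) = <⇒≱ (s≤s ≤-refl) (begin
          suc L            ≡⟨ length-upTo (suc L) ⟨
          length (upTo (suc L)) ≤⟨ pigeonhole (λ m z → IsRatio (m ·1) z) (λ {m} {m′} ne e e′ → ratio-unique ne e e′) T⁴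
                                (Characteristic.multiples-distinct K L char) (λ {m} _ → multiples c∈ d∈ c≉d ¬pivot m) ⟩
          length T⁴        ≡⟨ trans (length-cartesianProduct (cartesianProduct T T) (cartesianProduct T T)) (cong₂ _*_ (length-cartesianProduct T T) (length-cartesianProduct T T)) ⟩
          L                ∎)
          where open ≤-Reasoning

    -- Each step squares |T|, so that T outgrows the bound of few-good.
    pivoting : ∀ j T → AllPairs _≉_ T → ∀ {k} → All (λ t → Good t k) T → κ ≤ k → 2 ≤ length T →
               k ^ (13 ^ j) < w → w⁴ < length T ^ (2 ^ j) → (∀ p → HasCharacteristic p → w⁴ * w⁴ * (w⁴ * w⁴) < p) → ⊥
    pivoting zero T T-≉ {k} T-good κ≤k 2≤T k<w w⁴<T char = <⇒≱ (subst (w⁴ <_) (*-identityʳ (length T)) w⁴<T)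
      (few-good (subst (_< w) (*-identityʳ k) k<w) T T-≉ T-good)
    pivoting (suc j) T T-≉ {k} T-good κ≤k 2≤T k<w w⁴<T char with w⁴ <? length T
    ... | yes w⁴<T′ = <⇒≱ w⁴<T′ (few-good (≤-<-trans k≤ k<w) T T-≉ T-good)
      where
      k≤ : k ≤ k ^ (13 ^ suc j)
      k≤ = subst (_≤ k ^ (13 ^ suc j)) (*-identityʳ k) (^-monoʳ-≤ k {{>-nonZero (≤-trans κ>0 κ≤k)}} {1} {13 ^ suc j} (m^n>0 13 (suc j)))
    ... | no w⁴≮T = Step.next T T-≉ T-good κ≤k 2≤T
      (λ p h → ≤-<-trans (*-mono-≤ (*-mono-≤ T≤ T≤) (*-mono-≤ T≤ T≤)) (char p h))
      λ (T′ , T′-≉ , T′-good , eq) → pivoting j T′ T′-≉ T′-good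
        (≤-trans κ≤k (subst (_≤ k ^ 13) (*-identityʳ k) (^-monoʳ-≤ k {{>-nonZero (≤-trans κ>0 κ≤k)}} {1} {13} (s≤s z≤n))))
        (subst (2 ≤_) (sym eq) (≤-trans 2≤T (m≤m*n (length T) (length T) {{>-nonZero (≤-trans (s≤s z≤n) 2≤T)}})))
        (subst (_< w) (sym (^-*-assoc k 13 (13 ^ j))) k<w)
        (subst (w⁴ <_) (trans (sym (^-*-assoc (length T) 2 (2 ^ j))) (cong (_^ (2 ^ j)) (trans (cong (length T *_) (*-identityʳ (length T))) (sym eq)))) w⁴<T)
        char
      where
      T≤ : length T ≤ w⁴
      T≤ = ≮⇒≥ w⁴≮T

-- Approximate groups of affine maps

module ApproximateGroup {c ℓ} (K : Field c ℓ) (dim : ℕ) where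
  open Affine K dim
  open Proj K using (HasCharacteristic)
  module 𝔾 = Group affineGroup
  open Popularity affineGroup using (SmallSet)
  open 𝔾 using (_∙_; _⁻¹; ε) renaming (_≈_ to _≈ᴳ_)

  module Translations (𝕊 : SmallSet) where
    open SmallSet 𝕊 public
    open Popularity.Powers affineGroup 𝕊 public

    translation : V → Aff
    translation u = aff 1# 1# u (solve 0 (:1 :* :1 := :1) ≈-refl)

    Tr : ℕ → V → Set (c ⊔ ℓ)
    Tr k u = Pow k (translation u)

    Tr-resp : ∀ k {u v} → u ≈ᵛ v → Tr k u → Tr k v
    Tr-resp k e = Pow-resp k (≈-refl ,ᵃ e)

    Tr-⊕ : ∀ j k {u v} → Tr j u → Tr k v → Tr (j + k) (λ i → u i ⊕ v i)
    Tr-⊕ j k {u} {v} Tu Tv = Pow-resp (j + k)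
      (solve 0 (:1 :* :1 := :1) ≈-refl ,ᵃ λ i → solve 2 (λ u v → :1 :* v :+ u := u :+ v) ≈-refl (u i) (v i)) (Pow-∙ j k Tu Tv)

    Tr-⊖ : ∀ k {u} → Tr k u → Tr k (λ i → ⊖ u i)
    Tr-⊖ k {u} Tu = Pow-resp k (≈-refl ,ᵃ λ i → solve 1 (λ u → :- (:1 :* u) := :- u) ≈-refl (u i)) (Pow-inverse k Tu)

    -- Conjugating a translation by p multiplies its vector by the linear part of p; the two extra
    -- factors are p and its inverse.
    Tr-scale : ∀ k {p u} → P p → Tr k u → Tr (1 + (k + 1)) (λ i → scale p ⊗ u i)
    Tr-scale k {p} {u} Pp Tu = Pow-resp (1 + (k + 1))
      (by 1# (unit p) (solve 2 (λ a a′ → a :* (:1 :* a′) := :1 :+ :1 :* (a :* a′ :- :1)) ≈-refl (scale p) (scale⁻¹ p))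
       ,ᵃ λ i → by (⊖ shift p i) (unit p)
          (solve 4 (λ a a′ u s → a :* (:1 :* (:- (a′ :* s)) :+ u) :+ s := a :* u :+ (:- s) :* (a :* a′ :- :1)) ≈-refl (scale p) (scale⁻¹ p) (u i) (shift p i)))
      (Pow-∙ 1 (k + 1) (Pow-one Pp) (Pow-∙ k 1 Tu (Pow-one (P-inverse Pp))))

    Tr-quotient : ∀ j k {p r} → Pow j p → Pow k r → scale p ≈ᶠ scale r →
                  Σ V λ u → Tr (j + k) u × p ≈ᴳ translation u ∙ r
    Tr-quotient j k {p} {r} Pp Pr e = shift (p ∙ r ⁻¹)
      , Pow-resp (j + k) (e₁ ,ᵃ λ _ → ≈-refl) (Pow-∙ j k Pp (Pow-inverse k Pr))
      , (≈-trans e (solve 1 (λ x → x := :1 :* x) ≈-refl (scale r))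
         ,ᵃ λ i → ≈-sym (by (⊖ shift r i) e₁ (solve 4 (λ a b u v → :1 :* v :+ (a :* (:- (b :* v)) :+ u) := u :+ (:- v) :* (a :* b :- :1)) ≈-refl
              (scale p) (scale⁻¹ r) (shift p i) (shift r i))))
      where
      e₁ : scale p ⊗ scale⁻¹ r ≈ᶠ 1#
      e₁ = ≈-trans (*-congʳ e) (unit r)

    Tr-commutator : ∀ {r p} → P r → P p → Σ V λ u → Tr 4 u × r ∙ p ≈ᴳ translation u ∙ (p ∙ r)
    Tr-commutator {r} {p} Pr Pp = Tr-quotient 2 2 {r ∙ p} {p ∙ r} pow₁ pow₂ same-scale
      where
      pow₁ : Pow 2 (r ∙ p)
      pow₁ = Pow-∙ 1 1 {r} {p} (Pow-one {r} Pr) (Pow-one {p} Pp)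
      pow₂ : Pow 2 (p ∙ r)
      pow₂ = Pow-∙ 1 1 {p} {r} (Pow-one {p} Pp) (Pow-one {r} Pr)
      same-scale : scale r ⊗ scale p ≈ᶠ scale p ⊗ scale r
      same-scale = Field.*-comm K (scale r) (scale p)

    c# : ℕ → ℕ
    c# k = (2 * (M * M)) ^ k

    few-translations : ∀ k us → AllPairs (λ u v → ¬ u ≈ᵛ v) us → All (Tr k) us → length us ≤ q * c# k
    few-translations k us ds ts = subst (_≤ q * c# k) (length-map translation us)
      (few-powers k (map translation us) (AllPairs.map⁺ (AllPairs.map (λ ne e → ne (shift≈ e)) ds)) (All.map⁺ ts))

    maximal-translations : ∀ k → DN (Σ (List V) λ us → AllPairs (λ u v → ¬ u ≈ᵛ v) us × All (Tr k) us ×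
                                    (∀ {v} → Tr k v → DN (Σ V λ w → w ∈ us × v ≈ᵛ w)))
    maximal-translations k = do
      us , ds , ts , max ← maximal (Tr k) (λ u v → ¬ u ≈ᵛ v) (q * c# k) (few-translations k)
      pure (us , ds , ts , λ {v} Tv → ¬All⇒DNAny us (max v Tv))

    -- `as` is a column of popular quotients, `ps` represents the linear parts that occur in P, and
    -- `ws` lists V₂.
    module Chosen (b₀ : Fin q) (as : List (Fin q)) (as-unique : Unique as) (as-popular : All (λ a → Popular a b₀) as)
      (q≤2M|as| : q ≤ 2 * M * length as)
      (ps : List Aff) (ps-distinct : AllPairs (λ p r → ¬ scale p ≈ᶠ scale r) ps) (ps-P : All P ps)
      (ps-max : ∀ p → P p → DN (Σ Aff λ r → r ∈ ps × scale p ≈ᶠ scale r))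
      (ws : List V) (ws-distinct : AllPairs (λ u v → ¬ u ≈ᵛ v) ws) (ws-Tr : All (Tr 2) ws)
      (ws-max : ∀ {v} → Tr 2 v → DN (Σ V λ w → w ∈ ws × v ≈ᵛ w)) where

      open ≤-Reasoning

      τ w₂ : ℕ
      τ = length ps
      w₂ = length ws

      p : Fin q → Aff
      p a = S a ∙ S b₀ ⁻¹

      p-P : ∀ {a} → a ∈ as → P (p a)
      p-P {a} a∈ = (a , b₀) , All.lookup as-popular a∈ , 𝔾.refl

      p-injective : ∀ {a b} → p a ≈ᴳ p b → a ≡ b
      p-injective e = injective _ _ (∙-cancelʳ (S b₀ ⁻¹) _ _ e)
        where open import Algebra.Properties.Group affineGroup using (∙-cancelʳ)

      -- Every `p a` is a translation in V₂ times the element of `ps` with the same linear part.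
      |as|≤τw₂ : length as ≤ τ * w₂
      |as|≤τw₂ = ≤-trans (pigeonhole Located (λ {a} {b} {ru} → clash {a} {b} {ru}) (cartesianProduct ps ws) as-unique located)
        (≤-reflexive (length-cartesianProduct ps ws))
        where
        Located : Fin q → Aff × V → Set ℓ
        Located a (r , u) = p a ≈ᴳ translation u ∙ r
        clash : ∀ {a b ru} → a ≢ b → Located a ru → Located b ru → ⊥
        clash {a} {b} {r , u} ne e e′ = ne (p-injective {a} {b} (𝔾.trans {p a} {translation u ∙ r} {p b} e (𝔾.sym {p b} {translation u ∙ r} e′)))
        located : ∀ {a} → a ∈ as → DN (Σ (Aff × V) λ ru → ru ∈ cartesianProduct ps ws × Located a ru)
        located {a} a∈ = do
          r , r∈ , e ← ps-max (p a) (p-P a∈)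
          let u , Tu , e′ = Tr-quotient 1 1 {p a} {r} (Pow-one {p a} (p-P a∈)) (Pow-one {r} (All.lookup ps-P r∈)) e
          v , v∈ , u≈v ← ws-max Tu
          pure ((r , v) , ∈-cartesianProduct⁺ r∈ v∈ , 𝔾.trans {p a} {translation u ∙ r} {translation v ∙ r} e′ (≈-refl ,ᵃ λ i → +-congˡ (u≈v i)))

      q≤2Mτw₂ : q ≤ 2 * M * (τ * w₂)
      q≤2Mτw₂ = ≤-trans q≤2M|as| (*-monoʳ-≤ (2 * M) |as|≤τw₂)

      positive : 0 < τ * w₂
      positive = n≢0⇒n>0 λ τw≡0 → <⇒≱ q>0 (≤-trans q≤2Mτw₂ (≤-reflexive (trans (cong (2 * M *_) τw≡0) (*-zeroʳ (2 * M)))))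

      instance
        τw₂-nonZero : NonZero (τ * w₂)
        τw₂-nonZero = >-nonZero positive
        τ-nonZero : NonZero τ
        τ-nonZero = m*n≢0⇒m≢0 τ
        w₂-nonZero : NonZero w₂
        w₂-nonZero = m*n≢0⇒n≢0 τ

      -- The products of `us` with `ps` are distinct elements of Pᵏ⁺¹, so τ times `length us` is at
      -- most a constant times q, hence a constant times τ |V₂|. Cancelling τ compares Vₖ with V₂,
      -- even if both are far smaller than q.
      few-relative : ∀ k us → AllPairs (λ u v → ¬ u ≈ᵛ v) us → All (Tr k) us → length us ≤ 2 * M * c# (suc k) * w₂
      few-relative k us ds ts = *-cancelˡ-≤ τ (begin
        τ * length us ≡⟨ length-cartesianProductWith f ps us ⟨
        length (cartesianProductWith f ps us) ≤⟨ few-powers (suc k) (cartesianProductWith f ps us) distinct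
          (All.tabulate (λ {x} → powers {x})) ⟩
        q * c# (suc k) ≤⟨ *-monoˡ-≤ (c# (suc k)) q≤2Mτw₂ ⟩
        2 * M * (τ * w₂) * c# (suc k) ≡⟨ regroup (2 * M) τ w₂ (c# (suc k)) ⟩
        τ * (2 * M * c# (suc k) * w₂) ∎)
        where
        regroup : ∀ a t w c → a * (t * w) * c ≡ t * (a * c * w)
        regroup = solve-∀
        f : Aff → V → Aff
        f p u = translation u ∙ p
        unscale : ∀ {p p′ u u′} → f p u ≈ᴳ f p′ u′ → scale p ≈ᶠ scale p′
        unscale {p} {p′} (e ,ᵃ _) = by 1# e (solve 2 (λ x y → x := y :+ :1 :* (:1 :* x :- :1 :* y)) ≈-refl (scale p) (scale p′))
        unshift : ∀ {p u u′} → f p u ≈ᴳ f p u′ → u ≈ᵛ u′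
        unshift {p} {u} {u′} (_ ,ᵃ e) i = by 1# (e i) (solve 3 (λ s u u′ → u := u′ :+ :1 :* ((:1 :* s :+ u) :- (:1 :* s :+ u′))) ≈-refl (shift p i) (u i) (u′ i))
        distinct : AllPairs (λ x y → ¬ x ≈ᴳ y) (cartesianProductWith f ps us)
        distinct = AllPairs-cartesianProductWith {R = λ p r → ¬ scale p ≈ᶠ scale r} {S = λ u v → ¬ u ≈ᵛ v} {T = λ x y → ¬ x ≈ᴳ y} f
          (λ {p} {p′} {u} {u′} _ _ ne e → ne (unscale {p} {p′} {u} {u′} e)) (λ {p} {u} {u′} ne e → ne (unshift {p} {u} {u′} e)) ps-distinct ds
        power : ∀ r u → r ∈ ps → u ∈ us → Pow (suc k) (f r u)
        power r u r∈ u∈ = subst (λ j → Pow j (f r u)) (+-comm k 1)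
          (Pow-∙ k 1 {translation u} {r} (All.lookup ts u∈) (Pow-one {r} (All.lookup ps-P r∈)))
        powers : ∀ {x} → x ∈ cartesianProductWith f ps us → Pow (suc k) x
        powers {x} x∈ = let r , u , r∈ , u∈ , x≡ = ∈-cartesianProductWith⁻ f ps us x∈ in
          subst (Pow (suc k)) (sym x≡) (power r u r∈ u∈)

      -- V₈ + V₂ lies in V₁₀, and `few-relative` at 10 bounds V₁₀ by κ |V₂|.
      κ : ℕ
      κ = 2 * M * c# 11

      κ>0 : 0 < κ
      κ>0 = *-mono-< {0} {2 * M} {0} {c# 11} (*-mono-< {0} {2} {0} {M} (s≤s z≤n) M>0) (m^n>0 (2 * (M * M)) {{m*n≢0 2 (M * M) {{_}} {{m*n≢0 M M}}}} 11)

      Disjoint : V → V → Set (c ⊔ ℓ)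
      Disjoint x y = ∀ u v → u ∈ ws → v ∈ ws → ¬ (∀ i → x i ⊕ u i ≈ᶠ y i ⊕ v i)

      few-disjoint : ∀ X → AllPairs Disjoint X → All (Tr 8) X → length X ≤ κ
      few-disjoint X ds ts = *-cancelʳ-≤ _ _ w₂ (begin
        length X * w₂ ≡⟨ length-cartesianProductWith f X ws ⟨
        length (cartesianProductWith f X ws) ≤⟨ few-relative 10 _
          (AllPairs-cartesianProductWith f (λ {x} {x′} {u} {u′} u∈ u′∈ dis → dis u u′ u∈ u′∈) (λ {x} {u} {u′} ne e → ne λ i →
             by 1# (e i) (solve 3 (λ x u u′ → u := u′ :+ :1 :* ((x :+ u) :- (x :+ u′))) ≈-refl (x i) (u i) (u′ i))) ds ws-distinct)
          (All.tabulate sums) ⟩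
        κ * w₂ ∎)
        where
        f : V → V → V
        f x u i = x i ⊕ u i
        sums : ∀ {v} → v ∈ cartesianProductWith f X ws → Tr 10 v
        sums v∈ = let x , u , x∈ , u∈ , v≡ = ∈-cartesianProductWith⁻ f X ws v∈ in
          subst (Tr 10) (sym v≡) (Tr-⊕ 8 2 (All.lookup ts x∈) (All.lookup ws-Tr u∈))

      Cover : Set (c ⊔ ℓ)
      Cover = Σ (List V) λ X → length X ≤ κ × (∀ {v} → Tr 8 v → DN (Σ V λ x → x ∈ X × Tr 4 (λ i → v i ⊕ ⊖ x i)))

      -- Ruzsa's covering argument: for a maximal system of disjoint translates x + V₂, any v + V₂
      -- meets one of them, and then v - x lies in V₂ - V₂, inside V₄.
      cover : DN Cover
      cover = do
        X , ds , ts , max ← maximal (Tr 8) Disjoint κ few-disjoint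
        pure (X , few-disjoint X ds ts , λ {v} Tv → do
          x , x∈ , meet ← meeting X v (max v Tv)
          u , u′ , u∈ , u′∈ , e ← meet
          pure (x , x∈ , Tr-resp 4 (λ i → by (⊖ 1#) (e i) (solve 4 (λ v u x u′ → u′ :- u := (v :- x) :+ (:- :1) :* ((v :+ u) :- (x :+ u′))) ≈-refl (v i) (u i) (x i) (u′ i)))
            (Tr-⊕ 2 2 (All.lookup ws-Tr u′∈) (Tr-⊖ 2 (All.lookup ws-Tr u∈)))))
        where
        Meet : V → V → Set (c ⊔ ℓ)
        Meet v x = Σ V λ u → Σ V λ u′ → u ∈ ws × u′ ∈ ws × (∀ i → v i ⊕ u i ≈ᶠ x i ⊕ u′ i)
        meeting : ∀ X v → ¬ All (Disjoint v) X → DN (Σ V λ x → x ∈ X × DN (Meet v x))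
        meeting X v h k = h (All.tabulate λ {x} x∈ u u′ u∈ u′∈ e → k (x , x∈ , pure (u , u′ , u∈ , u′∈ , e)))

      module Concentrated (B : ℕ)
        (conc-scale : ∀ s {xs} → Unique xs → All (λ a → scale (S a) ≈ᶠ s) xs → length xs * B ≤ q)
        (conc-point : ∀ v w {xs} → Unique xs → All (λ a → act (S a) v ≈ᵛ w) xs → length xs * B ≤ q) where

        qB≤2M|as|B : q * B ≤ 2 * M * (length as * B)
        qB≤2M|as|B = ≤-trans (*-monoˡ-≤ B q≤2M|as|) (≤-reflexive (*-assoc (2 * M) (length as) B))

        scale-p : ∀ {a s} → scale (p a) ≈ᶠ s → scale (S a) ≈ᶠ s ⊗ scale (S b₀)
        scale-p {a} {s} e = by (scale (S b₀)) e (by (⊖ scale (S a)) (unit (S b₀))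
          (solve 4 (λ x b b′ s → x := (s :* b :+ b :* (x :* b′ :- s)) :+ (:- x) :* (b :* b′ :- :1)) ≈-refl (scale (S a)) (scale (S b₀)) (scale⁻¹ (S b₀)) s))

        -- A linear part is shared by at most q/B of the quotients `p a`, and there are at least
        -- q/2M of these.
        B≤2Mτ : B ≤ 2 * M * τ
        B≤2Mτ = *-cancelˡ-≤ q {{>-nonZero q>0}} (begin
          q * B ≤⟨ qB≤2M|as|B ⟩
          2 * M * (length as * B) ≤⟨ *-monoʳ-≤ (2 * M) (grouping (finite-Fin q) (λ a r → scale (p a) ≈ᶠ scale r) B q
              (λ r u h → conc-scale (scale r ⊗ scale (S b₀)) u (All.map scale-p h)) ps as-unique (λ {a} a∈ → ps-max (p a) (p-P a∈))) ⟩
          2 * M * (τ * q) ≡⟨ regroup (2 * M) τ q ⟩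
          q * (2 * M * τ) ∎)
          where
          regroup : ∀ a t q → a * (t * q) ≡ q * (a * t)
          regroup = solve-∀

        -- If there are few translations in P⁴, then [r, p′] takes few values as p′ varies, and [r, p′] = u
        -- forces p′ to send the fixed point of r to the fixed point of u⁻¹ r.
        module Commutators (W : List V) (W-max : ∀ {v} → Tr 4 v → DN (Σ V λ w → w ∈ W × v ≈ᵛ w))
          (r : Aff) (Pr : P r) (r≉1 : ¬ scale r ≈ᶠ 1#) where

          δ : F
          δ = proj₁ (inverse (1# ⊕ ⊖ scale r) (λ e → r≉1 (≈-sym (-≈0⇒≈ e))))

          δ-inv : (1# ⊕ ⊖ scale r) ⊗ δ ≈ᶠ 1#
          δ-inv = proj₂ (inverse (1# ⊕ ⊖ scale r) (λ e → r≉1 (≈-sym (-≈0⇒≈ e))))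

          x₀ : V
          x₀ i = δ ⊗ shift r i

          r-fixes : act r x₀ ≈ᵛ x₀
          r-fixes i = by (⊖ shift r i) δ-inv (solve 3 (λ a u d → a :* (d :* u) :+ u := d :* u :+ (:- u) :* ((:1 :- a) :* d :- :1)) ≈-refl (scale r) (shift r i) δ)

          target : V → V
          target u i = δ ⊗ (shift r i ⊕ ⊖ u i)

          -- Evaluating r p′ = u p′ r at the fixed point `x₀` of r gives r(y) = y + u for y =
          -- p′(`x₀`), which can be solved for y as the linear part of r is not 1.
          lands : ∀ {p′ u} → r ∙ p′ ≈ᴳ translation u ∙ (p′ ∙ r) → act p′ x₀ ≈ᵛ target u
          lands {p′} {u} e i = by (⊖ y) δ-inv (by (⊖ δ) (≈-trans (≈-sym (act-∘ r p′ x₀ i)) (≈-trans (act-cong e {x₀} (λ _ → ≈-refl) i)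
              (≈-trans (act-∘ (translation u) (p′ ∙ r) x₀ i) (act-cong {translation u} 𝔾.refl (λ j → ≈-trans (act-∘ p′ r x₀ j) (act-cong {p′} 𝔾.refl r-fixes j)) i))))
            (solve 5 (λ a s d u y → y := (d :* (s :- u) :+ (:- y) :* ((:1 :- a) :* d :- :1)) :+ (:- d) :* ((a :* y :+ s) :- (:1 :* y :+ u)))
              ≈-refl (scale r) (shift r i) δ (u i) y) )
            where
            y = act p′ x₀ i

          B≤2M|W| : B ≤ 2 * M * length W
          B≤2M|W| = *-cancelˡ-≤ q {{>-nonZero q>0}} (begin
            q * B ≤⟨ qB≤2M|as|B ⟩
            2 * M * (length as * B) ≤⟨ *-monoʳ-≤ (2 * M) (grouping (finite-Fin q) (λ a u → act (p a) x₀ ≈ᵛ target u) B q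
                (λ u un h → conc-point (act (S b₀ ⁻¹) x₀) (target u) un (All.map (λ {a} e i → ≈-trans (≈-sym (act-∘ (S a) (S b₀ ⁻¹) x₀ i)) (e i)) h))
                W as-unique located) ⟩
            2 * M * (length W * q) ≡⟨ regroup (2 * M) (length W) q ⟩
            q * (2 * M * length W) ∎)
            where
            regroup : ∀ a t q → a * (t * q) ≡ q * (a * t)
            regroup = solve-∀
            located : ∀ {a} → a ∈ as → DN (Σ V λ u → u ∈ W × act (p a) x₀ ≈ᵛ target u)
            located {a} a∈ = do
              let u , Tu , e = Tr-commutator {r} {p a} Pr (p-P a∈)
              v , v∈ , u≈v ← W-max Tu
              pure (v , v∈ , λ i → ≈-trans (lands {p a} {u} e i) (*-congˡ (+-congˡ (-‿cong (u≈v i)))))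

        -- If all linear parts in P were 1, the at least q/2M quotients `p a` would form a single
        -- class of at most q/B elements.
        nontrivial-scale : 2 * M < B → DN (Σ Aff λ r → P r × ¬ scale r ≈ᶠ 1#)
        nontrivial-scale 2M<B none = <⇒≱ 2M<B (*-cancelˡ-≤ q {{>-nonZero q>0}} (begin
          q * B ≤⟨ qB≤2M|as|B ⟩
          2 * M * (length as * B) ≤⟨ *-monoʳ-≤ (2 * M) (grouping (finite-Fin q) (λ a r → scale (p a) ≈ᶠ scale r) B q
              (λ r u h → conc-scale (scale r ⊗ scale (S b₀)) u (All.map scale-p h)) (idᵃ ∷ []) as-unique
              (λ {a} a∈ k → none (p a , p-P a∈ , λ e → k (idᵃ , here refl , e)))) ⟩
          2 * M * (1 * q) ≡⟨ trans (cong (2 * M *_) (*-identityˡ q)) (*-comm (2 * M) q) ⟩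
          q * (2 * M) ∎))

        ω ω⁴ : ℕ
        ω = q * c# 4
        ω⁴ = ω * ω * (ω * ω)

        module Contradiction (X : List V) (X≤κ : length X ≤ κ)
          (X-cover : ∀ {v} → Tr 8 v → DN (Σ V λ x → x ∈ X × Tr 4 (λ i → v i ⊕ ⊖ x i)))
          (W : List V) (W-≉ : AllPairs (λ u v → ¬ u ≈ᵛ v) W) (W-Tr : All (Tr 4) W)
          (W-max : ∀ {v} → Tr 4 v → DN (Σ V λ w → w ∈ W × v ≈ᵛ w)) where

          module G = GoodScalars K dim (Tr 4)

          covering : G.Covering
          covering = record
            { H-resp = Tr-resp 4 ; H-neg = Tr-⊖ 4 ; X = X ; κ = κ ; κ>0 = κ>0 ; X≤κ = X≤κ
            ; H-+ = λ Hv Hw → X-cover (Tr-⊕ 4 4 Hv Hw)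
            ; W = W ; W-≉ = W-≉ ; W-H = W-Tr ; W-max = W-max }

          open G.Closure covering using (Good; pivoting)

          scales : List F
          scales = map scale ps

          scales-good : All (λ t → Good t κ) scales
          scales-good = All.map⁺ (All.map (λ {r} Pr → X , X≤κ , λ v Tv → X-cover {λ i → scale r ⊗ v i} (Pow-+ 2 6 (Tr-scale 4 {r} {v} Pr Tv))) ps-P)

          -- If V₄ has more than κ^(13^J) elements, there are at least B/2M good scalars to start
          -- from, and J squarings would lift them above |V₄|⁴. Otherwise commutators take too few
          -- values for B.
          contradiction : ∀ J → 2 * M * κ ^ (13 ^ J) < B → ω⁴ * (2 * M) ^ (2 ^ J) < B ^ (2 ^ J) →
            (∀ p → HasCharacteristic p → ω⁴ * ω⁴ * (ω⁴ * ω⁴) < p) → ⊥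
          contradiction J large larger char = by-size (κ ^ (13 ^ J) <? length W)
            where
            w≤ω : length W ≤ ω
            w≤ω = few-translations 4 W W-≉ W-Tr
            w⁴≤ω⁴ : length W * length W * (length W * length W) ≤ ω⁴
            w⁴≤ω⁴ = *-mono-≤ (*-mono-≤ w≤ω w≤ω) (*-mono-≤ w≤ω w≤ω)
            2M≤ : 2 * M ≤ 2 * M * κ ^ (13 ^ J)
            2M≤ = m≤m*n (2 * M) (κ ^ (13 ^ J)) {{m^n≢0 κ (13 ^ J) {{>-nonZero κ>0}}}}
            2≤τ : 2 ≤ τ
            2≤τ = ≰⇒> λ τ≤1 → <⇒≱ (≤-<-trans 2M≤ large) (≤-trans B≤2Mτ (≤-trans (*-monoʳ-≤ (2 * M) τ≤1) (≤-reflexive (*-identityʳ (2 * M)))))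
            ω⁴<τ : ω⁴ < τ ^ (2 ^ J)
            ω⁴<τ = *-cancelʳ-< ((2 * M) ^ (2 ^ J)) ω⁴ (τ ^ (2 ^ J)) (<-≤-trans larger (≤-trans (^-monoˡ-≤ (2 ^ J) B≤2Mτ)
              (≤-reflexive (trans (^-distribʳ-* (2 ^ J) (2 * M) τ) (*-comm ((2 * M) ^ (2 ^ J)) _)))))
            by-size : Dec (κ ^ (13 ^ J) < length W) → ⊥
            by-size (yes κ<w) = pivoting J scales (AllPairs.map⁺ ps-distinct) scales-good ≤-refl
              (subst (2 ≤_) (sym (length-map scale ps)) 2≤τ) κ<w
              (≤-<-trans w⁴≤ω⁴ (subst (λ t → ω⁴ < t ^ (2 ^ J)) (sym (length-map scale ps)) ω⁴<τ))
              (λ p h → ≤-<-trans (*-mono-≤ (*-mono-≤ w⁴≤ω⁴ w⁴≤ω⁴) (*-mono-≤ w⁴≤ω⁴ w⁴≤ω⁴)) (char p h))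
            by-size (no κ≮w) = nontrivial-scale (≤-<-trans 2M≤ large) λ (r , Pr , r≉1) →
              <⇒≱ large (≤-trans (Commutators.B≤2M|W| W W-max r Pr r≉1) (*-monoʳ-≤ (2 * M) (≮⇒≥ κ≮w)))

    maximal-scales : DN (Σ (List Aff) λ ps → AllPairs (λ p r → ¬ scale p ≈ᶠ scale r) ps × All P ps ×
                          (∀ p → P p → DN (Σ Aff λ r → r ∈ ps × scale p ≈ᶠ scale r)))
    maximal-scales = do
      ps , ds , Ps , max ← maximal P (λ p r → ¬ scale p ≈ᶠ scale r) (q * c# 1)
        (λ ps ds Ps → few-powers 1 ps (AllPairs.map (λ ne e → ne (scale≈ e)) ds) (All.map Pow-one Ps))
      pure (ps , ds , Ps , λ p Pp → ¬All⇒DNAny ps (max p Pp))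

    not-spread : ∀ B J →
      (∀ s {xs} → Unique xs → All (λ a → scale (S a) ≈ᶠ s) xs → length xs * B ≤ q) →
      (∀ v w {xs} → Unique xs → All (λ a → act (S a) v ≈ᵛ w) xs → length xs * B ≤ q) →
      let ω  = q * c# 4
          ω⁴ = ω * ω * (ω * ω)
      in 2 * M * (2 * M * c# 11) ^ (13 ^ J) < B → ω⁴ * (2 * M) ^ (2 ^ J) < B ^ (2 ^ J) →
         (∀ p → HasCharacteristic p → ω⁴ * ω⁴ * (ω⁴ * ω⁴) < p) → ⊥
    not-spread B J conc-scale conc-point large larger char =
      many-popular λ (b₀ , as , as-unique , as-popular , q≤) →
      maximal-scales λ (ps , ps-distinct , ps-P , ps-max) →
      maximal-translations 2 λ (ws , ws-distinct , ws-Tr , ws-max) →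
      maximal-translations 4 λ (W , W-≉ , W-Tr , W-max) →
      let module C = Chosen b₀ as as-unique as-popular q≤ ps ps-distinct ps-P ps-max ws ws-distinct ws-Tr ws-max in
      C.cover λ (X , X≤κ , X-cover) →
      C.Concentrated.Contradiction.contradiction B conc-scale conc-point X X≤κ X-cover W W-≉ W-Tr W-max J large larger char

-- Rich families of affine maps

module Flattening {c ℓ} (K : Field c ℓ) (dim : ℕ) where
  open Affine K dim
  module 𝔾 = Group affineGroup
  open 𝔾 using () renaming (_≈_ to _≈ᴳ_)

  Injectiveᵛ : ∀ {n} → (Fin n → V) → Set ℓ
  Injectiveᵛ A = ∀ a b → A a ≈ᵛ A b → a ≡ b

  module Family {I : Set} (fin : Finite I) (g : I → Aff) where
    is : List I
    is = proj₁ fin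

    m : ℕ
    m = length is

    Incidence : ∀ {n} → (Fin n → V) → (Fin n → V) → I → Fin n → Fin n → Set ℓ
    Incidence A B i a b = act (g i) (A a) ≈ᵛ B b

    energy : (∀ i j → Dec (g i ≈ᴳ g j)) → ℕ
    energy _~?_ = ∑ is (λ i → ∑ is (λ j → 𝟙 (i ~? j)))

    -- Indices are counted with multiplicity. Decision procedures are arguments because the sums
    -- need them and equality in the field is undecided.
    Spread : ℕ → Set (c ⊔ ℓ)
    Spread B = (∀ s (d : ∀ i → Dec (scale (g i) ≈ᶠ s)) → ∑ is (𝟙 ∘ d) * B ≤ m) ×
               (∀ v w (d : ∀ i → Dec (act (g i) v ≈ᵛ w)) → ∑ is (𝟙 ∘ d) * B ≤ m)

    module Incidences {n} (A B : Fin n → V) (A-inj : Injectiveᵛ A) (B-inj : Injectiveᵛ B)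
      (c? : ∀ i a b → Dec (Incidence A B i a b)) where
      open ≤-Reasoning

      ns : List (Fin n)
      ns = allFin n

      incidences : ℕ
      incidences = ∑ is (λ i → ∑ ns (λ a → ∑ ns (λ b → 𝟙 (c? i a b))))

      ∑b≤1 : ∀ i a → ∑ ns (λ b → 𝟙 (c? i a b)) ≤ 1
      ∑b≤1 i a = ∑𝟙≤1 (c? i a) (λ {b} {b′} ne e e′ → ne (B-inj b b′ (λ j → ≈-trans (≈-sym (e j)) (e′ j)))) (Unique.allFin⁺ n)

      act-injective : ∀ h {v w} → act h v ≈ᵛ act h w → v ≈ᵛ w
      act-injective h {v} {w} e i = ≈-trans (≈-sym (act-inv h v i)) (≈-trans (act-cong {invᵃ h} 𝔾.refl e i) (act-inv h w i))

      two-points : ∀ {x y v v′ w w′} → ¬ v ≈ᵛ v′ → act x v ≈ᵛ w → act x v′ ≈ᵛ w′ → act y v ≈ᵛ w → act y v′ ≈ᵛ w′ → DN (x ≈ᴳ y)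
      two-points {x} {y} {v} {v′} {w} {w′} v≉v′ xv xv′ yv yv′ k = dec (scale x ≈ᶠ scale y) λ where
        (yes e) → k (e ,ᵃ λ i → by 1# (≈-trans (xv i) (≈-sym (yv i))) (by (⊖ v i) e
          (solve 5 (λ a b s t v → s := (t :+ :1 :* ((a :* v :+ s) :- (b :* v :+ t))) :+ (:- v) :* (a :- b)) ≈-refl (scale x) (scale y) (shift x i) (shift y i) (v i))))
        (no ne) → v≉v′ λ i → -≈0⇒≈ (nonzero-cancel (ne ∘ -≈0⇒≈)
          (by 1# (≈-trans (xv i) (≈-sym (yv i))) (by (⊖ 1#) (≈-trans (xv′ i) (≈-sym (yv′ i)))
            (solve 6 (λ a b s t v v′ → (a :- b) :* (v :- v′) := (:0 :+ :1 :* ((a :* v :+ s) :- (b :* v :+ t))) :+ (:- :1) :* ((a :* v′ :+ s) :- (b :* v′ :+ t))) ≈-refl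
              (scale x) (scale y) (shift x i) (shift y i) (v i) (v′ i)))))

      module Energy (_~?_ : ∀ i j → Dec (g i ≈ᴳ g j)) where
        pairs : List (Fin n × Fin n)
        pairs = cartesianProduct ns ns

        f : I → Fin n × Fin n → ℕ
        f i (a , b) = 𝟙 (c? i a b)

        N : I → ℕ
        N i = ∑ pairs (f i)

        N≡ : ∀ i → N i ≡ ∑ ns (λ a → ∑ ns (λ b → 𝟙 (c? i a b)))
        N≡ i = ∑-cartesianProduct ns ns (f i)

        N≤n : ∀ i → N i ≤ n
        N≤n i = begin
          N i ≡⟨ N≡ i ⟩
          ∑ ns (λ a → ∑ ns (λ b → 𝟙 (c? i a b))) ≤⟨ ∑-≤const ns 1 (λ {a} _ → ∑b≤1 i a) ⟩
          length ns * 1 ≡⟨ trans (*-identityʳ _) (length-allFin n) ⟩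
          n ∎

        ne? : ∀ (θ : (Fin n × Fin n) × (Fin n × Fin n)) → Dec (proj₁ (proj₁ θ) ≢ proj₁ (proj₂ θ))
        ne? (p , p′) = ¬? (proj₁ p Fin.≟ proj₁ p′)

        quads : List ((Fin n × Fin n) × (Fin n × Fin n))
        quads = cartesianProduct pairs pairs

        h : I → (Fin n × Fin n) × (Fin n × Fin n) → ℕ
        h i (p , p′) = f i p * f i p′

        x : (Fin n × Fin n) × (Fin n × Fin n) → ℕ
        x θ = ∑ is (λ i → 𝟙 (ne? θ) * h i θ)

        X : ℕ
        X = ∑ quads x

        ∑h : ∀ i → ∑ quads (h i) ≡ N i * N i
        ∑h i = trans (∑-cartesianProduct pairs pairs (h i)) (∑-∑-* pairs pairs (f i) (f i))

        -- Pairs of incidences with the same first point contribute at most N i, because a map and a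
        -- determine b.
        N²≤ : ∀ i → N i * N i ≤ ∑ quads (λ θ → 𝟙 (ne? θ) * h i θ) + N i
        N²≤ i = begin
          N i * N i ≡⟨ ∑h i ⟨
          ∑ quads (h i) ≤⟨ ∑-mono quads (λ θ → 𝟙-cover (ne? θ) (h i θ)) ⟩
          ∑ quads (λ θ → 𝟙 (ne? θ) * h i θ + 𝟙 (¬? (ne? θ)) * h i θ) ≡⟨ ∑-+ quads _ _ ⟩
          ∑ quads (λ θ → 𝟙 (ne? θ) * h i θ) + ∑ quads (λ θ → 𝟙 (¬? (ne? θ)) * h i θ) ≤⟨ +-monoʳ-≤ _ diagonal ⟩
          ∑ quads (λ θ → 𝟙 (ne? θ) * h i θ) + N i ∎
          where
          row : ∀ p p′ → 𝟙 (¬? (ne? (p , p′))) * h i (p , p′) ≤ f i p * 𝟙 ((proj₁ p Fin.≟ proj₁ p′) ×-dec (proj₂ p Fin.≟ proj₂ p′))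
          row p@(a , b) p′@(a′ , b′) = collapse (a Fin.≟ a′) (b Fin.≟ b′) (c? i a b) (c? i a′ b′) same
            where
            same : a ≡ a′ → Incidence A B i a b → Incidence A B i a′ b′ → b ≡ b′
            same refl e e′ = B-inj b b′ (λ j → ≈-trans (≈-sym (e j)) (e′ j))
            collapse : ∀ {p q r s} {P : Set p} {Q : Set q} {R : Set r} {S : Set s} (a : Dec P) (b : Dec Q) (d : Dec R) (e : Dec S) →
                       (P → R → S → Q) → 𝟙 (¬? (¬? a)) * (𝟙 d * 𝟙 e) ≤ 𝟙 d * 𝟙 (a ×-dec b)
            collapse (no _)  b       d       e       h = z≤n
            collapse (yes p) b       (no _)  e       h = z≤n
            collapse (yes p) b       (yes r) (no _)  h = z≤n
            collapse (yes p) (yes _) (yes r) (yes s) h = ≤-refl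
            collapse (yes p) (no ¬q) (yes r) (yes s) h = ⊥-elim (¬q (h p r s))
          diagonal : ∑ quads (λ θ → 𝟙 (¬? (ne? θ)) * h i θ) ≤ N i
          diagonal = begin
            ∑ quads (λ θ → 𝟙 (¬? (ne? θ)) * h i θ) ≡⟨ ∑-cartesianProduct pairs pairs _ ⟩
            ∑ pairs (λ p → ∑ pairs (λ p′ → 𝟙 (¬? (ne? (p , p′))) * h i (p , p′))) ≤⟨ ∑-mono pairs (λ p → ∑-mono pairs (row p)) ⟩
            ∑ pairs (λ p → ∑ pairs (λ p′ → f i p * 𝟙 ((proj₁ p Fin.≟ proj₁ p′) ×-dec (proj₂ p Fin.≟ proj₂ p′)))) ≡⟨ ∑-cong pairs (λ p → ∑-*ˡ pairs (f i p) _) ⟩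
            ∑ pairs (λ p → f i p * ∑ pairs (λ p′ → 𝟙 ((proj₁ p Fin.≟ proj₁ p′) ×-dec (proj₂ p Fin.≟ proj₂ p′)))) ≤⟨ ∑-mono pairs (λ p → *-monoʳ-≤ (f i p) (∑𝟙≤1
                (λ p′ → (proj₁ p Fin.≟ proj₁ p′) ×-dec (proj₂ p Fin.≟ proj₂ p′)) (λ ne (e₁ , e₂) (e₁′ , e₂′) → ne (cong₂ _,_ (trans (sym e₁) e₁′) (trans (sym e₂) e₂′)))
                (Unique.cartesianProduct⁺ (Unique.allFin⁺ n) (Unique.allFin⁺ n)))) ⟩
            ∑ pairs (λ p → f i p * 1) ≡⟨ ∑-cong pairs (λ p → *-identityʳ (f i p)) ⟩
            N i ∎

        -- Maps that agree at two distinct points are equal by `two-points`. So x² counts pairs of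
        -- equal maps together with two incidences, and a map has at most n incidences.
        ∑x²≤ : ∑ quads (λ θ → x θ * x θ) ≤ energy _~?_ * (n * n)
        ∑x²≤ = begin
          ∑ quads (λ θ → x θ * x θ) ≡⟨ ∑-cong quads (λ θ → sym (∑-∑-* is is _ _)) ⟩
          ∑ quads (λ θ → ∑ is (λ i → ∑ is (λ j → (𝟙 (ne? θ) * h i θ) * (𝟙 (ne? θ) * h j θ)))) ≤⟨ ∑-mono quads (λ θ → ∑-mono is λ i → ∑-mono is λ j → same i j θ) ⟩
          ∑ quads (λ θ → ∑ is (λ i → ∑ is (λ j → 𝟙 (i ~? j) * h i θ))) ≡⟨ trans (∑-swap quads is _) (∑-cong is λ i → ∑-swap quads is _) ⟩
          ∑ is (λ i → ∑ is (λ j → ∑ quads (λ θ → 𝟙 (i ~? j) * h i θ))) ≡⟨ ∑-cong is (λ i → ∑-cong is λ j → trans (∑-*ˡ quads (𝟙 (i ~? j)) (h i)) (cong (𝟙 (i ~? j) *_) (∑h i))) ⟩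
          ∑ is (λ i → ∑ is (λ j → 𝟙 (i ~? j) * (N i * N i))) ≤⟨ ∑-mono is (λ i → ∑-mono is λ j → *-monoʳ-≤ (𝟙 (i ~? j)) (*-mono-≤ (N≤n i) (N≤n i))) ⟩
          ∑ is (λ i → ∑ is (λ j → 𝟙 (i ~? j) * (n * n))) ≡⟨ trans (∑-cong is λ i → ∑-*ʳ is _ (n * n)) (∑-*ʳ is _ (n * n)) ⟩
          energy _~?_ * (n * n) ∎
          where
          bools : ∀ {p q r s t u} {P : Set p} {Q : Set q} {R : Set r} {S : Set s} {T : Set t} {U : Set u}
            (dp : Dec P) (dq : Dec Q) (dr : Dec R) (ds : Dec S) (dt : Dec T) (du : Dec U) → (P → Q → R → S → T → DN U) →
            (𝟙 dp * (𝟙 dq * 𝟙 dr)) * (𝟙 dp * (𝟙 ds * 𝟙 dt)) ≤ 𝟙 du * (𝟙 dq * 𝟙 dr)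
          bools (no _)  dq dr ds dt du k = z≤n
          bools (yes p) (no _)  dr ds dt du k = z≤n
          bools (yes p) (yes q) (no _) ds dt du k = z≤n
          bools (yes p) (yes q) (yes r) (no _) dt du k = z≤n
          bools (yes p) (yes q) (yes r) (yes s) (no _) du k = z≤n
          bools (yes p) (yes q) (yes r) (yes s) (yes t) (yes u) k = ≤-refl
          bools (yes p) (yes q) (yes r) (yes s) (yes t) (no ¬u) k = ⊥-elim (k p q r s t ¬u)
          same : ∀ i j θ → (𝟙 (ne? θ) * h i θ) * (𝟙 (ne? θ) * h j θ) ≤ 𝟙 (i ~? j) * h i θ
          same i j θ@((a , b) , (a′ , b′)) = bools (ne? θ) (c? i a b) (c? i a′ b′) (c? j a b) (c? j a′ b′) (i ~? j)
            (λ a≢a′ e₁ e₂ e₃ e₄ → two-points {g i} {g j} (λ e → a≢a′ (A-inj a a′ e)) e₁ e₂ e₃ e₄)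

        -- `x` counts the maps with prescribed values at two distinct points. Richness gives Σ x ≥
        -- mn²/2z², Cauchy-Schwarz over n⁴ cells turns this into a lower bound for Σ x², and `∑x²≤`
        -- is the upper bound. Thus m²/E ≤ 4z⁴n²; the assumption 2z² ≤ n disposes of the diagonal.
        rich⇒energy : ∀ z → m * n ≤ z * incidences → 2 * (z * z) ≤ n → .{{NonZero m}} → .{{NonZero n}} → m * m ≤ 4 * (z * z * (z * z)) * (n * n) * energy _~?_
        rich⇒energy z rich 2z²≤n = *-cancelʳ-≤ _ _ (n * n * (n * n)) {{m*n≢0 _ _ {{m*n≢0 n n}} {{m*n≢0 n n}}}} (begin
          m * m * (n * n * (n * n)) ≡⟨ regroup₁ m n ⟩
          (m * (n * n)) * (m * (n * n)) ≤⟨ *-mono-≤ mn²≤2z²X mn²≤2z²X ⟩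
          2 * (z * z) * X * (2 * (z * z) * X) ≡⟨ regroup₂ z X ⟩
          4 * (z * z * (z * z)) * (X * X) ≤⟨ *-monoʳ-≤ (4 * (z * z * (z * z))) (cauchy-schwarz quads x) ⟩
          4 * (z * z * (z * z)) * (length quads * ∑ quads (λ θ → x θ * x θ)) ≤⟨ *-monoʳ-≤ (4 * (z * z * (z * z))) (*-mono-≤ (≤-reflexive length-quads) ∑x²≤) ⟩
          4 * (z * z * (z * z)) * (n * n * (n * n) * (energy _~?_ * (n * n))) ≡⟨ regroup₃ (4 * (z * z * (z * z))) n (energy _~?_) ⟩
          4 * (z * z * (z * z)) * (n * n) * energy _~?_ * (n * n * (n * n)) ∎)
          where
          regroup₁ : ∀ m n → m * m * (n * n * (n * n)) ≡ (m * (n * n)) * (m * (n * n))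
          regroup₁ = solve-∀
          regroup₂ : ∀ z X → 2 * (z * z) * X * (2 * (z * z) * X) ≡ 4 * (z * z * (z * z)) * (X * X)
          regroup₂ = solve-∀
          regroup₃ : ∀ c n E → c * (n * n * (n * n) * (E * (n * n))) ≡ c * (n * n) * E * (n * n * (n * n))
          regroup₃ = solve-∀
          length-quads : length quads ≡ n * n * (n * n)
          length-quads = trans (length-cartesianProduct pairs pairs) (cong₂ _*_ lp lp)
            where lp = trans (length-cartesianProduct ns ns) (cong₂ _*_ (length-allFin n) (length-allFin n))
          ∑N : ∑ is N ≡ incidences
          ∑N = ∑-cong is N≡
          ∑N≤mn : ∑ is N ≤ m * n
          ∑N≤mn = ∑-≤const is n (λ {i} _ → N≤n i)
          mn²≤z²∑N² : m * (n * n) ≤ z * z * ∑ is (λ i → N i * N i)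
          mn²≤z²∑N² = *-cancelˡ-≤ m (begin
            m * (m * (n * n)) ≡⟨ r₁ m n ⟩
            m * n * (m * n) ≤⟨ *-mono-≤ rich rich ⟩
            z * incidences * (z * incidences) ≡⟨ r₂ z incidences ⟩
            z * z * (incidences * incidences) ≡⟨ cong (λ s → z * z * (s * s)) ∑N ⟨
            z * z * (∑ is N * ∑ is N) ≤⟨ *-monoʳ-≤ (z * z) (cauchy-schwarz is N) ⟩
            z * z * (m * ∑ is (λ i → N i * N i)) ≡⟨ r₃ (z * z) m (∑ is (λ i → N i * N i)) ⟩
            m * (z * z * ∑ is (λ i → N i * N i)) ∎)
            where
            r₁ : ∀ m n → m * (m * (n * n)) ≡ m * n * (m * n)
            r₁ = solve-∀
            r₂ : ∀ z s → z * s * (z * s) ≡ z * z * (s * s)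
            r₂ = solve-∀
            r₃ : ∀ a b c → a * (b * c) ≡ b * (a * c)
            r₃ = solve-∀
          ∑N²≤ : ∑ is (λ i → N i * N i) ≤ X + m * n
          ∑N²≤ = begin
            ∑ is (λ i → N i * N i) ≤⟨ ∑-mono is N²≤ ⟩
            ∑ is (λ i → ∑ quads (λ θ → 𝟙 (ne? θ) * h i θ) + N i) ≡⟨ trans (∑-+ is _ _) (cong (_+ ∑ is N) (∑-swap is quads _)) ⟩
            X + ∑ is N ≤⟨ +-monoʳ-≤ X ∑N≤mn ⟩
            X + m * n ∎
          mn²≤2z²X : m * (n * n) ≤ 2 * (z * z) * X
          mn²≤2z²X = +-cancelʳ-≤ (m * (n * n)) _ _ (begin
            m * (n * n) + m * (n * n) ≤⟨ +-mono-≤ step step ⟩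
            z * z * (X + m * n) + z * z * (X + m * n) ≡⟨ r₁ (z * z) X (m * n) ⟩
            2 * (z * z) * X + 2 * (z * z) * (m * n) ≤⟨ +-monoʳ-≤ (2 * (z * z) * X) (*-monoˡ-≤ (m * n) 2z²≤n) ⟩
            2 * (z * z) * X + n * (m * n) ≡⟨ cong (2 * (z * z) * X +_) (r₂ n m) ⟩
            2 * (z * z) * X + m * (n * n) ∎)
            where
            step = ≤-trans mn²≤z²∑N² (*-monoʳ-≤ (z * z) ∑N²≤)
            r₁ : ∀ z X y → z * (X + y) + z * (X + y) ≡ 2 * z * X + 2 * z * y
            r₁ = solve-∀
            r₂ : ∀ n m → n * (m * n) ≡ m * (n * n)
            r₂ = solve-∀

-- Passing from a family to its quotients

∑𝟙≤𝟙 : ∀ {a p q r} {A : Set a} {R : A → A → Set r} {P : A → Set p} {Q : Set q} (P? : ∀ x → Dec (P x)) (Q? : Dec Q) →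
       (∀ {x y} → R x y → P x → P y → ⊥) → (∀ {x} → P x → Q) → ∀ {xs} → AllPairs R xs → ∑ xs (𝟙 ∘ P?) ≤ 𝟙 Q?
∑𝟙≤𝟙 P? Q? excl impl {xs} ds = ∑-zero-or-∃ xs (𝟙 ∘ P?) (_≤ 𝟙 Q?) z≤n λ x _ lt →
  ≤-trans (∑𝟙≤1 P? excl ds) (≤-reflexive (sym (𝟙-yes Q? (impl (𝟙>0 (P? x) lt)))))

module Exponents {L : ℕ} (2≤L : 2 ≤ L) where
  _≼ᴸ_ : ℕ → ℕ → Set
  _≼ᴸ_ = _≼_ 2≤L

  ≼-^ : ∀ {x a} k → x ≼ᴸ a → (x ^ k) ≼ᴸ (a * k)
  ≼-^ {x} {a} k (wrap h) = wrap (≤-trans (^-monoˡ-≤ k h) (≤-reflexive (^-*-assoc L a k)))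

  M : ℕ
  M = L ^ 55

  2M≼ : (2 * M) ≼ᴸ 56
  2M≼ = _⊛_ 2≤L {a = 1} {b = 55} (numeral 2≤L 2 1 ≤-refl) (wrap ≤-refl)

  c#≼ : ∀ k → ((2 * (M * M)) ^ k) ≼ᴸ (111 * k)
  c#≼ k = ≼-^ k (_⊛_ 2≤L {a = 1} {b = 110} (numeral 2≤L 2 1 ≤-refl) (_⊛_ 2≤L {a = 55} {b = 55} (wrap ≤-refl) (wrap ≤-refl)))

  -- The covering constant for M = L^55: 2M costs 56 and 2M² costs 111, so the exponent is 56 + 11 ·
  -- 111.
  κ≼ : (2 * M * (2 * (M * M)) ^ 11) ≼ᴸ 1277
  κ≼ = _⊛_ 2≤L {a = 56} {b = 1221} 2M≼ (c#≼ 11)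

  large≼ : ∀ J → (2 * M * (2 * M * (2 * (M * M)) ^ 11) ^ (13 ^ J)) ≼ᴸ (56 + 1277 * 13 ^ J)
  large≼ J = _⊛_ 2≤L {a = 56} 2M≼ (≼-^ (13 ^ J) κ≼)

module Iteration {c ℓ} (K : Field c ℓ) (dim : ℕ) where
  open Affine K dim
  open Proj K using (HasCharacteristic)
  module 𝔾 = Group affineGroup
  open 𝔾 using (_∙_; _⁻¹) renaming (_≈_ to _≈ᴳ_)
  open Popularity affineGroup using (swap-quotient; unswap-quotient; smallSet)
  open ApproximateGroup K dim using (module Translations)
  open Flattening K dim hiding (module 𝔾)

  module Quotients {I : Set} (fin : Finite I) (g : I → Aff) where
    module Fm = Family fin g
    open Fm using (is; m; energy; Spread)
    open ≤-Reasoning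

    fin′ : Finite (I × I)
    fin′ = fin ×-finite fin

    g′ : I × I → Aff
    g′ (i , j) = g i ∙ g j ⁻¹

    module F′ = Family fin′ g′

    m′≡m² : F′.m ≡ m * m
    m′≡m² = length-cartesianProduct is is

    act-g′ : ∀ i j v → act (g′ (i , j)) (act (g j) v) ≈ᵛ act (g i) v
    act-g′ i j v k = ≈-trans (act-∘ (g i) (g j ⁻¹) (act (g j) v) k) (act-cong {g i} 𝔾.refl (act-inv (g j) v) k)

    -- If g i and g j send the same point a to b′ and b, then g i g j⁻¹ sends b to b′, and a is
    -- determined by i and b′. Cauchy-Schwarz runs over the n points a, so that the quotients act on
    -- B alone.
    next-incidences : ∀ {n} (A B : Fin n → V) (A-inj : Injectiveᵛ A) (B-inj : Injectiveᵛ B)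
      (c? : ∀ i a b → Dec (Fm.Incidence A B i a b)) (c?′ : ∀ i a b → Dec (F′.Incidence B B i a b)) →
      let N = Fm.Incidences.incidences A B A-inj B-inj c? in
      N * N ≤ n * F′.Incidences.incidences B B B-inj B-inj c?′
    next-incidences {n} A B A-inj B-inj c? c?′ = begin
      N * N ≡⟨ cong₂ _*_ N≡ N≡ ⟩
      ∑ ns R * ∑ ns R ≤⟨ cauchy-schwarz ns R ⟩
      length ns * ∑ ns (λ a → R a * R a) ≡⟨ cong₂ _*_ (length-allFin n) (∑-cong ns λ a → sym (∑-∑-* IB IB (f a) (f a))) ⟩
      n * ∑ ns (λ a → ∑ IB (λ p → ∑ IB (λ p′ → f a p * f a p′))) ≡⟨ cong (n *_) (trans (∑-swap ns IB _) (∑-cong IB λ p → ∑-swap ns IB _)) ⟩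
      n * ∑ IB (λ p → ∑ IB (λ p′ → ∑ ns (λ a → f a p * f a p′))) ≤⟨ *-monoʳ-≤ n (∑-mono IB λ p → ∑-mono IB λ p′ → meet p p′) ⟩
      n * ∑ IB (λ p → ∑ IB (λ p′ → h p p′)) ≡⟨ cong (n *_) rearrange ⟩
      n * F′.Incidences.incidences B B B-inj B-inj c?′ ∎
      where
      N = Fm.Incidences.incidences A B A-inj B-inj c?
      ns = allFin n
      IB = cartesianProduct is ns
      f : Fin n → I × Fin n → ℕ
      f a (i , b) = 𝟙 (c? i a b)
      R : Fin n → ℕ
      R a = ∑ IB (f a)
      N≡ : N ≡ ∑ ns R
      N≡ = trans (∑-swap is ns _) (∑-cong ns λ a → sym (∑-cartesianProduct is ns (f a)))
      h : I × Fin n → I × Fin n → ℕ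
      h (i , b′) (j , b) = 𝟙 (c?′ (i , j) b b′)
      meet : ∀ p p′ → ∑ ns (λ a → f a p * f a p′) ≤ h p p′
      meet (i , b′) (j , b) = begin
        ∑ ns (λ a → 𝟙 (c? i a b′) * 𝟙 (c? j a b)) ≡⟨ ∑-cong ns (λ a → sym (𝟙-× (c? i a b′) (c? j a b))) ⟩
        ∑ ns (λ a → 𝟙 (c? i a b′ ×-dec c? j a b)) ≤⟨ ∑𝟙≤𝟙 (λ a → c? i a b′ ×-dec c? j a b) (c?′ (i , j) b b′)
            (λ {a} {a′} ne (e , _) (e′ , _) → ne (A-inj a a′ (act-injective (g i) (λ k → ≈-trans (e k) (≈-sym (e′ k))))))
            (λ {a} (e , e′) k → ≈-trans (act-cong {g′ (i , j)} 𝔾.refl (λ l → ≈-sym (e′ l)) k) (≈-trans (act-g′ i j (A a) k) (e k)))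
            (Unique.allFin⁺ n) ⟩
        𝟙 (c?′ (i , j) b b′) ∎
        where open Fm.Incidences A B A-inj B-inj c? using (act-injective)
      rearrange : ∑ IB (λ p → ∑ IB (λ p′ → h p p′)) ≡ F′.Incidences.incidences B B B-inj B-inj c?′
      rearrange = begin-equality
        ∑ IB (λ p → ∑ IB (λ p′ → h p p′)) ≡⟨ trans (∑-cartesianProduct is ns _) (∑-cong is λ i → ∑-cong ns λ b′ → ∑-cartesianProduct is ns _) ⟩
        ∑ is (λ i → ∑ ns (λ b′ → ∑ is (λ j → ∑ ns (λ b → 𝟙 (c?′ (i , j) b b′))))) ≡⟨ ∑-cong is (λ i → ∑-swap ns is _) ⟩
        ∑ is (λ i → ∑ is (λ j → ∑ ns (λ b′ → ∑ ns (λ b → 𝟙 (c?′ (i , j) b b′))))) ≡⟨ ∑-cong is (λ i → ∑-cong is λ j → ∑-swap ns ns _) ⟩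
        ∑ is (λ i → ∑ is (λ j → ∑ ns (λ b → ∑ ns (λ b′ → 𝟙 (c?′ (i , j) b b′))))) ≡⟨ ∑-cartesianProduct is is _ ⟨
        F′.Incidences.incidences B B B-inj B-inj c?′ ∎

    column-bound : ∀ {p} (C : I × I → Set p) (d : ∀ z → Dec (C z)) B →
                   (∀ j → ∑ is (λ i → 𝟙 (d (i , j))) * B ≤ m) → ∑ (proj₁ fin′) (𝟙 ∘ d) * B ≤ F′.m
    column-bound C d B h = begin
      ∑ (proj₁ fin′) (𝟙 ∘ d) * B ≡⟨ cong (_* B) (trans (∑-cartesianProduct is is _) (∑-swap is is _)) ⟩
      ∑ is (λ j → ∑ is (λ i → 𝟙 (d (i , j)))) * B ≡⟨ ∑-*ʳ is _ B ⟨
      ∑ is (λ j → ∑ is (λ i → 𝟙 (d (i , j))) * B) ≤⟨ ∑-≤const is m (λ {j} _ → h j) ⟩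
      m * m ≡⟨ m′≡m² ⟨
      F′.m ∎

    -- For a fixed denominator g j, both conditions on g i g j⁻¹ are conditions of the same kind on
    -- g i. So the bound holds in each column, without loss.
    next-spread : ∀ B → Spread B → F′.Spread B
    next-spread B (sc , pt) =
        (λ s d → column-bound (λ z → scale (g′ z) ≈ᶠ s) d B λ j → ≤-trans
          (*-monoˡ-≤ B (∑-mono is λ i → 𝟙-mono (d (i , j)) (scale? s d j i) (to s i j)))
          (sc (s ⊗ scale (g j)) (scale? s d j)))
      , (λ v w d → column-bound (λ z → act (g′ z) v ≈ᵛ w) d B λ j → ≤-trans
          (*-monoˡ-≤ B (∑-mono is λ i → 𝟙-mono (d (i , j)) (act? v w d j i) (λ e k → ≈-trans (≈-sym (act-∘ (g i) (g j ⁻¹) v k)) (e k))))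
          (pt (act (g j ⁻¹) v) w (act? v w d j)))
      where
      to : ∀ s i j → scale (g′ (i , j)) ≈ᶠ s → scale (g i) ≈ᶠ s ⊗ scale (g j)
      to s i j e = by (scale (g j)) e (by (⊖ scale (g i)) (unit (g j))
        (solve 4 (λ x b b′ s → x := (s :* b :+ b :* (x :* b′ :- s)) :+ (:- x) :* (b :* b′ :- :1)) ≈-refl (scale (g i)) (scale (g j)) (scale⁻¹ (g j)) s))
      from : ∀ s i j → scale (g i) ≈ᶠ s ⊗ scale (g j) → scale (g′ (i , j)) ≈ᶠ s
      from s i j e = by (scale⁻¹ (g j)) e (by s (unit (g j))
        (solve 4 (λ x b b′ s → x :* b′ := (s :+ b′ :* (x :- s :* b)) :+ s :* (b :* b′ :- :1)) ≈-refl (scale (g i)) (scale (g j)) (scale⁻¹ (g j)) s))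
      scale? : ∀ s → (∀ z → Dec (scale (g′ z) ≈ᶠ s)) → ∀ j i → Dec (scale (g i) ≈ᶠ s ⊗ scale (g j))
      scale? s d j i = Dec.map′ (to s i j) (from s i j) (d (i , j))
      act? : ∀ v w → (∀ z → Dec (act (g′ z) v ≈ᵛ w)) → ∀ j i → Dec (act (g i) (act (g j ⁻¹) v) ≈ᵛ w)
      act? v w d j i = Dec.map′ (λ e k → ≈-trans (≈-sym (act-∘ (g i) (g j ⁻¹) v k)) (e k)) (λ e k → ≈-trans (act-∘ (g i) (g j ⁻¹) v k) (e k)) (d (i , j))

    module NoFlattening (_~?_ : ∀ i j → Dec (g i ≈ᴳ g j)) (_~?′_ : ∀ z z′ → Dec (g′ z ≈ᴳ g′ z′)) where
      E : ℕ
      E = energy _~?_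

      Q? : ∀ i j k l → Dec (g i ⁻¹ ∙ g j ≈ᴳ g k ⁻¹ ∙ g l)
      Q? i j k l = Dec.map′ (swap-quotient (g j) (g l) (g i) (g k)) (unswap-quotient (g j) (g l) (g i) (g k)) ((j , l) ~?′ (i , k))

      -- The energy of the quotient family is the multiplicative energy of the family, rearranged to
      -- left quotients.
      E′≤∑Q : F′.energy _~?′_ ≤ ∑ is (λ i → ∑ is (λ j → ∑ is (λ k → ∑ is (λ l → 𝟙 (Q? i j k l)))))
      E′≤∑Q = begin
        F′.energy _~?′_ ≡⟨ trans (∑-cartesianProduct is is _) (∑-cong is λ j → ∑-cong is λ l → ∑-cartesianProduct is is _) ⟩
        ∑ is (λ j → ∑ is (λ l → ∑ is (λ i → ∑ is (λ k → 𝟙 ((j , l) ~?′ (i , k)))))) ≤⟨ (∑-mono is λ j → ∑-mono is λ l → ∑-mono is λ i → ∑-mono is λ k →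
            𝟙-mono ((j , l) ~?′ (i , k)) (Q? i j k l) (swap-quotient (g j) (g l) (g i) (g k))) ⟩
        ∑ is (λ j → ∑ is (λ l → ∑ is (λ i → ∑ is (λ k → 𝟙 (Q? i j k l))))) ≡⟨ (∑-cong is λ j → trans (∑-swap is is _) (∑-cong is λ i → ∑-swap is is _)) ⟩
        ∑ is (λ j → ∑ is (λ i → ∑ is (λ k → ∑ is (λ l → 𝟙 (Q? i j k l))))) ≡⟨ ∑-swap is is _ ⟩
        ∑ is (λ i → ∑ is (λ j → ∑ is (λ k → ∑ is (λ l → 𝟙 (Q? i j k l))))) ∎

      -- The energy hypothesis says that the effective size grows at most by the factor L. The
      -- factor `L ^ 61` in `Spread` pays for the transfer to S. In Ω, which bounds |V₄|, 489 = 45 +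
      -- 444: first q against m²/E ≤ Nn, then |P⁴| against q.
      no-flattening : ∀ L → 2 ≤ L → 0 < m → m * m * E ≤ L * F′.energy _~?′_ →
        ∀ B J Nn → Spread (L ^ 61 * B) → m * m ≤ Nn * E →
        let Ω  = L ^ 489 * Nn
            Ω⁴ = Ω * Ω * (Ω * Ω)
        in L ^ (56 + 1277 * 13 ^ J) < B → Ω⁴ * L ^ (56 * 2 ^ J) < B ^ (2 ^ J) →
           (∀ p → HasCharacteristic p → Ω⁴ * Ω⁴ * (Ω⁴ * Ω⁴) < p) → ⊥
      no-flattening L 2≤L 0<m dense B J Nn (sc , pt) m²≤ large larger char = conclude
        (BSG.balog-szemerédi-gowers affineGroup {p = ℓ} is g _~?_ Q? L 2≤L 0<m (≤-trans dense (*-monoʳ-≤ L E′≤∑Q)))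
        where
        open Exponents 2≤L
        instance
          L-nonZero : NonZero L
          L-nonZero = >-nonZero (≤-trans (s≤s z≤n) 2≤L)
          E-nonZero : NonZero E
          E-nonZero = >-nonZero (≤-trans 0<m (≤-trans (≤-reflexive (length≡∑ is)) (∑-mono-∈ is λ {i} i∈ → ∑𝟙≥1 (i ~?_) i∈ 𝔾.refl)))
        Ω Ω⁴ : ℕ
        Ω  = L ^ 489 * Nn
        Ω⁴ = Ω * Ω * (Ω * Ω)
        conclude : (Σ ℕ λ q → Σ (Fin q → Aff) λ S →
          0 < q × (∀ a b → S a ≈ᴳ S b → a ≡ b) × BSG.FewQuotients affineGroup S (L ^ 55 * q) × q * E ≤ L ^ 45 * (m * m) ×
          (∀ (C : Aff → Set ℓ) → (∀ {x y} → C x → x ≈ᴳ y → C y) → (C? : ∀ i → Dec (C (g i))) → ∀ B →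
            ∑ is (𝟙 ∘ C?) * B ≤ m → ∀ {xs} → Unique xs → All (C ∘ S) xs → length xs * B ≤ L ^ 61 * q)) → ⊥
        conclude (q , S , 0<q , inj , few , qE≤ , conc) =
          Translations.not-spread (smallSet S inj (fromℕ< 0<q) (m^n>0 L 55) few) B J conc-scale conc-point
            (≤-<-trans (unwrap (large≼ J)) large)
            (≤-<-trans (*-mono-≤ ω⁴≤Ω⁴ (unwrap (≼-^ (2 ^ J) 2M≼))) larger)
            (λ p h → ≤-<-trans (*-mono-≤ (*-mono-≤ ω⁴≤Ω⁴ ω⁴≤Ω⁴) (*-mono-≤ ω⁴≤Ω⁴ ω⁴≤Ω⁴)) (char p h))
          where
          cancel : ∀ {x} → x * (L ^ 61 * B) ≤ L ^ 61 * q → x * B ≤ q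
          cancel {x} h = *-cancelˡ-≤ (L ^ 61) {{m^n≢0 L 61}} (≤-trans (≤-reflexive (regroup (L ^ 61) x B)) h)
            where
            regroup : ∀ l x b → l * (x * b) ≡ x * (l * b)
            regroup = solve-∀
          conc-scale : ∀ s {xs} → Unique xs → All (λ a → scale (S a) ≈ᶠ s) xs → length xs * B ≤ q
          conc-scale s {xs} u h = run do
            d ← decide fin (λ i → scale (g i) ≈ᶠ s)
            pure (cancel {length xs} (conc (λ x → scale x ≈ᶠ s) (λ e e′ → ≈-trans (≈-sym (scale≈ e′)) e) d (L ^ 61 * B) (sc s d) u h))
          conc-point : ∀ v w {xs} → Unique xs → All (λ a → act (S a) v ≈ᵛ w) xs → length xs * B ≤ q
          conc-point v w {xs} u h = run do
            d ← decide fin (λ i → act (g i) v ≈ᵛ w)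
            pure (cancel {length xs} (conc (λ x → act x v ≈ᵛ w) (λ {x} {y} e e′ k → ≈-trans (≈-sym (act-cong {x} {y} e′ {v} (λ _ → ≈-refl) k)) (e k)) d (L ^ 61 * B) (pt v w d) u h))
          q≤ : q ≤ L ^ 45 * Nn
          q≤ = *-cancelʳ-≤ _ _ E (≤-trans qE≤ (≤-trans (*-monoʳ-≤ (L ^ 45) m²≤) (≤-reflexive (sym (*-assoc (L ^ 45) Nn E)))))
          ω≤Ω : q * (2 * (L ^ 55 * L ^ 55)) ^ 4 ≤ Ω
          ω≤Ω = begin
            q * (2 * (L ^ 55 * L ^ 55)) ^ 4 ≤⟨ *-mono-≤ q≤ (unwrap (c#≼ 4)) ⟩
            L ^ 45 * Nn * L ^ 444 ≡⟨ regroup (L ^ 45) Nn (L ^ 444) ⟩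
            L ^ 45 * L ^ 444 * Nn ≡⟨ cong (_* Nn) (^-distribˡ-+-* L 45 444) ⟨
            L ^ 489 * Nn ∎
            where
            regroup : ∀ a b c → a * b * c ≡ a * c * b
            regroup = solve-∀
          ω⁴≤Ω⁴ = *-mono-≤ (*-mono-≤ ω≤Ω ω≤Ω) (*-mono-≤ ω≤Ω ω≤Ω)

  module Loop {n} .{{_ : NonZero n}} (L : ℕ) (2≤L : 2 ≤ L) (B J Z : ℕ) (2Z²≤n : 2 * (Z * Z) ≤ n) where
    Nn Ω Ω⁴ : ℕ
    Nn = 4 * (Z * Z * (Z * Z)) * (n * n)
    Ω  = L ^ 489 * Nn
    Ω⁴ = Ω * Ω * (Ω * Ω)

    module _ (large : L ^ (56 + 1277 * 13 ^ J) < B) (larger : Ω⁴ * L ^ (56 * 2 ^ J) < B ^ (2 ^ J))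
             (char : ∀ p → HasCharacteristic p → Ω⁴ * Ω⁴ * (Ω⁴ * Ω⁴) < p) where

      -- Invariants: the incidences have density at least 1/z, and the effective size is at least x
      -- n. A step squares z and multiplies x by L. Since z stays at most Z, `rich⇒energy` caps the
      -- effective size at 4Z⁴n², which `fuel` further steps would exceed.
      iterate : ∀ fuel {I : Set} (fin : Finite I) (g : I → Aff) (_~?_ : ∀ i j → Dec (g i ≈ᴳ g j))
        (A A′ : Fin n → V) (A-inj : Injectiveᵛ A) (A′-inj : Injectiveᵛ A′)
        (c? : ∀ i a b → Dec (Family.Incidence fin g A A′ i a b)) →
        let open Family fin g in
        ∀ z x → 0 < m → 0 < z → z ^ (2 ^ fuel) ≤ Z → Spread (L ^ 61 * B) →
        m * n ≤ z * Incidences.incidences A A′ A-inj A′-inj c? →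
        energy _~?_ * x * n ≤ m * m → 4 * (Z * Z * (Z * Z)) * n < x * L ^ fuel → ⊥
      iterate fuel fin g _~?_ A A′ A-inj A′-inj c? z x 0<m 0<z z≤ spread rich small big = go fuel z≤ big
        where
        open Family fin g
        open Quotients fin g using (fin′; g′; module F′; module NoFlattening; next-incidences; next-spread; m′≡m²)
        open ≤-Reasoning
        E N : ℕ
        E = energy _~?_
        N = Incidences.incidences A A′ A-inj A′-inj c?
        instance
          m-nonZero : NonZero m
          m-nonZero = >-nonZero 0<m
          E-nonZero : NonZero E
          E-nonZero = >-nonZero (≤-trans 0<m (≤-trans (≤-reflexive (length≡∑ is)) (∑-mono-∈ is λ {i} i∈ → ∑𝟙≥1 (i ~?_) i∈ 𝔾.refl)))
        z≤Z : ∀ fuel → z ^ (2 ^ fuel) ≤ Z → z ≤ Z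
        z≤Z fuel h = ≤-trans (subst (_≤ z ^ (2 ^ fuel)) (*-identityʳ z) (^-monoʳ-≤ z {{>-nonZero 0<z}} {1} {2 ^ fuel} (m^n>0 2 fuel))) h
        m²≤ : z ≤ Z → m * m ≤ Nn * E
        m²≤ z≤Z = ≤-trans (Incidences.Energy.rich⇒energy A A′ A-inj A′-inj c? _~?_ z rich (≤-trans (*-monoʳ-≤ 2 (*-mono-≤ z≤Z z≤Z)) 2Z²≤n))
          (*-monoˡ-≤ E (*-monoˡ-≤ (n * n) (*-monoʳ-≤ 4 (*-mono-≤ (*-mono-≤ z≤Z z≤Z) (*-mono-≤ z≤Z z≤Z)))))
        go : ∀ fuel → z ^ (2 ^ fuel) ≤ Z → 4 * (Z * Z * (Z * Z)) * n < x * L ^ fuel → ⊥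
        go zero z≤ big = <⇒≱ (subst (4 * (Z * Z * (Z * Z)) * n <_) (*-identityʳ x) big)
          (*-cancelˡ-≤ (E * n) {{m*n≢0 E n}} (begin
            E * n * x ≡⟨ r₁ E n x ⟩
            E * x * n ≤⟨ small ⟩
            m * m ≤⟨ m²≤ (z≤Z 0 z≤) ⟩
            Nn * E ≡⟨ r₂ (4 * (Z * Z * (Z * Z))) n E ⟩
            E * n * (4 * (Z * Z * (Z * Z)) * n) ∎))
          where
          r₁ : ∀ e n x → e * n * x ≡ e * x * n
          r₁ = solve-∀
          r₂ : ∀ c n e → c * (n * n) * e ≡ e * n * (c * n)
          r₂ = solve-∀
        go (suc fuel) z≤ big =
          decide₂ fin′ fin′ (λ w w′ → g′ w ≈ᴳ g′ w′) λ _~?′_ →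
          decide₂ fin′ (finite-Fin n ×-finite finite-Fin n) (λ w (a , b) → F′.Incidence A′ A′ w a b) λ d →
          step _~?′_ (λ w a b → d w (a , b))
          where
          step : (_~?′_ : ∀ w w′ → Dec (g′ w ≈ᴳ g′ w′)) → (∀ w a b → Dec (F′.Incidence A′ A′ w a b)) → ⊥
          step _~?′_ c?′ = by-density (m * m * E ≤? L * E′)
            where
            E′ N′ : ℕ
            E′ = F′.energy _~?′_
            N′ = F′.Incidences.incidences A′ A′ A′-inj A′-inj c?′
            rich′ : F′.m * n ≤ z * z * N′
            rich′ = *-cancelʳ-≤ _ _ n (begin
              F′.m * n * n ≡⟨ cong (λ k → k * n * n) m′≡m² ⟩
              m * m * n * n ≡⟨ r₁ m n ⟩
              m * n * (m * n) ≤⟨ *-mono-≤ rich rich ⟩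
              z * N * (z * N) ≡⟨ r₂ z N ⟩
              z * z * (N * N) ≤⟨ *-monoʳ-≤ (z * z) (next-incidences A A′ A-inj A′-inj c? c?′) ⟩
              z * z * (n * N′) ≡⟨ r₃ (z * z) n N′ ⟩
              z * z * N′ * n ∎)
              where
              r₁ : ∀ m n → m * m * n * n ≡ m * n * (m * n)
              r₁ = solve-∀
              r₂ : ∀ z s → z * s * (z * s) ≡ z * z * (s * s)
              r₂ = solve-∀
              r₃ : ∀ a b c → a * (b * c) ≡ a * c * b
              r₃ = solve-∀
            by-density : Dec (m * m * E ≤ L * E′) → ⊥
            by-density (yes dense) = NoFlattening.no-flattening _~?_ _~?′_ L 2≤L 0<m dense B J Nn spread (m²≤ (z≤Z (suc fuel) z≤)) large larger char
            by-density (no sparse) = iterate fuel fin′ g′ _~?′_ A′ A′ A′-inj A′-inj c?′ (z * z) (x * L)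
              (subst (0 <_) (sym m′≡m²) (*-mono-< 0<m 0<m)) (*-mono-< 0<z 0<z)
              (subst (_≤ Z) (trans (sym (^-*-assoc z 2 (2 ^ fuel))) (cong (_^ (2 ^ fuel)) (cong (z *_) (*-identityʳ z)))) z≤)
              (next-spread (L ^ 61 * B) spread) rich′
              (begin
                E′ * (x * L) * n ≡⟨ r₁ E′ x L n ⟩
                L * E′ * (x * n) ≤⟨ *-monoˡ-≤ (x * n) (<⇒≤ (≰⇒> sparse)) ⟩
                m * m * E * (x * n) ≡⟨ r₂ (m * m) E x n ⟩
                m * m * (E * x * n) ≤⟨ *-monoʳ-≤ (m * m) small ⟩
                m * m * (m * m) ≡⟨ cong₂ _*_ m′≡m² m′≡m² ⟨
                F′.m * F′.m ∎)
              (subst (4 * (Z * Z * (Z * Z)) * n <_) (sym (*-assoc x L (L ^ fuel))) big)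
              where
              r₁ : ∀ e x l n → e * (x * l) * n ≡ l * e * (x * n)
              r₁ = solve-∀
              r₂ : ∀ m e x n → m * e * (x * n) ≡ m * (e * x * n)
              r₂ = solve-∀

-- Exponents

root : ∀ R → 0 < R → ∀ n → Σ ℕ λ y → y ^ R ≤ n × n < suc y ^ R
root (suc R) _ zero    = 0 , z≤n , m^n>0 1 (suc R)
root (suc R) h (suc n) with root (suc R) h n
... | y , lo , hi with suc n <? suc y ^ suc R
...   | yes lt = y , m≤n⇒m≤1+n lo , lt
...   | no ge  = suc y , ≮⇒≥ ge , ≤-<-trans hi (^-monoˡ-< (suc R) ≤-refl)

-- The constants are chosen in the order J, β, C, f, g, e, R: β for `large`, C for the exponent of
-- `L ^ 61 * B`, f so that L^f exceeds 4Z⁴n, g so that L ≥ 4Z⁴, and R = b e so that n^(1/b) ≥ y^e.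
-- They are variables with equations and thus stay opaque.
module Numerics (b J : ℕ) (1≤b : 1 ≤ b) (64b≤2^J : 64 * b ≤ 2 ^ J)
  (β C f g e R : ℕ) (β≡ : β ≡ 57 + 1277 * 13 ^ J) (C≡ : C ≡ 61 + β) (f≡ : f ≡ 1 + 2 * (b * C))
  (g≡ : g ≡ 2 + 2 * (2 * 2 ^ f)) (e≡ : e ≡ g * C) (R≡ : R ≡ b * e)
  (y n : ℕ) (2≤y : 2 ≤ y) (y^R≤n : y ^ R ≤ n) (n<y^2R : n < y ^ (2 * R)) where

  open ≤-Reasoning

  instance
    y-nonZero : NonZero y
    y-nonZero = >-nonZero (≤-trans (s≤s z≤n) 2≤y)
    b-nonZero : NonZero b
    b-nonZero = >-nonZero 1≤b

  -- y is the inverse of the density of incidences, Z its value after f steps of iteration, L the loss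
  -- tolerated in each step, and L ^ 61 * B = y ^ e the non-concentration of X₃.
  L B Z : ℕ
  L = y ^ g
  B = L ^ β
  Z = y ^ (2 ^ f)

  1≤g : 1 ≤ g
  1≤g = subst (1 ≤_) (sym g≡) (s≤s z≤n)

  2≤L : 2 ≤ L
  2≤L = ≤-trans 2≤y (subst (_≤ L) (*-identityʳ y) (^-monoʳ-≤ y {1} {g} 1≤g))

  13^J≥1 : 1 ≤ 13 ^ J
  13^J≥1 = m^n>0 13 J

  1277≤β″ : 1277 ≤ 1277 * 13 ^ J
  1277≤β″ = m≤m*n 1277 (13 ^ J) {{>-nonZero 13^J≥1}}

  490≤C : 490 ≤ C
  490≤C = subst (490 ≤_) (sym (trans C≡ (cong (61 +_) β≡))) (≤-trans (m≤m+n 490 787) (≤-trans 1277≤β″ (m≤n+m _ 118)))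

  gC≤R : g * C ≤ R
  gC≤R = subst (g * C ≤_) (sym (trans R≡ (cong (b *_) e≡))) (m≤n*m (g * C) b)

  y^≤n : ∀ {k} → k ≤ R → y ^ k ≤ n
  y^≤n k≤R = ≤-trans (^-monoʳ-≤ y k≤R) y^R≤n

  L^490≤n : L ^ 490 ≤ n
  L^490≤n = ≤-trans (≤-reflexive (^-*-assoc y g 490)) (y^≤n (≤-trans (*-monoʳ-≤ g 490≤C) gC≤R))

  2≤n : 2 ≤ n
  2≤n = ≤-trans 2≤L (≤-trans (subst (_≤ L ^ 490) (*-identityʳ L) (^-monoʳ-≤ L {{>-nonZero (≤-trans (s≤s z≤n) 2≤L)}} {1} {490} (s≤s z≤n))) L^490≤n)

  large : L ^ (56 + 1277 * 13 ^ J) < B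
  large = ^-monoʳ-< L 2≤L (≤-reflexive (sym β≡))

  Z≼ : _≼_ 2≤y Z (2 ^ f)
  Z≼ = wrap ≤-refl

  Z⁴≼ : _≼_ 2≤y (4 * (Z * Z * (Z * Z))) (2 + (2 ^ f + 2 ^ f + (2 ^ f + 2 ^ f)))
  Z⁴≼ = _⊛_ 2≤y {a = 2} (numeral 2≤y 4 2 ≤-refl) (_⊛_ 2≤y (_⊛_ 2≤y Z≼ Z≼) (_⊛_ 2≤y Z≼ Z≼))

  exponent-g : 2 + (2 ^ f + 2 ^ f + (2 ^ f + 2 ^ f)) ≡ g
  exponent-g = trans (lemma (2 ^ f)) (sym g≡)
    where
    lemma : ∀ t → 2 + (t + t + (t + t)) ≡ 2 + 2 * (2 * t)
    lemma = solve-∀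

  4Z⁴≤L : 4 * (Z * Z * (Z * Z)) ≤ L
  4Z⁴≤L = ≤-trans (unwrap Z⁴≼) (≤-reflexive (cong (y ^_) exponent-g))

  2Z²≤n : 2 * (Z * Z) ≤ n
  2Z²≤n = begin
    2 * (Z * Z)                  ≤⟨ *-monoˡ-≤ (Z * Z) (m≤m+n 2 2) ⟩
    4 * (Z * Z)                  ≤⟨ *-monoʳ-≤ 4 (m≤m*n (Z * Z) (Z * Z) {{m*n≢0 Z Z {{m^n≢0 y (2 ^ f)}} {{m^n≢0 y (2 ^ f)}}}}) ⟩
    4 * (Z * Z * (Z * Z))        ≤⟨ 4Z⁴≤L ⟩
    L                            ≤⟨ y^≤n (≤-trans (m≤m*n g C {{>-nonZero (≤-trans (s≤s z≤n) 490≤C)}}) gC≤R) ⟩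
    n                            ∎

  2R≡ : 2 * R ≡ g * (2 * (b * C))
  2R≡ = trans (cong (2 *_) (trans R≡ (cong (b *_) e≡))) (lemma b g C)
    where
    lemma : ∀ b g C → 2 * (b * (g * C)) ≡ g * (2 * (b * C))
    lemma = solve-∀

  y^2R≡ : y ^ (2 * R) ≡ L ^ (2 * (b * C))
  y^2R≡ = trans (cong (y ^_) 2R≡) (sym (^-*-assoc y g (2 * (b * C))))

  big : 4 * (Z * Z * (Z * Z)) * n < 1 * L ^ f
  big = begin-strict
    4 * (Z * Z * (Z * Z)) * n         ≤⟨ *-monoˡ-≤ n 4Z⁴≤L ⟩
    L * n                             <⟨ *-monoʳ-< L {{m^n≢0 y g}} n<y^2R ⟩
    L * y ^ (2 * R)                   ≡⟨ cong (L *_) y^2R≡ ⟩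
    L ^ (1 + 2 * (b * C))             ≡⟨ cong (L ^_) f≡ ⟨
    L ^ f                             ≡⟨ *-identityˡ (L ^ f) ⟨
    1 * L ^ f                         ∎

  Nn Ω Ω⁴ : ℕ
  Nn = 4 * (Z * Z * (Z * Z)) * (n * n)
  Ω  = L ^ 489 * Nn
  Ω⁴ = Ω * Ω * (Ω * Ω)

  Ω≤ : Ω ≤ L ^ 490 * (n * n)
  Ω≤ = begin
    L ^ 489 * Nn             ≤⟨ *-monoʳ-≤ (L ^ 489) (*-monoˡ-≤ (n * n) 4Z⁴≤L) ⟩
    L ^ 489 * (L * (n * n))  ≡⟨ lemma (L ^ 489) L (n * n) ⟩
    L ^ 490 * (n * n)        ∎
    where
    lemma : ∀ a l x → a * (l * x) ≡ l * a * x
    lemma = solve-∀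

  -- The exponents of L are 1960 + 16 b C + 56 · 2^J against (57 + β″) 2^J, where C = 118 + β″. The
  -- slack (1 + β″) 2^J is at least 64 b (1 + β″): 16 b β″ of it covers the main term, and 48 b β″
  -- covers the constants as β″ ≥ 1277.
  larger : Ω⁴ * L ^ (56 * 2 ^ J) < B ^ (2 ^ J)
  larger = begin-strict
    Ω⁴ * L ^ (56 * 2 ^ J) ≤⟨ unwrap total≼ ⟩
    L ^ (w + w + (w + w) + 56 * 2 ^ J) <⟨ ^-monoʳ-< L 2≤L exponent ⟩
    L ^ (β * 2 ^ J) ≡⟨ ^-*-assoc L β (2 ^ J) ⟨
    B ^ (2 ^ J) ∎
    where
    w β″ P : ℕ
    w = 490 + (2 * (b * C) + 2 * (b * C))
    β″ = 1277 * 13 ^ J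
    P = 2 ^ J
    pow : ∀ k → _≼_ 2≤L (L ^ k) k
    pow k = wrap ≤-refl
    n≼ : _≼_ 2≤L n (2 * (b * C))
    n≼ = wrap (≤-trans (<⇒≤ n<y^2R) (≤-reflexive y^2R≡))
    Ω≼ : _≼_ 2≤L Ω w
    Ω≼ = wrap (≤-trans Ω≤ (unwrap bound≼))
      where
      bound≼ : _≼_ 2≤L (L ^ 490 * (n * n)) w
      bound≼ = _⊛_ 2≤L (pow 490) (_⊛_ 2≤L n≼ n≼)
    total≼ : _≼_ 2≤L (Ω⁴ * L ^ (56 * 2 ^ J)) (w + w + (w + w) + 56 * 2 ^ J)
    total≼ = _⊛_ 2≤L (_⊛_ 2≤L (_⊛_ 2≤L Ω≼ Ω≼) (_⊛_ 2≤L Ω≼ Ω≼)) (pow (56 * 2 ^ J))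
    r₁ : ∀ b β P → (490 + (2 * (b * (118 + β)) + 2 * (b * (118 + β)))) + (490 + (2 * (b * (118 + β)) + 2 * (b * (118 + β))))
           + ((490 + (2 * (b * (118 + β)) + 2 * (b * (118 + β)))) + (490 + (2 * (b * (118 + β)) + 2 * (b * (118 + β))))) + 56 * P
         ≡ 1960 + 1888 * b + 16 * b * β + 56 * P
    r₁ = solve-∀
    r₂ : ∀ b β → b * (48 * β) + 16 * b * β + 64 * b ≡ (64 * b) * (1 + β)
    r₂ = solve-∀
    r₃ : ∀ P β → P * (1 + β) + 56 * P ≡ (57 + β) * P
    r₃ = solve-∀
    r₄ : ∀ b → 1960 * b + 1888 * b ≡ b * 3848
    r₄ = solve-∀
    C′ : C ≡ 118 + β″
    C′ = trans C≡ (cong (61 +_) {x = β} {y = 57 + β″} β≡)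
    exponent : w + w + (w + w) + 56 * 2 ^ J < β * 2 ^ J
    exponent = begin-strict
      w + w + (w + w) + 56 * P                  ≡⟨ trans (cong (λ C → (490 + (2 * (b * C) + 2 * (b * C))) + (490 + (2 * (b * C) + 2 * (b * C)))
           + ((490 + (2 * (b * C) + 2 * (b * C))) + (490 + (2 * (b * C) + 2 * (b * C)))) + 56 * P) C′) (r₁ b β″ P) ⟩
      1960 + 1888 * b + 16 * b * β″ + 56 * P    ≤⟨ +-monoˡ-≤ (56 * P) (+-monoˡ-≤ (16 * b * β″) (+-monoˡ-≤ (1888 * b) (m≤m*n 1960 b))) ⟩
      1960 * b + 1888 * b + 16 * b * β″ + 56 * P ≡⟨ cong (λ s → s + 16 * b * β″ + 56 * P) (r₄ b) ⟩
      b * 3848 + 16 * b * β″ + 56 * P           ≤⟨ +-monoˡ-≤ (56 * P) (+-monoˡ-≤ (16 * b * β″) (*-monoʳ-≤ b (≤-trans (m≤m+n 3848 57448) (*-monoʳ-≤ 48 1277≤β″)))) ⟩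
      b * (48 * β″) + 16 * b * β″ + 56 * P      <⟨ +-monoˡ-< (56 * P) {b * (48 * β″) + 16 * b * β″} {b * (48 * β″) + 16 * b * β″ + 64 * b} (m<m+n (b * (48 * β″) + 16 * b * β″) (*-mono-< {0} {64} {0} {b} (s≤s z≤n) 1≤b)) ⟩
      b * (48 * β″) + 16 * b * β″ + 64 * b + 56 * P ≡⟨ cong (_+ 56 * P) (r₂ b β″) ⟩
      64 * b * (1 + β″) + 56 * P                ≤⟨ +-monoˡ-≤ (56 * P) (*-monoˡ-≤ (1 + β″) 64b≤2^J) ⟩
      P * (1 + β″) + 56 * P                     ≡⟨ r₃ P β″ ⟩
      (57 + β″) * P                             ≡⟨ cong (_* P) {x = β} {y = 57 + β″} β≡ ⟨
      β * P                                     ∎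

  -- The pivot needs a characteristic above |T|⁴, where |T| ≤ |V₄|⁴ ≤ Ω⁴ and Ω ≤ n³. This is the
  -- origin of N = 48.
  Ω^16≤n^48 : Ω⁴ * Ω⁴ * (Ω⁴ * Ω⁴) ≤ n ^ 48
  Ω^16≤n^48 = unwrap (sq (sq Ω≼3))
    where
    n≼1 : _≼_ 2≤n n 1
    n≼1 = wrap (≤-reflexive (sym (*-identityʳ n)))
    Ω≼3 : _≼_ 2≤n Ω 3
    Ω≼3 = wrap (≤-trans Ω≤ (≤-trans (*-monoˡ-≤ (n * n) L^490≤n) (unwrap n³≼3)))
      where
      n³≼3 : _≼_ 2≤n (n * (n * n)) 3
      n³≼3 = _⊛_ 2≤n n≼1 (_⊛_ 2≤n n≼1 n≼1)
    sq : ∀ {x a} → _≼_ 2≤n x a → _≼_ 2≤n (x * x * (x * x)) (a + a + (a + a))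
    sq h = _⊛_ 2≤n (_⊛_ 2≤n h h) (_⊛_ 2≤n h h)

  L^61B≡ : L ^ 61 * B ≡ y ^ e
  L^61B≡ = trans (sym (^-distribˡ-+-* L 61 β)) (trans (cong (L ^_) {x = 61 + β} {y = C} (sym C≡)) (trans (^-*-assoc y g C) (cong (y ^_) (sym e≡))))

  L^61B≤n : L ^ 61 * B ≤ n
  L^61B≤n = ≤-trans (≤-reflexive L^61B≡) (y^≤n (≤-trans (≤-reflexive e≡) gC≤R))

  -- k ≤ n^(1 - a/b) with a ≥ 1 gives (n/k)^b ≥ n ≥ y^R = (y^e)^b.
  spread : ∀ a k → 1 ≤ a → k ^ b * n ^ a ≤ n ^ b → k * (L ^ 61 * B) ≤ n
  spread a k 1≤a h = ^-cancelˡ-≤ b (begin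
    (k * (L ^ 61 * B)) ^ b      ≡⟨ ^-distribʳ-* b k (L ^ 61 * B) ⟩
    k ^ b * (L ^ 61 * B) ^ b    ≡⟨ cong (λ s → k ^ b * s ^ b) L^61B≡ ⟩
    k ^ b * (y ^ e) ^ b         ≡⟨ cong (k ^ b *_) (trans (^-*-assoc y e b) (cong (y ^_) (trans (*-comm e b) (sym R≡)))) ⟩
    k ^ b * y ^ R               ≤⟨ *-monoʳ-≤ (k ^ b) y^R≤n ⟩
    k ^ b * n                   ≤⟨ *-monoʳ-≤ (k ^ b) (subst (_≤ n ^ a) (*-identityʳ n) (^-monoʳ-≤ n {{>-nonZero (≤-trans (s≤s z≤n) 2≤n)}} {1} {a} 1≤a)) ⟩
    k ^ b * n ^ a               ≤⟨ h ⟩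
    n ^ b                       ∎)
    where
    ^-cancelˡ-≤ : ∀ b .{{_ : NonZero b}} {x y} → x ^ b ≤ y ^ b → x ≤ y
    ^-cancelˡ-≤ b {x} {y} h = ≮⇒≥ λ y<x → <⇒≱ (^-monoˡ-< b y<x) h

-- Projective geometry

module Geometry {k ℓ} (K : Field k ℓ) where
  open Affine K 4
  open Proj K

  pattern 0F = Fin.zero
  pattern 1F = Fin.suc Fin.zero
  pattern 2F = Fin.suc (Fin.suc Fin.zero)
  pattern 3F = Fin.suc (Fin.suc (Fin.suc Fin.zero))

  dot-cong : ∀ a {v w} → v ≈ᵛ w → dot a v ≈ᶠ dot a w
  dot-cong a e = +-cong (+-cong (*-congˡ (e 0F)) (*-congˡ (e 1F))) (+-cong (*-congˡ (e 2F)) (*-congˡ (e 3F)))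

  dot-linear : ∀ a s t v w → dot a (λ i → s ⊗ v i ⊕ t ⊗ w i) ≈ᶠ s ⊗ dot a v ⊕ t ⊗ dot a w
  dot-linear a s t v w = ≈-trans
    (+-cong (+-cong (distribute 0F) (distribute 1F)) (+-cong (distribute 2F) (distribute 3F)))
    (solve 10 (λ s t v₀ v₁ v₂ v₃ w₀ w₁ w₂ w₃ →
        ((s :* v₀ :+ t :* w₀) :+ (s :* v₁ :+ t :* w₁)) :+ ((s :* v₂ :+ t :* w₂) :+ (s :* v₃ :+ t :* w₃))
        := s :* ((v₀ :+ v₁) :+ (v₂ :+ v₃)) :+ t :* ((w₀ :+ w₁) :+ (w₂ :+ w₃))) ≈-refl
      s t (a 0F ⊗ v 0F) (a 1F ⊗ v 1F) (a 2F ⊗ v 2F) (a 3F ⊗ v 3F) (a 0F ⊗ w 0F) (a 1F ⊗ w 1F) (a 2F ⊗ w 2F) (a 3F ⊗ w 3F))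
    where
    distribute : ∀ i → a i ⊗ (s ⊗ v i ⊕ t ⊗ w i) ≈ᶠ s ⊗ (a i ⊗ v i) ⊕ t ⊗ (a i ⊗ w i)
    distribute i = solve 5 (λ a s t v w → a :* (s :* v :+ t :* w) := s :* (a :* v) :+ t :* (a :* w)) ≈-refl (a i) s t (v i) (w i)

  dot-comm : ∀ a v → dot a v ≈ᶠ dot v a
  dot-comm a v = +-cong (+-cong (c 0F) (c 1F)) (+-cong (c 2F) (c 3F))
    where
    c : ∀ i → a i ⊗ v i ≈ᶠ v i ⊗ a i
    c i = Field.*-comm K (a i) (v i)

  dot-scale : ∀ a s v → dot a (λ i → s ⊗ v i) ≈ᶠ s ⊗ dot a v
  dot-scale a s v = ≈-trans (dot-cong a (λ i → solve 2 (λ s v → s :* v := s :* v :+ :0 :* v) ≈-refl s (v i)))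
    (≈-trans (dot-linear a s 0# v v) (solve 2 (λ s d → s :* d :+ :0 :* d := s :* d) ≈-refl s (dot a v)))

  in-plane : ∀ (L : Line) (P : Plane) → OnPlane (pt₁ L) P → OnPlane (pt₂ L) P → LineInPlane L P
  in-plane L P h₁ h₂ x (a , b , e) = ≈-trans (dot-cong (form P) e) (≈-trans (dot-linear (form P) a b (vec (pt₁ L)) (vec (pt₂ L)))
    (by a h₁ (by b h₂ (solve 4 (λ a b x y → a :* x :+ b :* y := (:0 :+ a :* (x :- :0)) :+ b :* (y :- :0)) ≈-refl a b (dot (form P) (vec (pt₁ L))) (dot (form P) (vec (pt₂ L)))))))

  vec4 : F → F → F → F → Vec4
  vec4 a b c d 0F = a
  vec4 a b c d 1F = b
  vec4 a b c d 2F = c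
  vec4 a b c d 3F = d

  module CommonLine (P₁ P₂ : Plane) where
    minor : Fin 4 → Fin 4 → F
    minor i j = form P₁ i ⊗ form P₂ j ⊕ ⊖ (form P₁ j ⊗ form P₂ i)

    same-plane : (∀ i j → minor i j ≈ᶠ 0#) → DN (SamePlane P₁ P₂)
    same-plane h none = choice (finite-Fin 4) stable (formNonzero P₂)
      where
      stable : ∀ j → DN (form P₂ j ≈ᶠ 0#)
      stable j f₂j≉0 = let u , e = inverse (form P₂ j) f₂j≉0 in
        none (form P₁ j ⊗ u , λ i → by (⊖ form P₁ i) e (by u (h i j)
          (solve 5 (λ ai bj aj bi u → ai := ((aj :* u) :* bi :+ (:- ai) :* (bj :* u :- :1)) :+ u :* ((ai :* bj :- aj :* bi) :- :0)) ≈-refl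
            (form P₁ i) (form P₂ j) (form P₁ j) (form P₂ i) u)))

    Common : Set (k ⊔ ℓ)
    Common = Σ Line λ L → LineInPlane L P₁ × LineInPlane L P₂

    Kernel : Vec4 → Set ℓ
    Kernel v = dot (form P₁) v ≈ᶠ 0# × dot (form P₂) v ≈ᶠ 0#

    common : ∀ u v → Kernel u → Kernel v → ∀ p q → ¬ u p ≈ᶠ 0# → v p ≈ᶠ 0# → ¬ v q ≈ᶠ 0# → Common
    common u v (ku₁ , ku₂) (kv₁ , kv₂) p q up vp vq = L , in-plane L P₁ ku₁ kv₁ , in-plane L P₂ ku₂ kv₂
      where
      L : Line
      L = mkLine (mkPoint u λ h → up (h p)) (mkPoint v λ h → vq (h q))
        λ (s , e) → up (≈-trans (e p) (≈-trans (*-congˡ vp) (zeroʳ s)))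

    -- Four solutions of f₁ = f₂ = 0, one for each omitted coordinate: the vectors of 2 × 2 minors.
    omit₀ omit₁ omit₂ omit₃ : Vec4
    omit₀ = vec4 0# (minor 2F 3F) (minor 3F 1F) (minor 1F 2F)
    omit₁ = vec4 (minor 2F 3F) 0# (minor 3F 0F) (minor 0F 2F)
    omit₂ = vec4 (minor 1F 3F) (minor 3F 0F) 0# (minor 0F 1F)
    omit₃ = vec4 (minor 1F 2F) (minor 2F 0F) (minor 0F 1F) 0#

    -- Each value is the expansion of a 3 × 3 determinant with a repeated row.
    kernel₀ : Kernel omit₀
    kernel₀ =
        solve 7 (λ a b c d f g h → ((a :* :0) :+ b :* (c :* h :- d :* g)) :+ (c :* (d :* f :- b :* h) :+ d :* (b :* g :- c :* f)) := :0) ≈-refl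
          (form P₁ 0F) (form P₁ 1F) (form P₁ 2F) (form P₁ 3F) (form P₂ 1F) (form P₂ 2F) (form P₂ 3F)
      , solve 7 (λ e f g h b c d → ((e :* :0) :+ f :* (c :* h :- d :* g)) :+ (g :* (d :* f :- b :* h) :+ h :* (b :* g :- c :* f)) := :0) ≈-refl
          (form P₂ 0F) (form P₂ 1F) (form P₂ 2F) (form P₂ 3F) (form P₁ 1F) (form P₁ 2F) (form P₁ 3F)

    kernel₁ : Kernel omit₁
    kernel₁ =
        solve 7 (λ a b c d e g h → (a :* (c :* h :- d :* g) :+ (b :* :0)) :+ (c :* (d :* e :- a :* h) :+ d :* (a :* g :- c :* e)) := :0) ≈-refl
          (form P₁ 0F) (form P₁ 1F) (form P₁ 2F) (form P₁ 3F) (form P₂ 0F) (form P₂ 2F) (form P₂ 3F)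
      , solve 7 (λ e f g h a c d → (e :* (c :* h :- d :* g) :+ (f :* :0)) :+ (g :* (d :* e :- a :* h) :+ h :* (a :* g :- c :* e)) := :0) ≈-refl
          (form P₂ 0F) (form P₂ 1F) (form P₂ 2F) (form P₂ 3F) (form P₁ 0F) (form P₁ 2F) (form P₁ 3F)

    kernel₂ : Kernel omit₂
    kernel₂ =
        solve 7 (λ a b c d e f h → (a :* (b :* h :- d :* f) :+ b :* (d :* e :- a :* h)) :+ ((c :* :0) :+ d :* (a :* f :- b :* e)) := :0) ≈-refl
          (form P₁ 0F) (form P₁ 1F) (form P₁ 2F) (form P₁ 3F) (form P₂ 0F) (form P₂ 1F) (form P₂ 3F)
      , solve 7 (λ e f g h a b d → (e :* (b :* h :- d :* f) :+ f :* (d :* e :- a :* h)) :+ ((g :* :0) :+ h :* (a :* f :- b :* e)) := :0) ≈-refl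
          (form P₂ 0F) (form P₂ 1F) (form P₂ 2F) (form P₂ 3F) (form P₁ 0F) (form P₁ 1F) (form P₁ 3F)

    kernel₃ : Kernel omit₃
    kernel₃ =
        solve 7 (λ a b c d e f g → (a :* (b :* g :- c :* f) :+ b :* (c :* e :- a :* g)) :+ (c :* (a :* f :- b :* e) :+ (d :* :0)) := :0) ≈-refl
          (form P₁ 0F) (form P₁ 1F) (form P₁ 2F) (form P₁ 3F) (form P₂ 0F) (form P₂ 1F) (form P₂ 2F)
      , solve 7 (λ e f g h a b c → (e :* (b :* g :- c :* f) :+ f :* (c :* e :- a :* g)) :+ (g :* (a :* f :- b :* e) :+ (h :* :0)) := :0) ≈-refl
          (form P₂ 0F) (form P₂ 1F) (form P₂ 2F) (form P₂ 3F) (form P₁ 0F) (form P₁ 1F) (form P₁ 2F)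

    minor-anti : ∀ i j → ¬ minor i j ≈ᶠ 0# → ¬ minor j i ≈ᶠ 0#
    minor-anti i j ne e = ne (by (⊖ 1#) e (solve 4 (λ a b c d → a :* d :- b :* c := :0 :+ (:- :1) :* ((b :* c :- a :* d) :- :0)) ≈-refl (form P₁ i) (form P₁ j) (form P₂ i) (form P₂ j)))

    -- The minor of i and j occurs in the two vectors that omit the other two coordinates, each time
    -- where the other vector vanishes; so these two are independent.
    from-minor : ∀ i j → ¬ minor i j ≈ᶠ 0# → Common
    from-minor 0F 1F ne = common omit₃ omit₂ kernel₃ kernel₂ 2F 3F ne ≈-refl ne
    from-minor 0F 2F ne = common omit₃ omit₁ kernel₃ kernel₁ 1F 3F (minor-anti 0F 2F ne) ≈-refl ne
    from-minor 0F 3F ne = common omit₂ omit₁ kernel₂ kernel₁ 1F 2F (minor-anti 0F 3F ne) ≈-refl (minor-anti 0F 3F ne)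
    from-minor 1F 2F ne = common omit₃ omit₀ kernel₃ kernel₀ 0F 3F ne ≈-refl ne
    from-minor 1F 3F ne = common omit₂ omit₀ kernel₂ kernel₀ 0F 2F ne ≈-refl (minor-anti 1F 3F ne)
    from-minor 2F 3F ne = common omit₁ omit₀ kernel₁ kernel₀ 0F 1F ne ≈-refl ne
    from-minor 1F 0F ne = from-minor 0F 1F (minor-anti 1F 0F ne)
    from-minor 2F 0F ne = from-minor 0F 2F (minor-anti 2F 0F ne)
    from-minor 3F 0F ne = from-minor 0F 3F (minor-anti 3F 0F ne)
    from-minor 2F 1F ne = from-minor 1F 2F (minor-anti 2F 1F ne)
    from-minor 3F 1F ne = from-minor 1F 3F (minor-anti 3F 1F ne)
    from-minor 3F 2F ne = from-minor 2F 3F (minor-anti 3F 2F ne)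
    from-minor 0F 0F ne = ⊥-elim (ne (solve 2 (λ a b → a :* b :- a :* b := :0) ≈-refl (form P₁ 0F) (form P₂ 0F)))
    from-minor 1F 1F ne = ⊥-elim (ne (solve 2 (λ a b → a :* b :- a :* b := :0) ≈-refl (form P₁ 1F) (form P₂ 1F)))
    from-minor 2F 2F ne = ⊥-elim (ne (solve 2 (λ a b → a :* b :- a :* b := :0) ≈-refl (form P₁ 2F) (form P₂ 2F)))
    from-minor 3F 3F ne = ⊥-elim (ne (solve 2 (λ a b → a :* b :- a :* b := :0) ≈-refl (form P₁ 3F) (form P₂ 3F)))

    common-line : ¬ SamePlane P₁ P₂ → DN Common
    common-line distinct none = choice (finite-Fin 4 ×-finite finite-Fin 4) {P = λ (i , j) → minor i j ≈ᶠ 0#}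
      (λ (i , j) ne → none (from-minor i j ne)) λ h → same-plane (λ i j → h (i , j)) distinct

  _·ᵛ_ : F → Vec4 → Vec4
  (s ·ᵛ v) i = s ⊗ v i

  -- The second alternative of `value` admits points of X₁ and X₂ on the common line, which cannot
  -- be normalised. They keep the index set equal to `Fin n`; `normal-form` shows that they occur in
  -- none of the triples counted.
  record Normalised (f : Vec4) (x : Point) : Set (k ⊔ ℓ) where
    field
      factor factor⁻¹ : F
      factor-unit     : factor ⊗ factor⁻¹ ≈ᶠ 1#
      value           : dot f (factor ·ᵛ vec x) ≈ᶠ 1# ⊎ dot f (vec x) ≈ᶠ 0#
    point : Vec4
    point = factor ·ᵛ vec x
    restore : ∀ i → vec x i ≈ᶠ factor⁻¹ ⊗ point i
    restore i = by (⊖ vec x i) factor-unit (solve 3 (λ c c′ x → x := c′ :* (c :* x) :+ (:- x) :* (c :* c′ :- :1)) ≈-refl factor factor⁻¹ (vec x i))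
    off : ¬ dot f (vec x) ≈ᶠ 0# → dot f point ≈ᶠ 1#
    off ne with value
    ... | inj₁ e = e
    ... | inj₂ e = ⊥-elim (ne e)
  open Normalised

  normalise-off : ∀ f x → ¬ dot f (vec x) ≈ᶠ 0# → Normalised f x
  normalise-off f x ne = let u , e = inverse (dot f (vec x)) ne in record
    { factor = u ; factor⁻¹ = dot f (vec x) ; factor-unit = ≈-trans (Field.*-comm K u _) e
    ; value = inj₁ (≈-trans (dot-scale f u (vec x)) (≈-trans (Field.*-comm K u _) e)) }

  normalise : ∀ f x → DN (Normalised f x)
  normalise f x = do
    no ne ← dec (dot f (vec x) ≈ᶠ 0#)
      where yes e → pure (record { factor = 1# ; factor⁻¹ = 1# ; factor-unit = solve 0 (:1 :* :1 := :1) ≈-refl ; value = inj₂ e })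
    pure (normalise-off f x ne)

  same-normalised : ∀ {f f′ x y} (nx : Normalised f x) (ny : Normalised f′ y) → point nx ≈ᵛ point ny → SamePoint x y
  same-normalised {x = x} {y} nx ny e = factor⁻¹ nx ⊗ factor ny , λ i → ≈-trans (restore nx i) (≈-trans (*-congˡ (e i))
    (solve 3 (λ a b y → a :* (b :* y) := (a :* b) :* y) ≈-refl (factor⁻¹ nx) (factor ny) (vec y i)))

  -- With f₂(x) = f₁(y) = f₁(z) = 1 and t = f₂(z), collinearity reads z = t x + y.
  module Relation (P₁ P₂ : Plane) {x y z : Point} (x∈ : OnPlane x P₁) (y∈ : OnPlane y P₂)
    (z∉₁ : ¬ OnPlane z P₁) (z∉₂ : ¬ OnPlane z P₂) where
    private
      f₁ = form P₁
      f₂ = form P₂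

    -- The coordinates of x and y with respect to L are proportional, and y ≠ 0 provides a nonzero
    -- coordinate to divide by.
    dependent⇒same : ∀ (L : Line) a b c d → (∀ i → vec x i ≈ᶠ a ⊗ vec (pt₁ L) i ⊕ b ⊗ vec (pt₂ L) i) →
      (∀ i → vec y i ≈ᶠ c ⊗ vec (pt₁ L) i ⊕ d ⊗ vec (pt₂ L) i) → a ⊗ d ⊕ ⊖ (c ⊗ b) ≈ᶠ 0# → DN (SamePoint x y)
    dependent⇒same L a b c d ex ey Δ none = dec (c ≈ᶠ 0#) λ where
      (no c≉0) → let u , e = inverse c c≉0 in none (a ⊗ u , λ i → ≈-trans (ex i) (≈-trans
        (by (⊖ (a ⊗ vec (pt₁ L) i ⊕ b ⊗ vec (pt₂ L) i)) e (by (⊖ (u ⊗ vec (pt₂ L) i)) Δ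
          (solve 7 (λ a b c d u p q → a :* p :+ b :* q := ((a :* u) :* (c :* p :+ d :* q) :+ (:- (a :* p :+ b :* q)) :* (c :* u :- :1)) :+ (:- (u :* q)) :* ((a :* d :- c :* b) :- :0)) ≈-refl
            a b c d u (vec (pt₁ L) i) (vec (pt₂ L) i))))
        (*-congˡ (≈-sym (ey i)))))
      (yes c≈0) → dec (d ≈ᶠ 0#) λ where
        (yes d≈0) → nonzero y λ i → ≈-trans (ey i) (by (vec (pt₁ L) i) c≈0 (by (vec (pt₂ L) i) d≈0
          (solve 4 (λ c d p q → c :* p :+ d :* q := (:0 :+ p :* (c :- :0)) :+ q :* (d :- :0)) ≈-refl c d (vec (pt₁ L) i) (vec (pt₂ L) i))))
        (no d≉0) → let u , e = inverse d d≉0 in none (b ⊗ u , λ i → ≈-trans (ex i) (≈-trans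
          (by (⊖ (a ⊗ vec (pt₁ L) i ⊕ b ⊗ vec (pt₂ L) i)) e (by (u ⊗ vec (pt₁ L) i) Δ
            (solve 7 (λ a b c d u p q → a :* p :+ b :* q := ((b :* u) :* (c :* p :+ d :* q) :+ (:- (a :* p :+ b :* q)) :* (d :* u :- :1)) :+ (u :* p) :* ((a :* d :- c :* b) :- :0)) ≈-refl
              a b c d u (vec (pt₁ L) i) (vec (pt₂ L) i))))
          (*-congˡ (≈-sym (ey i)))))

    -- Cramer's rule for three vectors in the span of L: the coefficients are 2 × 2 minors, and α is
    -- the minor of x and y.
    relation : ¬ SamePoint x y → Collinear x y z →
      Σ F λ α → Σ F λ β → Σ F λ γ → ¬ α ≈ᶠ 0# × (∀ i → (α ⊗ vec z i ⊕ β ⊗ vec x i) ⊕ γ ⊗ vec y i ≈ᶠ 0#)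
    relation x≉y (L , (a , b , ex) , (c , d , ey) , (r , s , ez)) =
      a ⊗ d ⊕ ⊖ (c ⊗ b) , c ⊗ s ⊕ ⊖ (r ⊗ d) , r ⊗ b ⊕ ⊖ (a ⊗ s) , (λ Δ → dependent⇒same L a b c d ex ey Δ x≉y) ,
      λ i → ≈-trans (+-cong (+-cong (*-congˡ (ez i)) (*-congˡ (ex i))) (*-congˡ (ey i)))
        (solve 8 (λ a b c d r s p q → ((a :* d :- c :* b) :* (r :* p :+ s :* q) :+ (c :* s :- r :* d) :* (a :* p :+ b :* q)) :+ (r :* b :- a :* s) :* (c :* p :+ d :* q) := :0) ≈-refl
          a b c d r s (vec (pt₁ L) i) (vec (pt₂ L) i))

    dot-relation : ∀ f α β γ → (∀ i → (α ⊗ vec z i ⊕ β ⊗ vec x i) ⊕ γ ⊗ vec y i ≈ᶠ 0#) →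
      (α ⊗ dot f (vec z) ⊕ β ⊗ dot f (vec x)) ⊕ γ ⊗ dot f (vec y) ≈ᶠ 0#
    dot-relation f α β γ h = ≈-trans (≈-sym expand) (≈-trans (dot-cong f {w = λ _ → 0#} (λ i → ≈-trans (+-congʳ (one _)) (h i)))
        (solve 4 (λ a b c d → (a :* :0 :+ b :* :0) :+ (c :* :0 :+ d :* :0) := :0) ≈-refl (f 0F) (f 1F) (f 2F) (f 3F)))
      where
      one : ∀ a → 1# ⊗ a ≈ᶠ a
      one = solve 1 (λ a → :1 :* a := a) ≈-refl
      expand : dot f (λ i → 1# ⊗ (α ⊗ vec z i ⊕ β ⊗ vec x i) ⊕ γ ⊗ vec y i) ≈ᶠ (α ⊗ dot f (vec z) ⊕ β ⊗ dot f (vec x)) ⊕ γ ⊗ dot f (vec y)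
      expand = ≈-trans (dot-linear f 1# γ (λ i → α ⊗ vec z i ⊕ β ⊗ vec x i) (vec y))
        (+-congʳ (≈-trans (one _) (dot-linear f α β (vec z) (vec x))))

    -- f₁ vanishes at x and f₂ at y, so the two forms applied to the relation express γ and β by α.
    -- The same equations show that f₂(x) and f₁(y) are nonzero, because z lies on neither plane.
    normal-form : (nx : Normalised f₂ x) (ny : Normalised f₁ y) (nz : Normalised f₁ z) → ¬ SamePoint x y → Collinear x y z →
      ∀ i → ⊖ dot f₂ (point nz) ⊗ point nx i ⊕ point nz i ≈ᶠ point ny i
    normal-form nx ny nz x≉y col i = -≈0⇒≈ (nonzero-cancel α≉0 final)
      where
      rel = relation x≉y col
      α = proj₁ rel
      β = proj₁ (proj₂ rel)
      γ = proj₁ (proj₂ (proj₂ rel))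
      α≉0 = proj₁ (proj₂ (proj₂ (proj₂ rel)))
      R : ∀ i → (α ⊗ vec z i ⊕ β ⊗ vec x i) ⊕ γ ⊗ vec y i ≈ᶠ 0#
      R = proj₂ (proj₂ (proj₂ (proj₂ rel)))
      R₁ = dot-relation f₁ α β γ R
      R₂ = dot-relation f₂ α β γ R
      x∉ : ¬ dot f₂ (vec x) ≈ᶠ 0#
      x∉ e = z∉₂ (nonzero-cancel α≉0 (by 1# R₂ (by (⊖ β) e (by (⊖ γ) y∈
        (solve 6 (λ a b c z x y → a :* z := (((:0 :+ :1 :* (((a :* z :+ b :* x) :+ c :* y) :- :0)) :+ (:- b) :* (x :- :0)) :+ (:- c) :* (y :- :0))) ≈-refl
          α β γ (dot f₂ (vec z)) (dot f₂ (vec x)) (dot f₂ (vec y)))))))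
      y∉ : ¬ dot f₁ (vec y) ≈ᶠ 0#
      y∉ e = z∉₁ (nonzero-cancel α≉0 (by 1# R₁ (by (⊖ β) x∈ (by (⊖ γ) e
        (solve 6 (λ a b c z x y → a :* z := (((:0 :+ :1 :* (((a :* z :+ b :* x) :+ c :* y) :- :0)) :+ (:- b) :* (x :- :0)) :+ (:- c) :* (y :- :0))) ≈-refl
          α β γ (dot f₁ (vec z)) (dot f₁ (vec x)) (dot f₁ (vec y)))))))
      cx = factor nx
      cy = factor ny
      cz = factor nz
      vx : cx ⊗ dot f₂ (vec x) ≈ᶠ 1#
      vx = ≈-trans (≈-sym (dot-scale f₂ cx (vec x))) (off nx x∉)
      vy : cy ⊗ dot f₁ (vec y) ≈ᶠ 1#
      vy = ≈-trans (≈-sym (dot-scale f₁ cy (vec y))) (off ny y∉)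
      vz : cz ⊗ dot f₁ (vec z) ≈ᶠ 1#
      vz = ≈-trans (≈-sym (dot-scale f₁ cz (vec z))) (off nz z∉₁)
      αz₁ : α ⊗ dot f₁ (vec z) ≈ᶠ ⊖ (γ ⊗ dot f₁ (vec y))
      αz₁ = by 1# R₁ (by (⊖ β) x∈ (solve 6 (λ a b c z x y → a :* z := ((:- (c :* y) :+ :1 :* (((a :* z :+ b :* x) :+ c :* y) :- :0)) :+ (:- b) :* (x :- :0))) ≈-refl
        α β γ (dot f₁ (vec z)) (dot f₁ (vec x)) (dot f₁ (vec y))))
      αz₂ : α ⊗ dot f₂ (vec z) ≈ᶠ ⊖ (β ⊗ dot f₂ (vec x))
      αz₂ = by 1# R₂ (by (⊖ γ) y∈ (solve 6 (λ a b c z x y → a :* z := ((:- (b :* x) :+ :1 :* (((a :* z :+ b :* x) :+ c :* y) :- :0)) :+ (:- c) :* (y :- :0))) ≈-refl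
        α β γ (dot f₂ (vec z)) (dot f₂ (vec x)) (dot f₂ (vec y))))
      αz₂cx : α ⊗ dot f₂ (vec z) ⊗ cx ≈ᶠ ⊖ β
      αz₂cx = by cx αz₂ (by (⊖ β) vx (solve 5 (λ a b z x c → a :* z :* c := ((:- b :+ c :* (a :* z :- (:- (b :* x)))) :+ (:- b) :* (c :* x :- :1))) ≈-refl
        α β (dot f₂ (vec z)) (dot f₂ (vec x)) cx))
      αcy : α ⊗ cy ≈ᶠ ⊖ (cz ⊗ γ)
      αcy = by (cy ⊗ cz) αz₁ (by (⊖ (cz ⊗ γ)) vy (by (⊖ (α ⊗ cy)) vz
        (solve 6 (λ a c cy cz z y → a :* cy := (((:- (cz :* c) :+ (cy :* cz) :* (a :* z :- (:- (c :* y)))) :+ (:- (cz :* c)) :* (cy :* y :- :1)) :+ (:- (a :* cy)) :* (cz :* z :- :1))) ≈-refl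
          α γ cy cz (dot f₁ (vec z)) (dot f₁ (vec y)))))
      final : α ⊗ ((⊖ dot f₂ (point nz) ⊗ point nx i ⊕ point nz i) ⊕ ⊖ point ny i) ≈ᶠ 0#
      final = ≈-trans (*-congˡ (+-congʳ (+-congʳ (*-congʳ (-‿cong (dot-scale f₂ cz (vec z)))))))
        (by cz (R i) (by (⊖ (cz ⊗ vec x i)) αz₂cx (by (⊖ vec y i) αcy
          (solve 10 (λ a b c cx cy cz x y z w → a :* (((:- (cz :* w)) :* (cx :* x) :+ cz :* z) :- cy :* y) :=
              (((:0 :+ cz :* (((a :* z :+ b :* x) :+ c :* y) :- :0)) :+ (:- (cz :* x)) :* (a :* w :* cx :- (:- b))) :+ (:- y) :* (a :* cy :- (:- (cz :* c))))) ≈-refl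
            α β γ cx cy cz (vec x i) (vec y i) (vec z i) (dot f₂ (vec z))))))

-- The configuration

module Configuration {k ℓ} (K : Field k ℓ) where
  open Affine K 4
  open Proj K
  open Geometry K
  open Normalised

  module Maps (P₁ P₂ : Plane) (P₁≉P₂ : ¬ SamePlane P₁ P₂) {n : ℕ} (X₃ : Fin n → Point) (X₃-inj : Injective X₃)
    (X₃-off : ∀ i → ¬ OnPlane (X₃ i) P₁ × ¬ OnPlane (X₃ i) P₂) where

    N₃ : ∀ i → Normalised (form P₁) (X₃ i)
    N₃ i = normalise-off (form P₁) (X₃ i) (proj₁ (X₃-off i))

    u : Fin n → V
    u i = point (N₃ i)

    f₁u : ∀ i → dot (form P₁) (u i) ≈ᶠ 1#
    f₁u i = off (N₃ i) (proj₁ (X₃-off i))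

    t : Fin n → F
    t i = dot (form P₂) (u i)

    t≉0 : ∀ i → ¬ t i ≈ᶠ 0#
    t≉0 i e = proj₂ (X₃-off i) (nonzero-cancel factor≉0 (≈-trans (≈-sym (dot-scale (form P₂) (factor (N₃ i)) (vec (X₃ i)))) e))
      where
      factor≉0 : ¬ factor (N₃ i) ≈ᶠ 0#
      factor≉0 h = 0≉1 (≈-trans (≈-sym (≈-trans (*-congʳ h) (zeroˡ _))) (factor-unit (N₃ i)))

    g : Fin n → Aff
    g i = aff (⊖ t i) (⊖ t′) (u i) (≈-trans (solve 2 (λ a b → (:- a) :* (:- b) := a :* b) ≈-refl (t i) t′) (proj₂ (inverse (t i) (t≉0 i))))
      where
      t′ = proj₁ (inverse (t i) (t≉0 i))

    u-inj : ∀ i j → u i ≈ᵛ u j → i ≡ j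
    u-inj i j e = X₃-inj i j (same-normalised (N₃ i) (N₃ j) e)

    -- The maps with linear part s come from points of the plane f₂ + s f₁ = 0 of the pencil. Its
    -- form is nonzero: the index i₀ gives s ≠ 0, and the two planes are distinct.
    pencil : CommonLine.Common P₁ P₂ → ∀ s i₀ → ⊖ t i₀ ≈ᶠ s → Σ Plane λ P →
      Σ Line (λ L → LineInPlane L P × LineInPlane L P₁ × LineInPlane L P₂) × (∀ i → ⊖ t i ≈ᶠ s → OnPlane (X₃ i) P)
    pencil (L , L₁ , L₂) s i₀ e₀ = P , (L , in-plane L P (line-on (pt₁ L) one) (line-on (pt₂ L) two) , L₁ , L₂) , on
      where
      f₁ = form P₁
      f₂ = form P₂
      one : OnLine (pt₁ L) L
      one = 1# , 0# , λ i → solve 2 (λ x y → x := :1 :* x :+ :0 :* y) ≈-refl (vec (pt₁ L) i) (vec (pt₂ L) i)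
      two : OnLine (pt₂ L) L
      two = 0# , 1# , λ i → solve 2 (λ x y → y := :0 :* x :+ :1 :* y) ≈-refl (vec (pt₁ L) i) (vec (pt₂ L) i)
      t₀ = t i₀
      t₀′ = proj₁ (inverse t₀ (t≉0 i₀))
      form₀ : Vec4
      form₀ i = 1# ⊗ f₂ i ⊕ s ⊗ f₁ i
      P : Plane
      P = mkPlane form₀ λ h → P₁≉P₂ (t₀′ , λ i → by (⊖ t₀′) (h i) (by (⊖ (t₀′ ⊗ f₁ i)) e₀ (by (⊖ f₁ i) (proj₂ (inverse t₀ (t≉0 i₀)))
        (solve 5 (λ a b s t t′ → a := ((t′ :* b :+ (:- t′) :* ((:1 :* b :+ s :* a) :- :0)) :+ (:- (t′ :* a)) :* ((:- t) :- s)) :+ (:- a) :* (t :* t′ :- :1)) ≈-refl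
          (f₁ i) (f₂ i) s t₀ t₀′))))
      dot-form₀ : ∀ v → dot form₀ v ≈ᶠ 1# ⊗ dot f₂ v ⊕ s ⊗ dot f₁ v
      dot-form₀ v = ≈-trans (dot-comm form₀ v) (≈-trans (dot-linear v 1# s f₂ f₁) (+-cong (*-congˡ (dot-comm v f₂)) (*-congˡ (dot-comm v f₁))))
      line-on : ∀ x → OnLine x L → OnPlane x P
      line-on x h = ≈-trans (dot-form₀ (vec x)) (by 1# (L₂ x h) (by s (L₁ x h)
        (solve 3 (λ a b s → :1 :* a :+ s :* b := (:0 :+ :1 :* (a :- :0)) :+ s :* (b :- :0)) ≈-refl (dot f₂ (vec x)) (dot f₁ (vec x)) s)))
      on : ∀ i → ⊖ t i ≈ᶠ s → OnPlane (X₃ i) P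
      on i e = ≈-trans (dot-cong form₀ (restore (N₃ i))) (≈-trans (dot-scale form₀ (factor⁻¹ (N₃ i)) (u i))
        (≈-trans (*-congˡ (≈-trans (dot-form₀ (u i)) (by (⊖ 1#) e (by s (f₁u i)
          (solve 3 (λ t s x → :1 :* t :+ s :* x := (:0 :+ (:- :1) :* ((:- t) :- s)) :+ s :* (x :- :1)) ≈-refl (t i) s (dot f₁ (u i)))))))
          (zeroʳ _)))

    -- These points are u i = w + t i v, on a line parametrised by t. Different indices have
    -- different t, and interpolation in t gives the coefficients.
    through : ∀ v w i₀ i₁ → i₀ ≢ i₁ → act (g i₀) v ≈ᵛ w → act (g i₁) v ≈ᵛ w →
      Σ Line λ L → ∀ i → act (g i) v ≈ᵛ w → OnLine (X₃ i) L
    through v w i₀ i₁ ne e₀ e₁ = mkLine (X₃ i₀) (X₃ i₁) (λ same → ne (X₃-inj i₀ i₁ same)) , on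
      where
      t₀≉t₁ : ¬ t i₀ ⊕ ⊖ t i₁ ≈ᶠ 0#
      t₀≉t₁ h = ne (u-inj i₀ i₁ λ j → by 1# (≈-trans (e₀ j) (≈-sym (e₁ j))) (by (v j) h
        (solve 5 (λ t t′ v u u′ → u := (u′ :+ :1 :* (((:- t) :* v :+ u) :- ((:- t′) :* v :+ u′))) :+ v :* ((t :- t′) :- :0)) ≈-refl (t i₀) (t i₁) (v j) (u i₀ j) (u i₁ j))))
      δ = proj₁ (inverse (t i₀ ⊕ ⊖ t i₁) t₀≉t₁)
      δ-inv = proj₂ (inverse (t i₀ ⊕ ⊖ t i₁) t₀≉t₁)
      on : ∀ i → act (g i) v ≈ᵛ w → OnLine (X₃ i) (mkLine (X₃ i₀) (X₃ i₁) (λ same → ne (X₃-inj i₀ i₁ same)))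
      on i e = c′ ⊗ ((1# ⊕ λ₀) ⊗ factor (N₃ i₀)) , c′ ⊗ (⊖ λ₀ ⊗ factor (N₃ i₁)) , λ j → ≈-trans (restore (N₃ i) j)
        (≈-trans (*-congˡ (combine j)) (solve 6 (λ c l a b x y → c :* ((:1 :+ l) :* (a :* x) :+ (:- l) :* (b :* y)) := (c :* ((:1 :+ l) :* a)) :* x :+ (c :* ((:- l) :* b)) :* y) ≈-refl
          c′ λ₀ (factor (N₃ i₀)) (factor (N₃ i₁)) (vec (X₃ i₀) j) (vec (X₃ i₁) j)))
        where
        c′ = factor⁻¹ (N₃ i)
        λ₀ : F
        λ₀ = (t i ⊕ ⊖ t i₀) ⊗ δ
        combine : ∀ j → u i j ≈ᶠ (1# ⊕ λ₀) ⊗ u i₀ j ⊕ ⊖ λ₀ ⊗ u i₁ j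
        combine j = by 1# (≈-trans (e j) (≈-sym (e₀ j))) (by (⊖ λ₀) (≈-trans (e₀ j) (≈-sym (e₁ j))) (by (⊖ ((t i ⊕ ⊖ t i₀) ⊗ v j)) δ-inv
          (solve 8 (λ t t₀ t₁ d v u u₀ u₁ → u := ((((:1 :+ (t :- t₀) :* d) :* u₀ :+ (:- ((t :- t₀) :* d)) :* u₁)
               :+ :1 :* (((:- t) :* v :+ u) :- ((:- t₀) :* v :+ u₀)))
               :+ (:- ((t :- t₀) :* d)) :* (((:- t₀) :* v :+ u₀) :- ((:- t₁) :* v :+ u₁)))
               :+ (:- ((t :- t₀) :* v)) :* ((t₀ :- t₁) :* d :- :1)) ≈-refl
            (t i) (t i₀) (t i₁) δ (v j) (u i j) (u i₀ j) (u i₁ j))))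

-- Deduction of the bound on collinear triples

root-in-range : ∀ R → 0 < R → ∀ n → 2 ^ R ≤ n → Σ ℕ λ y → 2 ≤ y × y ^ R ≤ n × n < y ^ (2 * R)
root-in-range R R>0 n 2^R≤n with root R R>0 n
... | y , lo , hi = y , 2≤y , lo , <-≤-trans hi (≤-trans (^-monoˡ-≤ R 1+y≤y²) (≤-reflexive (^-*-assoc y 2 R)))
  where
  2≤y : 2 ≤ y
  2≤y = ≰⇒> λ y≤1 → <⇒≱ hi (≤-trans (^-monoˡ-≤ R (s≤s y≤1)) 2^R≤n)
  -- This replaces the upper bound (1 + y)^R of the integer root by a power of y, at the cost of the
  -- factor 2 in `2 * R`.
  1+y≤y² : suc y ≤ y ^ 2
  1+y≤y² = ≤-trans (+-mono-≤ (≤-trans (s≤s z≤n) 2≤y) (m≤m+n y 0)) (≤-trans (*-monoˡ-≤ y 2≤y) (≤-reflexive (cong (y *_) (sym (*-identityʳ y)))))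

module Bound (a b J : ℕ) (0<a : 0 < a) (0<b : 0 < b) (64b≤2^J : 64 * b ≤ 2 ^ J)
  (β C f g′ e R : ℕ) (β≡ : β ≡ 57 + 1277 * 13 ^ J) (C≡ : C ≡ 61 + β) (f≡ : f ≡ 1 + 2 * (b * C))
  (g≡ : g′ ≡ 2 + 2 * (2 * 2 ^ f)) (e≡ : e ≡ g′ * C) (R≡ : R ≡ b * e)
  (n y : ℕ) (2≤y : 2 ≤ y) (y^R≤n : y ^ R ≤ n) (n<y^2R : n < y ^ (2 * R)) where

  open Numerics b J 0<b 64b≤2^J β C f g′ e R β≡ C≡ f≡ g≡ e≡ R≡ y n 2≤y y^R≤n n<y^2R

  -- y N < n² and n < y^(2R) give N ≤ n^(2 - 1/(2R)); this is where δ comes from.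
  few-triples : ∀ N → y * N < n * n → AtMostPow2Minus N n 1 (2 * R)
  few-triples N h = begin
    N ^ (2 * R) * n ^ 1            ≡⟨ cong (N ^ (2 * R) *_) (*-identityʳ n) ⟩
    N ^ (2 * R) * n                ≤⟨ *-monoʳ-≤ (N ^ (2 * R)) (<⇒≤ n<y^2R) ⟩
    N ^ (2 * R) * y ^ (2 * R)      ≡⟨ ^-distribʳ-* (2 * R) N y ⟨
    (N * y) ^ (2 * R)              ≤⟨ ^-monoˡ-≤ (2 * R) (≤-trans (≤-reflexive (*-comm N y)) (<⇒≤ h)) ⟩
    (n * n) ^ (2 * R)              ≡⟨ cong (λ x → (n * x) ^ (2 * R)) (*-identityʳ n) ⟨
    (n ^ 2) ^ (2 * R)              ≡⟨ ^-*-assoc n 2 (2 * R) ⟩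
    n ^ (2 * (2 * R))              ∎
    where open ≤-Reasoning

  module Many {k ℓ} (K : Field k ℓ) where
    open Affine K 4
    open Proj K
    open Geometry K
    open Normalised
    open Flattening K 4 using (Injectiveᵛ; module Family)
    open Iteration K 4 using (module Loop)
    open Group affineGroup using () renaming (_≈_ to _≈ᴳ_)

    module _ (P₁ P₂ : Plane) (P₁≉P₂ : ¬ SamePlane P₁ P₂) (X₁ X₂ X₃ : Fin n → Point)
      (X₁-inj : Injective X₁) (X₂-inj : Injective X₂) (X₃-inj : Injective X₃)
      (X₁-on : ∀ i → OnPlane (X₁ i) P₁) (X₂-on : ∀ i → OnPlane (X₂ i) P₂)
      (X₃-off : ∀ i → ¬ OnPlane (X₃ i) P₁ × ¬ OnPlane (X₃ i) P₂)
      (char : ∀ p → HasCharacteristic p → n ^ 48 < p)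
      (planes : ∀ (P : Plane) → Σ Line (λ L → LineInPlane L P × LineInPlane L P₁ × LineInPlane L P₂) →
        CardBound (λ i → OnPlane (X₃ i) P) (λ m → AtMostPowMinus m n a b))
      (lines : ∀ (L : Line) → CardBound (λ i → OnLine (X₃ i) L) (λ m → AtMostPowMinus m n a b)) where

      open Configuration.Maps K P₁ P₂ P₁≉P₂ X₃ X₃-inj X₃-off
      open Family (finite-Fin n) g
      open ≤-Reasoning

      m≡n : m ≡ n
      m≡n = length-allFin n

      B₀ : ℕ
      B₀ = L ^ 61 * B

      Bounded : List (Fin n) → Set
      Bounded xs = length xs * B₀ ≤ n

      scale-bounded : CommonLine.Common P₁ P₂ → ∀ s xs → Unique xs → All (λ i → scale (g i) ≈ᶠ s) xs → Bounded xs
      scale-bounded common s []           u h = z≤n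
      scale-bounded common s xs@(i₀ ∷ _) u h@(h₀ ∷ _) = let P , L , on = pencil common s i₀ h₀ in
        spread a (length xs) 0<a (planes P L xs u (All.map (λ {i} → on i) h))

      point-bounded : ∀ v w xs → Unique xs → All (λ i → act (g i) v ≈ᵛ w) xs → Bounded xs
      point-bounded v w []                u h = z≤n
      -- A single point determines no line; the bound is then y^e ≤ n.
      point-bounded v w (_ ∷ [])          u h = ≤-trans (≤-reflexive (*-identityˡ B₀)) L^61B≤n
      point-bounded v w xs@(i₀ ∷ i₁ ∷ _) u@((ne ∷ _) ∷ _) h@(h₀ ∷ h₁ ∷ _) = let L , on = through v w i₀ i₁ ne h₀ h₁ in
        spread a (length xs) 0<a (lines L xs u (All.map (λ {i} → on i) h))

      filtered : ∀ {p} {P : Fin n → Set p} (d : ∀ i → Dec (P i)) → Bounded (filter d (allFin n)) → ∑ (allFin n) (𝟙 ∘ d) * B₀ ≤ m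
      filtered d h = ≤-trans (≤-reflexive (cong (_* B₀) (sym (length-filter≡∑ d (allFin n))))) (≤-trans h (≤-reflexive (sym m≡n)))

      is-spread : CommonLine.Common P₁ P₂ → Spread B₀
      is-spread common =
          (λ s d → filtered d (scale-bounded common s (filter d (allFin n)) (Unique.filter⁺ d (Unique.allFin⁺ n)) (All.all-filter d (allFin n))))
        , (λ v w d → filtered d (point-bounded v w (filter d (allFin n)) (Unique.filter⁺ d (Unique.allFin⁺ n)) (All.all-filter d (allFin n))))

      module _ (N₁ : ∀ i → Normalised (form P₂) (X₁ i)) (N₂ : ∀ i → Normalised (form P₁) (X₂ i))
        (xs : List (Fin n × Fin n × Fin n)) (xs-unique : Unique xs)
        (xs-collinear : All (λ t → DistinctCollinear (X₁ (Σ.proj₁ t)) (X₂ (Σ.proj₁ (Σ.proj₂ t))) (X₃ (Σ.proj₂ (Σ.proj₂ t)))) xs) where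

        A₁ A₂ : Fin n → V
        A₁ i = point (N₁ i)
        A₂ i = point (N₂ i)

        A₁-inj : Injectiveᵛ A₁
        A₁-inj i j h = X₁-inj i j (same-normalised (N₁ i) (N₁ j) h)

        A₂-inj : Injectiveᵛ A₂
        A₂-inj i j h = X₂-inj i j (same-normalised (N₂ i) (N₂ j) h)

        incident : ∀ {i j l} → DistinctCollinear (X₁ i) (X₂ j) (X₃ l) → Incidence A₁ A₂ l i j
        incident {i} {j} {l} (ne , _ , _ , col) = Relation.normal-form P₁ P₂ (X₁-on i) (X₂-on j) (proj₁ (X₃-off l)) (proj₂ (X₃-off l))
          (N₁ i) (N₂ j) (N₃ l) ne col

        module _ (_~?_ : ∀ i j → Dec (g i ≈ᴳ g j)) (c? : ∀ l i j → Dec (Incidence A₁ A₂ l i j)) where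

          all-n : List (Fin n)
          all-n = allFin n

          triples : List (Fin n × Fin n × Fin n)
          triples = cartesianProduct all-n (cartesianProduct all-n all-n)

          IncidentTriple : Fin n × Fin n × Fin n → Set ℓ
          IncidentTriple (l , i , j) = Incidence A₁ A₂ l i j

          triple? : ∀ t → Dec (IncidentTriple t)
          triple? (l , i , j) = c? l i j

          count : length xs ≤ Incidences.incidences A₁ A₂ A₁-inj A₂-inj c?
          count = begin
            length xs ≡⟨ length-map rotate xs ⟨
            length (map rotate xs) ≤⟨ unique-count {P = IncidentTriple} triple? {map rotate xs} {triples} (Unique.map⁺ rotate-injective xs-unique) (λ _ → full _) incident-triple ⟩
            ∑ triples (𝟙 ∘ triple?) ≡⟨ ∑-cartesianProduct all-n (cartesianProduct all-n all-n) (𝟙 ∘ triple?) ⟩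
            ∑ all-n (λ l → ∑ (cartesianProduct all-n all-n) (λ p → 𝟙 (triple? (l , p)))) ≡⟨ ∑-cong all-n (λ l → ∑-cartesianProduct all-n all-n (λ p → 𝟙 (triple? (l , p)))) ⟩
            Incidences.incidences A₁ A₂ A₁-inj A₂-inj c? ∎
            where
            rotate : Fin n × Fin n × Fin n → Fin n × Fin n × Fin n
            rotate (i , j , l) = l , i , j
            rotate-injective : ∀ {t t′} → rotate t ≡ rotate t′ → t ≡ t′
            rotate-injective refl = refl
            full : ∀ t → t ∈ triples
            full = proj₂ (finite-Fin n ×-finite (finite-Fin n ×-finite finite-Fin n))
            rotated : ∀ i j l → DistinctCollinear (X₁ i) (X₂ j) (X₃ l) → IncidentTriple (l , i , j)
            rotated i j l h = incident {i} {j} {l} h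
            incident-triple : ∀ {z} → z ∈ map rotate xs → IncidentTriple z
            incident-triple {z} z∈ = let (i , j , l) , t∈ , z≡ = ∈-map⁻ rotate z∈ in
              subst IncidentTriple (sym z≡) (rotated i j l (All.lookup xs-collinear t∈))

          energy≤n : energy _~?_ ≤ n
          energy≤n = begin
            energy _~?_ ≤⟨ ∑-≤const all-n 1 (λ {i} _ → ∑𝟙≤1 (i ~?_) (λ {j} {j′} ne h h′ → ne (u-inj j j′ (λ v → ≈-trans (≈-sym (shift≈ h v)) (shift≈ h′ v)))) (Unique.allFin⁺ n)) ⟩
            m * 1 ≡⟨ trans (*-identityʳ m) m≡n ⟩
            n ∎

          impossible : CommonLine.Common P₁ P₂ → n * n ≤ y * length xs → ⊥
          -- The start is z = y and x = 1: the density is at least 1/y, and the n distinct maps have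
          -- effective size at least n.
          impossible common rich = Loop.iterate L 2≤L B J Z 2Z²≤n large larger (λ p h → ≤-<-trans Ω^16≤n^48 (char p h))
            f (finite-Fin n) g _~?_ A₁ A₂ A₁-inj A₂-inj c? y 1
            (subst (0 <_) (sym m≡n) (≤-trans (s≤s z≤n) 2≤n)) (≤-trans (s≤s z≤n) 2≤y) ≤-refl (is-spread common)
            (≤-trans (≤-reflexive (cong (_* n) m≡n)) (≤-trans rich (*-monoʳ-≤ y count)))
            (≤-trans (*-monoˡ-≤ n (≤-trans (≤-reflexive (*-identityʳ (energy _~?_))) energy≤n)) (≤-reflexive (sym (cong₂ _*_ m≡n m≡n))))
            big
            where
            instance
              n-nonZero : NonZero n
              n-nonZero = >-nonZero (≤-trans (s≤s z≤n) 2≤n)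

      conclusion : CardBound {A = Fin n × Fin n × Fin n}
        (λ t → DistinctCollinear (X₁ (Σ.proj₁ t)) (X₂ (Σ.proj₁ (Σ.proj₂ t))) (X₃ (Σ.proj₂ (Σ.proj₂ t))))
        (λ m → AtMostPow2Minus m n 1 (2 * R))
      conclusion xs unique collinear = by-size (y * length xs <? n * n)
        where
        by-size : Dec (y * length xs < n * n) → AtMostPow2Minus (length xs) n 1 (2 * R)
        by-size (yes lt) = few-triples (length xs) lt
        by-size (no ge)  = ⊥-elim (
          choice (finite-Fin n) (λ i → normalise (form P₂) (X₁ i)) λ N₁ →
          choice (finite-Fin n) (λ i → normalise (form P₁) (X₂ i)) λ N₂ →
          CommonLine.common-line P₁ P₂ P₁≉P₂ λ common →
          decide₂ (finite-Fin n) (finite-Fin n) (λ i j → g i ≈ᴳ g j) λ _~?_ →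
          decide₂ (finite-Fin n) (finite-Fin n ×-finite finite-Fin n) (λ l (i , j) → Incidence (λ i → point (N₁ i)) (λ i → point (N₂ i)) l i j) λ d →
          impossible N₁ N₂ xs unique collinear _~?_ (λ l i j → d l (i , j)) common (≮⇒≥ ge))

theorem4p7 : (a b : ℕ) → 0 < a → 0 < b →
    Σω ℕ λ N → Σω ℕ λ c → Σω ℕ λ d → Σω ℕ λ n₀ →
    (1 ≤ N × 0 < c × 0 < d) ×ω
    (∀ {k ℓ} (K : Field k ℓ) → let open Proj K in
    (P₁ P₂ : Plane) → ¬ SamePlane P₁ P₂ →
    (n : ℕ) → n₀ ≤ n →
    (X₁ X₂ X₃ : Fin n → Point) →
    Injective X₁ → Injective X₂ → Injective X₃ →
    (∀ i → OnPlane (X₁ i) P₁) →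
    (∀ i → OnPlane (X₂ i) P₂) →
    (∀ i → ¬ OnPlane (X₃ i) P₁ × ¬ OnPlane (X₃ i) P₂) →
    (∀ p → HasCharacteristic p → n ^ N < p) →
    (∀ (P : Plane) →
    Σ Line (λ L → LineInPlane L P × LineInPlane L P₁ × LineInPlane L P₂) →
    CardBound (λ i → OnPlane (X₃ i) P) (λ m → AtMostPowMinus m n a b)) →
    (∀ (L : Line) → LineInPlane L P₁ →
    CardBound (λ i → OnLine (X₁ i) L) (λ m → AtMostPowMinus m n a b)) →
    (∀ (L : Line) → LineInPlane L P₂ →
    CardBound (λ i → OnLine (X₂ i) L) (λ m → AtMostPowMinus m n a b)) →
    (∀ (L : Line) →
    CardBound (λ i → OnLine (X₃ i) L) (λ m → AtMostPowMinus m n a b)) →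
    CardBound {A = Fin n × Fin n × Fin n}
    (λ t → DistinctCollinear (X₁ (Σ.proj₁ t)) (X₂ (Σ.proj₁ (Σ.proj₂ t)))
    (X₃ (Σ.proj₂ (Σ.proj₂ t))))
    (λ m → AtMostPow2Minus m n c d))
theorem4p7 a b 0<a 0<b =
  -- Since ε = a/b ≥ 1/b, the constants are computed from b. The threshold 2^R ensures y ≥ 2.
  48 ,ω (1 ,ω ((2 * R) ,ω ((2 ^ R) ,ω ((s≤s z≤n , s≤s z≤n , *-mono-< {0} {2} {0} {R} (s≤s z≤n) R>0) ,ω'
  λ K P₁ P₂ P₁≉P₂ n n₀≤n X₁ X₂ X₃ X₁-inj X₂-inj X₃-inj X₁-on X₂-on X₃-off char planes _ _ lines →
    let y , 2≤y , y^R≤n , n<y^2R = root-in-range R R>0 n n₀≤n in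
    Bound.Many.conclusion a b J 0<a 0<b 64b≤2^J β C f g e R refl refl refl refl refl refl n y 2≤y y^R≤n n<y^2R
      K P₁ P₂ P₁≉P₂ X₁ X₂ X₃ X₁-inj X₂-inj X₃-inj X₁-on X₂-on X₃-off char planes lines))))
  where
  J β C f g e R : ℕ
  -- Chosen so that 2^J = 64 · 2^b ≥ 64 b.
  J = 6 + b
  β = 57 + 1277 * 13 ^ J
  C = 61 + β
  f = 1 + 2 * (b * C)
  g = 2 + 2 * (2 * 2 ^ f)
  e = g * C
  R = b * e
  R>0 : 0 < R
  R>0 = *-mono-< {0} {b} {0} {e} 0<b (s≤s z≤n)
  n<2^n : ∀ n → n < 2 ^ n
  n<2^n zero    = s≤s z≤n
  n<2^n (suc n) = ≤-trans (+-mono-≤ (m^n>0 2 n) (n<2^n n)) (≤-reflexive (cong (2 ^ n +_) (sym (+-identityʳ (2 ^ n)))))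
  64b≤2^J : 64 * b ≤ 2 ^ J
  64b≤2^J = ≤-trans (*-monoʳ-≤ 64 (<⇒≤ (n<2^n b))) (≤-reflexive (sym (^-distribˡ-+-* 2 6 b)))
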